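{- For every $\varepsilon > 0$ there exist positive constants $\beta$, $\delta$, $\lambda$, $C$ such that the following holds for all $\ell$ and $n$ with $\ell \ge C\sqrt{n}$. Suppose that $\mathcal{P} = (M,E)$ is a pregraph on $n$ vertices with $e(E) \le \binom{\ell}{2}$ and that at least one of the following holds: (M1) $e(M) \ge 4\ell n$; (M2) $e(M) \ge (1-\delta)\ell n$, $E$ is not $\varepsilon$-close to $K_\ell$, and $\ell \le \lambda n$; (M3) there exists $U \subseteq V(K_n)$ with $|U| = \ell$, $e_E(U) \ge (1-\varepsilon)\binom{\ell}{2}$, and $e_M(U^c) \ge 7\sqrt{\varepsilon}\,\ell n$. Then there exist $i \in \{0,1,2\}$ and $\mathcal{H}_i \subseteq \mathcal{H}_i^{\mathcal{P}}$ such that \[ e(\mathcal{H}_i) \ge \beta\ell^4,\qquad \Delta_{(0,1)}(\mathcal{H}_i) \le \frac{\ell^3}{n}, \qquad \Delta_{(0,2)}(\mathcal{H}_i) \le \ell, \] and, if $i > 0$, then also $\Delta_{(1,0)}(\mathcal{H}_i) \le \ell^2$.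
   Context: A pregraph on $n$ vertices is a pair $\mathcal{P}=(M,E)$ of disjoint subsets of $E(K_n)$ (edges $E$, mixed edges $M$); $e(X)=|X|$, $e_X(U)$ is the number of elements of $X$ with both endpoints in $U$, and $U^c = V(K_n)\setminus U$. A good copy of $C_4$ in $\mathcal{P}$ is a $4$-cycle with all four edges in $M$ whose vertex set spans no element of $E$. A graph is $\varepsilon$-close to $K_\ell$ if it can be turned into a complete graph on some $\ell$ vertices (plus isolated vertices) by adding or deleting at most $\varepsilon\binom{\ell}{2}$ edges. For $i\in\{0,1,2\}$, $\mathcal{H}_i^{\mathcal{P}}$ is the hypergraph with vertex set $M$ consisting of all pairs $(A,B)$ such that $B$ is (the edge set of) a good copy of $C_4$ whose vertex set induces exactly $4+i$ elements of $M$, and $A$ is the set of the remaining $i$ elements of $M$ induced by this vertex set. For a hypergraph $\mathcal{H}$ of such pairs and disjoint sets $T_0,T_1$ of elements of $M$, $\deg_{\mathcal{H}}(T_0,T_1)$ is the number of $(A,B)\in\mathcal{H}$ with $T_0\subseteq A$ and $T_1\subseteq B$, and $\Delta_{(\ell_0,\ell_1)}(\mathcal{H})$ is its maximum over $|T_0|=\ell_0$, $|T_1|=\ell_1$; $e(\mathcal{H})$ is the number of pairs in $\mathcal{H}$.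
   Formalization: The formal theorem takes ε to be a positive rational number instead of a positive real (the constants β, δ, λ, C obtained are rational too), and it assumes n ≥ 1. -}

module Defs where

open import Data.Nat using (ℕ; zero; suc; _+_; _*_; _<_; _<ᵇ_)
open import Data.Nat.Combinatorics using (_C_)
open import Data.Bool using (Bool; true; false; if_then_else_; _∧_; _∨_; not; _xor_)
open import Data.Fin using (Fin; toℕ)
open import Data.Fin.Properties using (_≟_)
open import Data.List using (List; []; _∷_; map; allFin; concatMap)
open import Data.Nat.ListAction using (sum)
open import Data.Product using (Σ; _×_; _,_; proj₁; proj₂)
open import Relation.Nullary.Decidable using (⌊_⌋)
open import Relation.Binary.PropositionalEquality using (_≡_)
open import Data.Integer using (+_)
import Data.Rational as Q

count : {A : Set} → List A → (A → Bool) → ℕ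
count xs p = sum (map (λ x → if p x then 1 else 0) xs)

ℚ[_] : ℕ → Q.ℚ
ℚ[ k ] = (+ k) Q./ 1

_<ᶠ_ : {n : ℕ} → Fin n → Fin n → Bool
x <ᶠ y = toℕ x <ᵇ toℕ y

_==_ : {n : ℕ} → Fin n → Fin n → Bool
x == y = ⌊ x ≟ y ⌋

-- all ordered pairs (x , y) of vertices; an edge of K_n is represented
-- by the unique pair (x , y) with x < y.
pairs : (n : ℕ) → List (Fin n × Fin n)
pairs n = concatMap (λ x → map (λ y → (x , y)) (allFin n)) (allFin n)

-- a set of edges of K_n: a Bool-valued function, read only at (x , y)
-- with x < y (values at other positions are ignored by every definition)
EdgeSet : ℕ → Set
EdgeSet n = Fin n → Fin n → Bool

adj : {n : ℕ} → EdgeSet n → Fin n → Fin n → Bool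
adj X x y = if x <ᶠ y then X x y else (if y <ᶠ x then X y x else false)

e : {n : ℕ} → EdgeSet n → ℕ
e {n} X = count (pairs n) (λ p → (proj₁ p <ᶠ proj₂ p) ∧ X (proj₁ p) (proj₂ p))

VSet : ℕ → Set
VSet n = Fin n → Bool

∣_∣ᵛ : {n : ℕ} → VSet n → ℕ
∣_∣ᵛ {n} U = count (allFin n) U

_ᶜ : {n : ℕ} → VSet n → VSet n
(U ᶜ) x = not (U x)

eIn : {n : ℕ} → EdgeSet n → VSet n → ℕ
eIn {n} X U = count (pairs n)
  (λ p → (proj₁ p <ᶠ proj₂ p) ∧ X (proj₁ p) (proj₂ p) ∧ U (proj₁ p) ∧ U (proj₂ p))

record Pregraph (n : ℕ) : Set where
  field
    M : EdgeSet n
    E : EdgeSet n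
    disjoint : (x y : Fin n) → toℕ x < toℕ y → M x y ≡ true → E x y ≡ false
open Pregraph public

symDiffK : {n : ℕ} → EdgeSet n → VSet n → ℕ
symDiffK {n} X W = count (pairs n)
  (λ p → (proj₁ p <ᶠ proj₂ p) ∧ (X (proj₁ p) (proj₂ p) xor (W (proj₁ p) ∧ W (proj₂ p))))

CloseToK : {n : ℕ} → Q.ℚ → ℕ → EdgeSet n → Set
CloseToK {n} ε ℓ X =
  Σ (VSet n) λ W → (∣ W ∣ᵛ ≡ ℓ) × (ℚ[ symDiffK X W ] Q.≤ ε Q.* ℚ[ ℓ C 2 ])

-- A quadruple (a , b , c , d) stands for the 4-cycle a-b-c-d-a, i.e. the
-- edge set {ab, bc, cd, da}.  Each 4-cycle of K_n has exactly one
-- canonical representation: a is its smallest vertex, b < d.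
Quad : ℕ → Set
Quad n = Fin n × Fin n × Fin n × Fin n

quads : (n : ℕ) → List (Quad n)
quads n = concatMap (λ a → concatMap (λ b → concatMap (λ c → map (λ d → (a , b , c , d))
  (allFin n)) (allFin n)) (allFin n)) (allFin n)

canonical : {n : ℕ} → Quad n → Bool
canonical (a , b , c , d) =
  (a <ᶠ b) ∧ (a <ᶠ c) ∧ (b <ᶠ d) ∧ not (b == c) ∧ not (c == d)

samePair : {n : ℕ} → Fin n → Fin n → Fin n → Fin n → Bool
samePair x y u v = ((x == u) ∧ (y == v)) ∨ ((x == v) ∧ (y == u))

inCycle : {n : ℕ} → Quad n → Fin n → Fin n → Bool
inCycle (a , b , c , d) x y =
  samePair x y a b ∨ samePair x y b c ∨ samePair x y c d ∨ samePair x y d a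

inSpan : {n : ℕ} → Quad n → Fin n → Fin n → Bool
inSpan (a , b , c , d) x y = inCycle (a , b , c , d) x y ∨ samePair x y a c ∨ samePair x y b d

induced : {n : ℕ} → EdgeSet n → Quad n → ℕ
induced X (a , b , c , d) =
  count ((a , b) ∷ (b , c) ∷ (c , d) ∷ (d , a) ∷ (a , c) ∷ (b , d) ∷ [])
        (λ p → adj X (proj₁ p) (proj₂ p))

goodC4 : {n : ℕ} → Pregraph n → Quad n → Bool
goodC4 P (a , b , c , d) =
  adj (M P) a b ∧ adj (M P) b c ∧ adj (M P) c d ∧ adj (M P) d a ∧
  (induced (E P) (a , b , c , d) Data.Nat.≡ᵇ 0)

-- (A , B) ∈ H_i^P, where B is the cycle t and A the remaining induced
-- elements of M (A is determined by t)
inHP : {n : ℕ} → Pregraph n → Fin 3 → Quad n → Bool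
inHP P i t = canonical t ∧ goodC4 P t ∧ (induced (M P) t Data.Nat.≡ᵇ (4 + toℕ i))

-- sub-hypergraphs are given by Bool-valued selections of canonical quadruples
Hyp : ℕ → Set
Hyp n = Quad n → Bool

SubHyp : {n : ℕ} → Pregraph n → Fin 3 → Hyp n → Set
SubHyp {n} P i H = (t : Quad n) → H t ≡ true → inHP P i t ≡ true

eH : {n : ℕ} → Hyp n → ℕ
eH {n} H = count (quads n) H

inA : {n : ℕ} → EdgeSet n → Quad n → Fin n → Fin n → Bool
inA Mx t x y = inSpan t x y ∧ not (inCycle t x y) ∧ adj Mx x y

IsMEdge : {n : ℕ} → Pregraph n → Fin n → Fin n → Set
IsMEdge P x y = (toℕ x < toℕ y) × (M P x y ≡ true)

deg01 : {n : ℕ} → Hyp n → Fin n → Fin n → ℕ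
deg01 {n} H x y = count (quads n) (λ t → H t ∧ inCycle t x y)

deg02 : {n : ℕ} → Hyp n → Fin n → Fin n → Fin n → Fin n → ℕ
deg02 {n} H x y u v = count (quads n) (λ t → H t ∧ inCycle t x y ∧ inCycle t u v)

deg10 : {n : ℕ} → Pregraph n → Hyp n → Fin n → Fin n → ℕ
deg10 {n} P H x y = count (quads n) (λ t → H t ∧ inA (M P) t x y)

{-# OPTIONS --safe #-}

-- A family H of good 4-cycles obeying the degree bounds is enlarged one cycle at a time.  As
-- long as H is small, few edges, chords and paths of length two are saturated.  Let A be the
-- set of unsaturated edges of M and B the union of E, the diagonal, the saturated chords and
-- the few pairs most of whose connecting paths are saturated.  It suffices to find many
-- 4-cycles abcd in A with ac, bd ∉ B.
--
-- If there were few of them, the common A-neighbourhood of a typical pair ac ∉ B would be a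
-- clique of B, so that the sum of 1 / k(b) over it, with k(b) the B-degree, is at most 1
-- (Caro–Wei).  Summing over all pairs gives Σ t(b)² / k(b) ≲ n², where t(b)² bounds from below
-- the number of pairs outside B in the A-neighbourhood of b; since Σ k(b) ≲ ℓ², the
-- Cauchy–Schwarz inequality yields Σ t(b) ≲ ℓn.
--
-- In cases (M1) and (M3) t(b) is half the degree of b, where that is large enough, and this is
-- a contradiction.  In case (M2) it shows that almost all edges of A meet vertices of linear
-- degree.  Two such vertices have few common neighbours unless they are adjacent in B, and
-- counting paths of length two between them shows that the vertices of degree at least 3n/4
-- almost form a clique of size about ℓ in E, so that E is close to K_ℓ.

module Submission where

open import Defs
open import Data.Bool using (Bool; true; false; if_then_else_; _∧_; _∨_; not; T; _xor_)
open import Data.Bool.Properties using (∧-comm; ∨-comm)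
open import Data.Empty using (⊥; ⊥-elim)
open import Data.Fin using (Fin; toℕ)
import Data.Fin as F
open import Data.Fin.Properties using (_≟_; toℕ-injective)
import Data.Integer as ℤ
import Data.Integer.Properties as ℤ
open import Data.List using (List; []; _∷_; _++_; map; allFin; concatMap; length)
open import Data.List.Properties using (map-++; map-tabulate; length-tabulate)
open import Data.Nat as ℕ using (ℕ; zero; suc; pred; _+_; _*_; _∸_; _^_; _≤_; _<_; z≤n; s≤s; _≤?_; _<?_; _≤ᵇ_; _<ᵇ_; _≡ᵇ_; NonZero; _!)
open import Data.Nat.Combinatorics using (_C_; nC1≡n; nCk+nC[k+1]≡[n+1]C[k+1])
open import Data.Nat.Divisibility using (_∣_; divides; m≤n⇒m!∣n!; ∣-trans; m∣m*n)
open import Data.Nat.ListAction using (sum)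
open import Data.Nat.ListAction.Properties using (sum-++)
open import Data.Nat.Properties as ℕ hiding (_≟_)
open import Data.Nat.Tactic.RingSolver using (solve-∀)
open import Data.Product using (Σ; _×_; _,_; proj₁; proj₂)
import Data.Rational as Q
import Data.Rational.Properties as Q
open import Data.Rational.Unnormalised as ℚᵘ using (mkℚᵘ; *≤*; *<*; *≡*)
import Data.Rational.Unnormalised.Properties as ℚᵘ
open import Data.Sum using (_⊎_; inj₁; inj₂; [_,_]′)
open import Function using (_∘_; id)
open import Relation.Binary.Definitions using (tri<; tri≈; tri>)
open import Relation.Binary.PropositionalEquality using (_≡_; refl; sym; trans; cong; cong₂; subst; subst₂; _≢_)
open import Relation.Nullary using (¬_; yes; no)

-- The obstacle is the cap on pairs of edges. Two opposite edges determine a 4-cycle, so the cycles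
-- lost to saturated opposite pairs are charged to the size of the family; but a saturated path of
-- length two may lie on as many as `n` cycles. Putting the dead pairs into B ensures that saturated
-- paths destroy only a fixed fraction of the cycles, up to a multiple of the size of the family.
-- The bound ℓ ≥ C√n makes the `n` diagonal pairs of B negligible against ℓ². Caro-Wei and
-- Cauchy-Schwarz are both used in the tangent form 2xy ≤ x² + y². All estimates then stay linear in
-- the number of 4-cycles, which enters as an additive error, and no roots are taken. If E is
-- complete on ℓ vertices and M joins these to all others, there are about ℓn mixed edges and no
-- good 4-cycle. Case (M2) is therefore a stability statement: its estimates have to be sharp up to
-- errors of order 1 / Q, whereas (M1) and (M3) can afford to lose constant factors.

-- Finite sums and indicators.

S : {X : Set} → List X → (X → ℕ) → ℕ
S xs f = sum (map f xs)

∑ : {n : ℕ} → (Fin n → ℕ) → ℕ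
∑ {n} f = S (allFin n) f

∑∑ : {n : ℕ} → (Fin n → Fin n → ℕ) → ℕ
∑∑ f = ∑ λ x → ∑ λ y → f x y

⟦_⟧ : Bool → ℕ
⟦ b ⟧ = if b then 1 else 0

module _ {X : Set} where

  S-cong : (xs : List X) {f g : X → ℕ} → (∀ x → f x ≡ g x) → S xs f ≡ S xs g
  S-cong []       h = refl
  S-cong (x ∷ xs) h = cong₂ _+_ (h x) (S-cong xs h)

  S-mono : (xs : List X) {f g : X → ℕ} → (∀ x → f x ≤ g x) → S xs f ≤ S xs g
  S-mono []       h = z≤n
  S-mono (x ∷ xs) h = +-mono-≤ (h x) (S-mono xs h)

  S-+ : (xs : List X) (f g : X → ℕ) → S xs (λ x → f x + g x) ≡ S xs f + S xs g
  S-+ []       f g = refl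
  S-+ (x ∷ xs) f g rewrite S-+ xs f g = interchange (f x) (g x) (S xs f) (S xs g)
    where interchange : ∀ a b c d → a + b + (c + d) ≡ a + c + (b + d)
          interchange = solve-∀

  S-*ˡ : (xs : List X) (k : ℕ) (f : X → ℕ) → S xs (λ x → k * f x) ≡ k * S xs f
  S-*ˡ []       k f = sym (*-zeroʳ k)
  S-*ˡ (x ∷ xs) k f rewrite S-*ˡ xs k f = sym (*-distribˡ-+ k (f x) (S xs f))

  S-*ʳ : (xs : List X) (f : X → ℕ) (k : ℕ) → S xs (λ x → f x * k) ≡ S xs f * k
  S-*ʳ xs f k = trans (S-cong xs λ x → *-comm (f x) k) (trans (S-*ˡ xs k f) (*-comm k (S xs f)))

  S-const : (xs : List X) (k : ℕ) → S xs (λ _ → k) ≡ length xs * k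
  S-const []       k = refl
  S-const (x ∷ xs) k = cong (k +_) (S-const xs k)

  S-++ : (xs ys : List X) (f : X → ℕ) → S (xs ++ ys) f ≡ S xs f + S ys f
  S-++ xs ys f = trans (cong sum (map-++ f xs ys)) (sum-++ (map f xs) (map f ys))

  S-map : {Y : Set} (xs : List Y) (g : Y → X) (f : X → ℕ) → S (map g xs) f ≡ S xs (λ y → f (g y))
  S-map []       g f = refl
  S-map (x ∷ xs) g f = cong (f (g x) +_) (S-map xs g f)

  S-concatMap : {Y : Set} (xs : List Y) (g : Y → List X) (f : X → ℕ) →
    S (concatMap g xs) f ≡ S xs (λ y → S (g y) f)
  S-concatMap []       g f = refl
  S-concatMap (x ∷ xs) g f = trans (S-++ (g x) (concatMap g xs) f) (cong (S (g x) f +_) (S-concatMap xs g f))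

  S-< : (xs : List X) {f g : X → ℕ} → S xs f < S xs g → Σ X λ x → f x < g x
  S-< (x ∷ xs) {f} {g} h with f x <? g x
  ... | yes p = x , p
  ... | no ¬p = S-< xs (+-cancelˡ-< (f x) _ _ (<-≤-trans h (+-monoˡ-≤ (S xs g) (≮⇒≥ ¬p))))

S-swap : {X Y : Set} (xs : List X) (ys : List Y) (f : X → Y → ℕ) →
  S xs (λ x → S ys (f x)) ≡ S ys (λ y → S xs (λ x → f x y))
S-swap []       ys f = sym (trans (S-const ys 0) (*-zeroʳ (length ys)))
S-swap (x ∷ xs) ys f = trans (cong (S ys (f x) +_) (S-swap xs ys f))
  (sym (S-+ ys (f x) (λ y → S xs (λ x′ → f x′ y))))

module FinSums (n : ℕ) where

  ∑-const : (k : ℕ) → ∑ {n} (λ _ → k) ≡ n * k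
  ∑-const k = trans (S-const (allFin n) k) (cong (_* k) (length-tabulate {n = n} id))

  ∑-≤n : {f : Fin n → ℕ} → (∀ x → f x ≤ 1) → ∑ f ≤ n
  ∑-≤n h = ≤-trans (S-mono (allFin n) h) (≤-reflexive (trans (∑-const 1) (*-identityʳ n)))

  ∑∑-cong : {f g : Fin n → Fin n → ℕ} → (∀ x y → f x y ≡ g x y) → ∑∑ f ≡ ∑∑ g
  ∑∑-cong h = S-cong (allFin n) λ x → S-cong (allFin n) (h x)

  ∑∑-mono : {f g : Fin n → Fin n → ℕ} → (∀ x y → f x y ≤ g x y) → ∑∑ f ≤ ∑∑ g
  ∑∑-mono h = S-mono (allFin n) λ x → S-mono (allFin n) (h x)

  ∑∑-+ : (f g : Fin n → Fin n → ℕ) → ∑∑ (λ x y → f x y + g x y) ≡ ∑∑ f + ∑∑ g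
  ∑∑-+ f g = trans (S-cong (allFin n) λ x → S-+ (allFin n) (f x) (g x))
    (S-+ (allFin n) (λ x → ∑ (f x)) (λ x → ∑ (g x)))

  ∑∑-*ˡ : (k : ℕ) (f : Fin n → Fin n → ℕ) → ∑∑ (λ x y → k * f x y) ≡ k * ∑∑ f
  ∑∑-*ˡ k f = trans (S-cong (allFin n) λ x → S-*ˡ (allFin n) k (f x)) (S-*ˡ (allFin n) k (λ x → ∑ (f x)))

  ∑∑-*ʳ : (f : Fin n → Fin n → ℕ) (k : ℕ) → ∑∑ (λ x y → f x y * k) ≡ ∑∑ f * k
  ∑∑-*ʳ f k = trans (S-cong (allFin n) λ x → S-*ʳ (allFin n) (f x) k) (S-*ʳ (allFin n) (λ x → ∑ (f x)) k)

  ∑∑-swap : (f : Fin n → Fin n → ℕ) → ∑∑ f ≡ ∑∑ (λ x y → f y x)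
  ∑∑-swap f = S-swap (allFin n) (allFin n) f

  ∑-∑∑-swap : (f : Fin n → Fin n → Fin n → ℕ) →
    ∑ (λ z → ∑∑ (f z)) ≡ ∑∑ (λ x y → ∑ λ z → f z x y)
  ∑-∑∑-swap f = trans (S-swap (allFin n) (allFin n) (λ z x → ∑ (f z x)))
    (S-cong (allFin n) λ x → S-swap (allFin n) (allFin n) (λ z y → f z x y))

  ∑-product : (f g : Fin n → ℕ) → ∑ f * ∑ g ≡ ∑∑ (λ x y → f x * g y)
  ∑-product f g = sym (trans (S-cong (allFin n) λ x → S-*ˡ (allFin n) (f x) g) (S-*ʳ (allFin n) f (∑ g)))

∑-suc : ∀ {n} (f : Fin (suc n) → ℕ) → ∑ f ≡ f F.zero + ∑ (f ∘ F.suc)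
∑-suc {n} f = cong (λ l → f F.zero + sum l)
  (trans (map-tabulate F.suc f) (sym (map-tabulate id (f ∘ F.suc))))

S-pairs : ∀ {n} (f : Fin n × Fin n → ℕ) → S (pairs n) f ≡ ∑∑ (λ x y → f (x , y))
S-pairs {n} f = trans (S-concatMap (allFin n) _ f) (S-cong (allFin n) λ x → S-map (allFin n) _ f)

S-quads : ∀ {n} (f : Quad n → ℕ) → S (quads n) f ≡ ∑∑ (λ a b → ∑∑ (λ c d → f (a , b , c , d)))
S-quads {n} f =
  trans (S-concatMap (allFin n) _ f) (S-cong (allFin n) λ a →
  trans (S-concatMap (allFin n) _ f) (S-cong (allFin n) λ b →
  trans (S-concatMap (allFin n) _ f) (S-cong (allFin n) λ c → S-map (allFin n) _ f)))

⟦⟧≤1 : ∀ b → ⟦ b ⟧ ≤ 1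
⟦⟧≤1 true  = ≤-refl
⟦⟧≤1 false = z≤n

⟦⟧-∧ : ∀ b c → ⟦ b ∧ c ⟧ ≡ ⟦ b ⟧ * ⟦ c ⟧
⟦⟧-∧ true  c = sym (*-identityˡ ⟦ c ⟧)
⟦⟧-∧ false c = refl

⟦⟧-∨ : ∀ b c → ⟦ b ∨ c ⟧ ≤ ⟦ b ⟧ + ⟦ c ⟧
⟦⟧-∨ true  c = m≤m+n 1 ⟦ c ⟧
⟦⟧-∨ false c = ≤-refl

⟦⟧-not : ∀ b → ⟦ not b ⟧ + ⟦ b ⟧ ≡ 1
⟦⟧-not true  = refl
⟦⟧-not false = refl

==-refl : ∀ {n} (x : Fin n) → (x == x) ≡ true
==-refl x with x ≟ x
... | yes _ = refl
... | no ¬p = ⊥-elim (¬p refl)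

==⇒≡ : ∀ {n} {x y : Fin n} → (x == y) ≡ true → x ≡ y
==⇒≡ {x = x} {y} h with x ≟ y
... | yes p = p

==-sym : ∀ {n} (x y : Fin n) → (x == y) ≡ (y == x)
==-sym x y with x ≟ y | y ≟ x
... | yes _ | yes _ = refl
... | no  _ | no  _ = refl
... | yes p | no ¬q = ⊥-elim (¬q (sym p))
... | no ¬p | yes q = ⊥-elim (¬p (sym q))

∑-δ : ∀ {n} (a : Fin n) → ∑ (λ x → ⟦ x == a ⟧) ≡ 1
∑-δ {suc n} F.zero = trans (∑-suc {n} (λ x → ⟦ x == F.zero ⟧)) (cong suc (trans (FinSums.∑-const n 0) (*-zeroʳ n)))
∑-δ {suc n} (F.suc a) = trans (∑-suc {n} (λ x → ⟦ x == F.suc a ⟧))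
  (trans (S-cong (allFin n) (λ x → cong ⟦_⟧ (==-suc x a))) (∑-δ a))
  where
  ==-suc : ∀ {m} (x y : Fin m) → (F.suc x == F.suc y) ≡ (x == y)
  ==-suc x y with x ≟ y
  ... | yes _ = refl
  ... | no _ = refl

-- Linear arithmetic by certificate: X ≤ Y is a combination of the hypotheses and s is
-- the slack, so that only a semiring identity remains to be checked.
linear : ∀ {X Y L R} s → X ≤ Y → L + Y + s ≡ R + X → L ≤ R
linear {X} {Y} {L} {R} s h eq = +-cancelʳ-≤ X L R
  (≤-trans (+-monoʳ-≤ L h) (≤-trans (m≤m+n (L + Y) s) (≤-reflexive eq)))

-- Inequalities and rounding in the natural numbers.

2ab≤a²+b² : ∀ a b → 2 * (a * b) ≤ a * a + b * b
2ab≤a²+b² a b with ≤-total a b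
... | inj₁ a≤b = subst (λ v → 2 * (a * v) ≤ a * a + v * v) (m+[n∸m]≡n a≤b)
                   (linear ((b ∸ a) * (b ∸ a)) z≤n (eq a (b ∸ a)))
  where eq : ∀ a c → 2 * (a * (a + c)) + 0 + c * c ≡ a * a + (a + c) * (a + c) + 0
        eq = solve-∀
... | inj₂ b≤a = subst (λ v → 2 * (v * b) ≤ v * v + b * b) (m+[n∸m]≡n b≤a)
                   (linear ((a ∸ b) * (a ∸ b)) z≤n (eq b (a ∸ b)))
  where eq : ∀ b c → 2 * ((b + c) * b) + 0 + c * c ≡ (b + c) * (b + c) + b * b + 0
        eq = solve-∀

≤ᵇ-true : ∀ m n → (m ≤ᵇ n) ≡ true → m ≤ n
≤ᵇ-true m n h = ≤ᵇ⇒≤ m n (subst T (sym h) _)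

≤ᵇ-false : ∀ m n → (m ≤ᵇ n) ≡ false → n < m
≤ᵇ-false m n h = ≰⇒> λ p → subst T h (≤⇒≤ᵇ p)

-- Makes `n !` a common denominator of the weights 1 / t with 1 ≤ t ≤ n, so that scaled weights are
-- natural numbers.
∣-factorial : ∀ {t n} → 1 ≤ t → t ≤ n → t ∣ n !
∣-factorial {suc t} {n} _ t≤n = ∣-trans (m∣m*n (t !)) (m≤n⇒m!∣n! t≤n)

-- The weight of a vertex with parameters t² ≤ c: up to scaling it is 1/t, or 0
-- where the contribution 2rt - pk would be negative.
weight-choice : ∀ {n} p r τ σ t c k → t * t ≤ c → t ≤ n → (t ≡ 0) ⊎ (τ ≤ σ * t) →
  Σ ℕ λ θ → (c * (θ * θ * k) + 2 * (p * r) * (n ! * n !) * t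
               ≤ 2 * (r * n !) * (c * θ) + p * p * (n ! * n !) * k)
          × (θ * τ ≤ p * σ * n !)
weight-choice {n} p r τ σ t c k t²≤c t≤n h with 2 * r * t ≤? p * k
... | yes q = 0 , linear 0 (*-monoʳ-≤ (p * (n ! * n !)) q) (eq p r (n !) t c k) , z≤n
  where eq : ∀ p r Z t c k → c * (0 * 0 * k) + 2 * (p * r) * (Z * Z) * t + p * (Z * Z) * (p * k) + 0
                ≡ 2 * (r * Z) * (c * 0) + p * p * (Z * Z) * k + p * (Z * Z) * (2 * r * t)
        eq = solve-∀
weight-choice {n} p r τ σ zero c k t²≤c t≤n h | no ¬q with () ← ¬q (subst (_≤ p * k) (sym (*-zeroʳ (2 * r))) z≤n)
weight-choice {n} p r τ σ (suc t′) c k t²≤c t≤n (inj₂ h) | no ¬q with ∣-factorial {suc t′} (s≤s z≤n) t≤n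
-- For `c = t * t` the inequality is an equality; in general its two sides differ by
-- `(c - t * t) * (p * (u * u) * gap)`.
... | divides u Z≡ut = p * u , main , bound
  where
  t = suc t′
  gap = 2 * r * t ∸ p * k
  2rt : 2 * r * t ≡ p * k + gap
  2rt = sym (m+[n∸m]≡n (<⇒≤ (≰⇒> ¬q)))
  eq : ∀ c p u k t r gap → 2 * r * t ≡ p * k + gap →
    c * (p * u * (p * u) * k) + 2 * (p * r) * (u * t * (u * t)) * t + c * (p * (u * u) * gap) + 0
      ≡ 2 * (r * (u * t)) * (c * (p * u)) + p * p * (u * t * (u * t)) * k + t * t * (p * (u * u) * gap)
  eq c p u k t r gap h =
    trans (eq₁ c p u k t r gap) (trans (cong (λ v → c * (p * u * (p * u) * k) + v * (p * (u * u) * (t * t)) + c * (p * (u * u) * gap)) h)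
      (trans (eq₂ c p u k t gap) (trans (cong (λ v → v * (c * p * (u * u)) + p * p * (u * t * (u * t)) * k + t * t * (p * (u * u) * gap)) (sym h)) (eq₃ c p u k t r gap))))
    where
    eq₁ : ∀ c p u k t r gap → c * (p * u * (p * u) * k) + 2 * (p * r) * (u * t * (u * t)) * t + c * (p * (u * u) * gap) + 0
        ≡ c * (p * u * (p * u) * k) + 2 * r * t * (p * (u * u) * (t * t)) + c * (p * (u * u) * gap)
    eq₁ = solve-∀
    eq₂ : ∀ c p u k t gap → c * (p * u * (p * u) * k) + (p * k + gap) * (p * (u * u) * (t * t)) + c * (p * (u * u) * gap)
        ≡ (p * k + gap) * (c * p * (u * u)) + p * p * (u * t * (u * t)) * k + t * t * (p * (u * u) * gap)
    eq₂ = solve-∀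
    eq₃ : ∀ c p u k t r gap → 2 * r * t * (c * p * (u * u)) + p * p * (u * t * (u * t)) * k + t * t * (p * (u * u) * gap)
        ≡ 2 * (r * (u * t)) * (c * (p * u)) + p * p * (u * t * (u * t)) * k + t * t * (p * (u * u) * gap)
    eq₃ = solve-∀
  main : c * (p * u * (p * u) * k) + 2 * (p * r) * (n ! * n !) * t
           ≤ 2 * (r * n !) * (c * (p * u)) + p * p * (n ! * n !) * k
  main rewrite Z≡ut = linear 0 (*-monoˡ-≤ (p * (u * u) * gap) t²≤c) (eq c p u k t r gap 2rt)
  bound : p * u * τ ≤ p * σ * n !
  bound rewrite Z≡ut = ≤-trans (*-monoʳ-≤ (p * u) h) (≤-reflexive (eqb p u σ t))
    where eqb : ∀ p u σ t → p * u * (σ * t) ≡ p * σ * (u * t)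
          eqb = solve-∀

halve : ∀ n → Σ ℕ λ h → (2 * h ≤ n) × (n ≤ 1 + 2 * h)
halve zero = 0 , z≤n , z≤n
halve (suc zero) = 0 , z≤n , ≤-refl
halve (suc (suc n)) with halve n
... | h , p , q = suc h , ≤-trans (≤-reflexive (eq h)) (s≤s (s≤s p)) , ≤-trans (s≤s (s≤s q)) (≤-reflexive (eq′ h))
  where eq : ∀ h → 2 * (1 + h) ≡ 2 + 2 * h
        eq = solve-∀
        eq′ : ∀ h → 3 + 2 * h ≡ 1 + 2 * (1 + h)
        eq′ = solve-∀

cancel-≤ : ∀ {c a b} → 1 ≤ c → c * a ≤ c * b → a ≤ b
cancel-≤ {suc c} {a} {b} _ h = *-cancelˡ-≤ (suc c) h

round-up : ∀ g ℓ → 1 ≤ g → Σ ℕ λ h → (ℓ ≤ g * h) × (g * h ≤ ℓ + g)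
round-up g zero    1≤g = 0 , z≤n , subst (_≤ g) (sym (*-zeroʳ g)) z≤n
round-up g (suc ℓ) 1≤g with round-up g ℓ 1≤g
... | h , p , q with suc ℓ ≤? g * h
... | yes r = h , r , m≤n⇒m≤1+n q
... | no ¬r = suc h , ≤-trans (+-mono-≤ 1≤g p) (≤-reflexive (sym (*-suc g h))) ,
              ≤-trans (≤-reflexive (trans (*-suc g h) (+-comm g (g * h)))) (+-monoˡ-≤ g (<⇒≤ (≰⇒> ¬r)))

-- Counting 4-cycles of A whose diagonals avoid B.

-- `α` is the indicator of A, `κ` that of B and `ν` that of the complement of B. All counts are over
-- ordered pairs and quadruples, so that sums can be exchanged freely.
module Counting {n : ℕ} (α ν κ : Fin n → Fin n → ℕ)
  (α≤1 : ∀ x y → α x y ≤ 1) (α-sym : ∀ x y → α x y ≡ α y x)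
  (κ-sym : ∀ x y → κ x y ≡ κ y x) (ν+κ : ∀ x y → ν x y + κ x y ≡ 1) where

  open FinSums n

  private
    V = allFin n

  k D : Fin n → ℕ
  k b = ∑ λ d → κ b d
  D b = ∑ λ a → α b a

  K G : ℕ
  K = ∑ k
  G = ∑∑ λ a b → ∑∑ λ c d → (α a b * α b c) * (α c d * α d a) * (ν a c * ν b d)

  τ : Fin n → Fin n → Fin n → ℕ
  τ x y u = α x u * α u y

  -- `opp x y` counts the 4-cycles in which x and y are opposite and the other diagonal is outside
  -- B; `G` is its sum over the pairs outside B.
  codeg opp : Fin n → Fin n → ℕ
  codeg x y = ∑ λ u → τ x y u
  opp x y = ∑∑ λ u v → τ x y u * τ x y v * ν u v

  cherries : Fin n → ℕ
  cherries b = ∑∑ λ a c → ν a c * (α a b * α b c)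

  ν≤1 : ∀ x y → ν x y ≤ 1
  ν≤1 x y = ≤-trans (m≤m+n (ν x y) (κ x y)) (≤-reflexive (ν+κ x y))

  τ≤1 : ∀ x y u → τ x y u ≤ 1
  τ≤1 x y u = *-mono-≤ (α≤1 x u) (α≤1 u y)

  G-opp : G ≡ ∑∑ λ a c → ν a c * opp a c
  G-opp = S-cong V λ a → trans (S-swap V V (λ b c → ∑ λ d → (α a b * α b c) * (α c d * α d a) * (ν a c * ν b d)))
    (S-cong V λ c → trans (∑∑-cong λ b d → trans (eq (α a b * α b c) (α c d) (α d a) (ν a c) (ν b d))
        (cong₂ (λ s t → ν a c * (α a b * α b c * (s * t) * ν b d)) (α-sym d a) (α-sym c d)))
      (∑∑-*ˡ (ν a c) (λ b d → τ a c b * τ a c d * ν b d)))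
    where eq : ∀ x c d a b → x * (c * d) * (a * b) ≡ a * (x * (d * c) * b)
          eq = solve-∀

  -- B has only `K` ordered pairs altogether, so a set of clearly more than √K vertices spans many
  -- pairs outside B.
  square-split : (f : Fin n → ℕ) → (∀ u → f u ≤ 1) → ∑ f * ∑ f ≤ (∑∑ λ u v → f u * f v * ν u v) + K
  square-split f f≤1 = begin
    ∑ f * ∑ f                            ≡⟨ ∑-product f f ⟩
    (∑∑ λ u v → f u * f v)               ≤⟨ ∑∑-mono (λ u v → ≤-trans (≤-reflexive (split u v))
                                              (+-monoʳ-≤ (f u * f v * ν u v)
                                                (≤-trans (*-monoˡ-≤ (κ u v) (*-mono-≤ (f≤1 u) (f≤1 v)))
                                                         (≤-reflexive (*-identityˡ (κ u v)))))) ⟩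
    (∑∑ λ u v → f u * f v * ν u v + κ u v) ≡⟨ ∑∑-+ _ κ ⟩
    (∑∑ λ u v → f u * f v * ν u v) + K   ∎
    where
    open ≤-Reasoning
    split : ∀ u v → f u * f v ≡ f u * f v * ν u v + f u * f v * κ u v
    split u v = trans (sym (*-identityʳ _)) (trans (cong (f u * f v *_) (sym (ν+κ u v))) (*-distribˡ-+ (f u * f v) (ν u v) (κ u v)))

  codeg²≤opp+K : ∀ x y → codeg x y * codeg x y ≤ opp x y + K
  codeg²≤opp+K x y = square-split (τ x y) (τ≤1 x y)

  cherries-ν : ∀ b → (∑∑ λ u v → α b u * α b v * ν u v) ≡ cherries b
  cherries-ν b = ∑∑-cong λ u v → trans (*-comm (α b u * α b v) (ν u v))
    (cong (λ s → ν u v * (s * α b v)) (α-sym b u))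

  D²≤cherries+K : ∀ b → D b * D b ≤ cherries b + K
  D²≤cherries+K b = subst (λ v → D b * D b ≤ v + K) (cherries-ν b) (square-split (α b) (α≤1 b))

  D≤n : ∀ b → D b ≤ n
  D≤n b = ∑-≤n (α≤1 b)

  module Weighted (θ : Fin n → ℕ) where

    -- The weighted failure of the common neighbourhoods to be cliques of B; it vanishes if there
    -- are no 4-cycles to be counted.
    W : ℕ
    W = ∑∑ λ a c → ν a c * (∑∑ λ b d → τ a c b * τ a c d * ν b d * (θ b * θ d))

    -- Caro–Wei inside one common neighbourhood, linearised by 2Θx ≤ x² + Θ².
    caro-wei : ∀ Θ a c → 2 * Θ * (∑ λ b → τ a c b * θ b)
      ≤ (∑∑ λ b d → τ a c b * τ a c d * ν b d * (θ b * θ d)) + (∑ λ b → τ a c b * (θ b * θ b * k b)) + Θ * Θ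
    caro-wei Θ a c = ≤-trans (≤-trans (≤-reflexive (*-assoc 2 Θ X)) (2ab≤a²+b² Θ X))
      (≤-trans (≤-reflexive (+-comm (Θ * Θ) (X * X))) (+-monoˡ-≤ (Θ * Θ) X²≤))
      where
      open ≤-Reasoning
      t = τ a c
      X = ∑ λ b → t b * θ b
      N Q : Fin n → Fin n → ℕ
      N b d = t b * t d * ν b d * (θ b * θ d)
      Q b d = κ b d * ((t b * θ b) * (t d * θ d))
      P = ∑ λ b → t b * (θ b * θ b * k b)
      t²≤t : ∀ b → t b * t b ≤ t b
      t²≤t b = ≤-trans (*-monoʳ-≤ (t b) (τ≤1 a c b)) (≤-reflexive (*-identityʳ (t b)))
      split : ∀ ν κ tb td x y → ν + κ ≡ 1 → tb * x * (td * y) ≡ tb * td * ν * (x * y) + κ * (tb * x * (td * y))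
      split ν κ tb td x y h = trans (sym (*-identityˡ _)) (trans (cong (_* (tb * x * (td * y))) (sym h)) (eq ν κ tb td x y))
        where eq : ∀ ν κ tb td x y → (ν + κ) * (tb * x * (td * y)) ≡ tb * td * ν * (x * y) + κ * (tb * x * (td * y))
              eq = solve-∀
      row : (∑∑ λ b d → κ b d * (t b * (θ b * θ b))) ≡ P
      row = S-cong V λ b → trans (S-*ʳ V (κ b) (t b * (θ b * θ b))) (eq (k b) (t b) (θ b))
        where eq : ∀ k t x → k * (t * (x * x)) ≡ t * (x * x * k)
              eq = solve-∀
      -- On pairs in B, `2xy ≤ x² + y²` separates the two ends; summing over one of them produces
      -- the B-degree `k`.
      Q≤ : 2 * ∑∑ Q ≤ 2 * P
      Q≤ = begin
        2 * ∑∑ Q                    ≡⟨ ∑∑-*ˡ 2 Q ⟨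
        (∑∑ λ b d → 2 * Q b d)      ≤⟨ ∑∑-mono (λ b d → amgm b d) ⟩
        (∑∑ λ b d → κ b d * (t b * (θ b * θ b)) + κ b d * (t d * (θ d * θ d))) ≡⟨ ∑∑-+ _ _ ⟩
        (∑∑ λ b d → κ b d * (t b * (θ b * θ b))) + (∑∑ λ b d → κ b d * (t d * (θ d * θ d)))
          ≡⟨ cong₂ _+_ row (trans (∑∑-swap _) (trans (∑∑-cong λ b d → cong (_* (t b * (θ b * θ b))) (κ-sym d b)) row)) ⟩
        P + P                       ≡⟨ cong (P +_) (sym (+-identityʳ P)) ⟩
        2 * P                       ∎
        where
        amgm : ∀ b d → 2 * Q b d ≤ κ b d * (t b * (θ b * θ b)) + κ b d * (t d * (θ d * θ d))
        amgm b d = begin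
          2 * Q b d ≡⟨ eq (κ b d) (t b * θ b) (t d * θ d) ⟩
          κ b d * (2 * ((t b * θ b) * (t d * θ d))) ≤⟨ *-monoʳ-≤ (κ b d) (2ab≤a²+b² (t b * θ b) (t d * θ d)) ⟩
          κ b d * ((t b * θ b) * (t b * θ b) + (t d * θ d) * (t d * θ d)) ≡⟨ eq′ (κ b d) (t b) (θ b) (t d) (θ d) ⟩
          κ b d * (t b * t b * (θ b * θ b)) + κ b d * (t d * t d * (θ d * θ d))
            ≤⟨ +-mono-≤ (*-monoʳ-≤ (κ b d) (*-monoˡ-≤ (θ b * θ b) (t²≤t b))) (*-monoʳ-≤ (κ b d) (*-monoˡ-≤ (θ d * θ d) (t²≤t d))) ⟩
          κ b d * (t b * (θ b * θ b)) + κ b d * (t d * (θ d * θ d)) ∎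
          where eq : ∀ κ x y → 2 * (κ * (x * y)) ≡ κ * (2 * (x * y))
                eq = solve-∀
                eq′ : ∀ κ s x t y → κ * (s * x * (s * x) + t * y * (t * y)) ≡ κ * (s * s * (x * x)) + κ * (t * t * (y * y))
                eq′ = solve-∀
      X²≤ : X * X ≤ ∑∑ N + P
      X²≤ = begin
        X * X                          ≡⟨ ∑-product (λ b → t b * θ b) (λ b → t b * θ b) ⟩
        (∑∑ λ b d → t b * θ b * (t d * θ d)) ≡⟨ ∑∑-cong (λ b d → split (ν b d) (κ b d) (t b) (t d) (θ b) (θ d) (ν+κ b d)) ⟩
        (∑∑ λ b d → N b d + Q b d)     ≡⟨ ∑∑-+ N Q ⟩
        ∑∑ N + ∑∑ Q                    ≤⟨ +-monoʳ-≤ (∑∑ N) (*-cancelˡ-≤ 2 Q≤) ⟩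
        ∑∑ N + P                       ∎

    by-centre : (f : Fin n → ℕ) → (∑∑ λ a c → ν a c * (∑ λ b → τ a c b * f b)) ≡ ∑ λ b → cherries b * f b
    by-centre f = begin
      (∑∑ λ a c → ν a c * (∑ λ b → τ a c b * f b)) ≡⟨ (∑∑-cong λ a c → sym (trans (S-cong V λ b → *-assoc (ν a c) _ (f b)) (S-*ˡ V (ν a c) _))) ⟩
      (∑∑ λ a c → ∑ λ b → ν a c * τ a c b * f b)   ≡⟨ ∑-∑∑-swap (λ b a c → ν a c * τ a c b * f b) ⟨
      (∑ λ b → ∑∑ λ a c → ν a c * τ a c b * f b)   ≡⟨ (S-cong V λ b → ∑∑-*ʳ (λ a c → ν a c * τ a c b) (f b)) ⟩
      (∑ λ b → cherries b * f b) ∎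
      where open Relation.Binary.PropositionalEquality.≡-Reasoning

    -- `caro-wei` summed over the pairs outside B; counting paths by their middle vertex turns
    -- codegrees into `cherries`.
    weighted-bound : ∀ Θ → 2 * Θ * (∑ λ b → cherries b * θ b)
      ≤ W + (∑ λ b → cherries b * (θ b * θ b * k b)) + n * n * (Θ * Θ)
    weighted-bound Θ = begin
      2 * Θ * (∑ λ b → cherries b * θ b) ≡⟨ cong (2 * Θ *_) (by-centre θ) ⟨
      2 * Θ * (∑∑ λ a c → ν a c * X a c) ≡⟨ ∑∑-*ˡ (2 * Θ) _ ⟨
      (∑∑ λ a c → 2 * Θ * (ν a c * X a c)) ≤⟨ ∑∑-mono step ⟩
      (∑∑ λ a c → ν a c * N a c + ν a c * P a c + Θ * Θ) ≡⟨ trans (∑∑-+ _ _) (cong (_+ (∑∑ {n} λ a c → Θ * Θ)) (∑∑-+ _ _)) ⟩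
      W + (∑∑ λ a c → ν a c * P a c) + (∑∑ {n} λ a c → Θ * Θ) ≡⟨ cong₂ (λ s t → W + s + t) (by-centre _) n²Θ² ⟩
      W + (∑ λ b → cherries b * (θ b * θ b * k b)) + n * n * (Θ * Θ) ∎
      where
      open ≤-Reasoning
      X N P : Fin n → Fin n → ℕ
      X a c = ∑ λ b → τ a c b * θ b
      N a c = ∑∑ λ b d → τ a c b * τ a c d * ν b d * (θ b * θ d)
      P a c = ∑ λ b → τ a c b * (θ b * θ b * k b)
      n²Θ² : (∑∑ {n} λ a c → Θ * Θ) ≡ n * n * (Θ * Θ)
      n²Θ² = trans (S-cong V λ _ → ∑-const (Θ * Θ)) (trans (∑-const (n * (Θ * Θ))) (sym (*-assoc n n (Θ * Θ))))
      step : ∀ a c → 2 * Θ * (ν a c * X a c) ≤ ν a c * N a c + ν a c * P a c + Θ * Θ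
      step a c = begin
        2 * Θ * (ν a c * X a c) ≡⟨ eq Θ (ν a c) (X a c) ⟩
        ν a c * (2 * Θ * X a c) ≤⟨ *-monoʳ-≤ (ν a c) (caro-wei Θ a c) ⟩
        ν a c * (N a c + P a c + Θ * Θ) ≡⟨ eq′ (ν a c) (N a c) (P a c) (Θ * Θ) ⟩
        ν a c * N a c + ν a c * P a c + ν a c * (Θ * Θ)
          ≤⟨ +-monoʳ-≤ (ν a c * N a c + ν a c * P a c) (≤-trans (*-monoˡ-≤ (Θ * Θ) (ν≤1 a c)) (≤-reflexive (*-identityˡ (Θ * Θ)))) ⟩
        ν a c * N a c + ν a c * P a c + Θ * Θ ∎
        where eq : ∀ Θ v x → 2 * Θ * (v * x) ≡ v * (2 * Θ * x)
              eq = solve-∀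
              eq′ : ∀ v x y z → v * (x + y + z) ≡ v * x + v * y + v * z
              eq′ = solve-∀

    W≤G : ∀ s M → (∀ b → θ b * s ≤ M) → W * (s * s) ≤ M * M * G
    W≤G s M h = begin
      W * (s * s) ≡⟨ ∑∑-*ʳ _ (s * s) ⟨
      (∑∑ λ a c → ν a c * N a c * (s * s)) ≤⟨ ∑∑-mono step ⟩
      (∑∑ λ a c → M * M * (ν a c * opp a c)) ≡⟨ ∑∑-*ˡ (M * M) _ ⟩
      M * M * (∑∑ λ a c → ν a c * opp a c) ≡⟨ cong (M * M *_) G-opp ⟨
      M * M * G ∎
      where
      open ≤-Reasoning
      N : Fin n → Fin n → ℕ
      N a c = ∑∑ λ b d → τ a c b * τ a c d * ν b d * (θ b * θ d)
      step : ∀ a c → ν a c * N a c * (s * s) ≤ M * M * (ν a c * opp a c)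
      step a c = begin
        ν a c * N a c * (s * s) ≡⟨ *-assoc (ν a c) (N a c) (s * s) ⟩
        ν a c * (N a c * (s * s)) ≡⟨ cong (ν a c *_) (∑∑-*ʳ _ (s * s)) ⟨
        ν a c * (∑∑ λ b d → τ a c b * τ a c d * ν b d * (θ b * θ d) * (s * s)) ≤⟨ *-monoʳ-≤ (ν a c) (∑∑-mono λ b d → inner b d) ⟩
        ν a c * (∑∑ λ b d → M * M * (τ a c b * τ a c d * ν b d)) ≡⟨ cong (ν a c *_) (∑∑-*ˡ (M * M) _) ⟩
        ν a c * (M * M * opp a c) ≡⟨ eq (ν a c) (M * M) (opp a c) ⟩
        M * M * (ν a c * opp a c) ∎
        where
        eq : ∀ a b c → a * (b * c) ≡ b * (a * c)
        eq = solve-∀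
        inner : ∀ b d → τ a c b * τ a c d * ν b d * (θ b * θ d) * (s * s) ≤ M * M * (τ a c b * τ a c d * ν b d)
        inner b d = begin
          x * (θ b * θ d) * (s * s) ≡⟨ eq″ x (θ b) (θ d) s ⟩
          x * (θ b * s * (θ d * s)) ≤⟨ *-monoʳ-≤ x (*-mono-≤ (h b) (h d)) ⟩
          x * (M * M) ≡⟨ *-comm x (M * M) ⟩
          M * M * x ∎
          where x = τ a c b * τ a c d * ν b d
                eq″ : ∀ x p q s → x * (p * q) * (s * s) ≡ x * (p * s * (q * s))
                eq″ = solve-∀

  -- Without the term in `G` this reads 2pr Σt ≤ p²K + n²r², which for p : r = n : √K is Σt ≤ n√K.
  -- It is `weighted-bound` with weights `p * n ! / t` and scale `Θ = r * n !`. The lower bound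
  -- `s / σ` on the nonzero `t` caps the weights and thereby bounds the error `W` by a multiple of
  -- `G`.
  supersaturation : ∀ p r s σ (t : Fin n → ℕ) → (∀ b → t b * t b ≤ cherries b) →
    (∀ b → t b ≤ n) → (∀ b → (t b ≡ 0) ⊎ (s ≤ σ * t b)) →
    2 * (s * s) * (p * r) * ∑ t ≤ p * p * (σ * σ) * G + s * s * (p * p * K + n * n * (r * r))
  supersaturation p r s σ t t²≤ t≤n big = *-cancelʳ-≤ _ _ (Z * Z) scaled
    where
    open ≤-Reasoning
    Z = n !
    instance
      Z²≢0 : NonZero (Z * Z)
      Z²≢0 = m*n≢0 Z Z {{n !≢0}} {{n !≢0}}
    choice : ∀ b → _
    choice b = weight-choice {n} p r s σ (t b) (cherries b) (k b) (t²≤ b) (t≤n b) (big b)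
    θ : Fin n → ℕ
    θ b = proj₁ (choice b)
    open Weighted θ
    Y = ∑ λ b → cherries b * (θ b * θ b * k b)
    X = ∑ λ b → cherries b * θ b
    summed : Y + 2 * (p * r) * (Z * Z) * ∑ t ≤ 2 * (r * Z) * X + p * p * (Z * Z) * K
    summed = begin
      Y + 2 * (p * r) * (Z * Z) * ∑ t ≡⟨ cong (Y +_) (S-*ˡ V (2 * (p * r) * (Z * Z)) t) ⟨
      Y + (∑ λ b → 2 * (p * r) * (Z * Z) * t b) ≡⟨ S-+ V _ _ ⟨
      (∑ λ b → cherries b * (θ b * θ b * k b) + 2 * (p * r) * (Z * Z) * t b) ≤⟨ S-mono V (λ b → proj₁ (proj₂ (choice b))) ⟩
      (∑ λ b → 2 * (r * Z) * (cherries b * θ b) + p * p * (Z * Z) * k b) ≡⟨ S-+ V _ _ ⟩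
      (∑ λ b → 2 * (r * Z) * (cherries b * θ b)) + (∑ λ b → p * p * (Z * Z) * k b)
        ≡⟨ cong₂ _+_ (S-*ˡ V (2 * (r * Z)) (λ b → cherries b * θ b)) (S-*ˡ V (p * p * (Z * Z)) k) ⟩
      2 * (r * Z) * X + p * p * (Z * Z) * K ∎
    unscaled : 2 * (p * r) * (Z * Z) * ∑ t ≤ W + n * n * (r * Z * (r * Z)) + p * p * (Z * Z) * K
    unscaled = linear 0 (+-mono-≤ summed (weighted-bound (r * Z)))
      (eq (2 * (p * r) * (Z * Z) * ∑ t) (2 * (r * Z) * X) (p * p * (Z * Z) * K) W Y (n * n * (r * Z * (r * Z))))
      where eq : ∀ L a b w y c → L + (a + b + (w + y + c)) + 0 ≡ w + c + b + (y + L + a)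
            eq = solve-∀
    scaled : 2 * (s * s) * (p * r) * ∑ t * (Z * Z) ≤ (p * p * (σ * σ) * G + s * s * (p * p * K + n * n * (r * r))) * (Z * Z)
    scaled = linear 0 (+-mono-≤ (*-monoʳ-≤ (s * s) unscaled) (W≤G s (p * σ * Z) (λ b → proj₂ (proj₂ (choice b)))))
      (eq (∑ t) s p r Z σ W n K G)
      where eq : ∀ T s p r Z σ W n K G →
              2 * (s * s) * (p * r) * T * (Z * Z) + (s * s * (W + n * n * (r * Z * (r * Z)) + p * p * (Z * Z) * K) + p * σ * Z * (p * σ * Z) * G) + 0
                ≡ (p * p * (σ * σ) * G + s * s * (p * p * K + n * n * (r * r))) * (Z * Z) + (s * s * (2 * (p * r) * (Z * Z) * T) + W * (s * s))
            eq = solve-∀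

  -- The fraction `y / x` bounds √(K / 2) / ℓ. A vertex of degree at least `2yℓ / x` has degree
  -- squared at least `2K`, so at most half of the pairs in its neighbourhood lie in B and half its
  -- degree can serve as `t`. The other vertices contribute at most `2yℓn / x` to the sum of the
  -- degrees.
  dense : ∀ ℓ x y → 1 ≤ n → 1 ≤ x → 1 ≤ y → x ≤ y * ℓ → x * x * K ≤ 2 * (y * y * (ℓ * ℓ)) →
    7 * (y * ℓ * n) ≤ x * ∑ D → ℓ * ℓ * (ℓ * ℓ) ≤ 4 * (x * x * (x * x)) * G
  dense ℓ x y 1≤n 1≤x 1≤y x≤yℓ K≤ D≥ = ≤-trans ℓ⁴≤ (cancel-≤ (*-mono-≤ 1≤n 1≤n) final)
    where
    open ≤-Reasoning
    half-degree : ∀ b → Σ ℕ λ t → (t * t ≤ cherries b) × (t ≤ n) × ((t ≡ 0) ⊎ (ℓ ≤ 2 * x * t)) ×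
      (x * D b ≤ 2 * (y * ℓ) + 2 * x * t + x)
    half-degree b with 2 * (y * ℓ) ≤? x * D b
    ... | no ¬p = 0 , z≤n , z≤n , inj₁ refl , ≤-trans (<⇒≤ (≰⇒> ¬p)) (≤-trans (m≤m+n _ _) (m≤m+n _ _))
    ... | yes p with halve (D b)
    ... | t , 2t≤D , D≤ = t , t²≤ , ≤-trans (m≤m+n t _) (≤-trans 2t≤D (D≤n b)) , inj₂ ℓ≤ ,
          ≤-trans xD≤ (+-monoˡ-≤ x (m≤n+m (2 * x * t) (2 * (y * ℓ))))
      where
      xD≤ : x * D b ≤ 2 * x * t + x
      xD≤ = ≤-trans (*-monoʳ-≤ x D≤) (≤-reflexive (eq x t))
        where eq : ∀ x t → x * (1 + 2 * t) ≡ 2 * x * t + x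
              eq = solve-∀
      ℓ≤ : ℓ ≤ 2 * x * t
      ℓ≤ = ≤-trans (≤-trans (≤-reflexive (sym (*-identityˡ ℓ))) (*-monoˡ-≤ ℓ 1≤y))
        (linear 0 (+-mono-≤ (≤-trans p xD≤) x≤yℓ) (eq (y * ℓ) (2 * x * t) x))
        where eq : ∀ a b x → a + (b + x + a) + 0 ≡ b + (2 * a + x)
              eq = solve-∀
      D²≤2c : D b * D b ≤ 2 * cherries b
      D²≤2c = cancel-≤ (*-mono-≤ 1≤x 1≤x) (linear 0
        (+-mono-≤ (+-mono-≤ (*-monoʳ-≤ (2 * (x * x)) (D²≤cherries+K b)) (*-monoʳ-≤ 2 K≤)) (*-mono-≤ p p))
        (eq x y ℓ K (D b) (cherries b)))
        where eq : ∀ x y ℓ K D c → x * x * (D * D) + (2 * (x * x) * (c + K) + 2 * (2 * (y * y * (ℓ * ℓ))) + x * D * (x * D)) + 0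
                ≡ x * x * (2 * c) + (2 * (x * x) * (D * D) + 2 * (x * x * K) + 2 * (y * ℓ) * (2 * (y * ℓ)))
              eq = solve-∀
      t²≤ : t * t ≤ cherries b
      t²≤ = *-cancelˡ-≤ 2 (linear (2 * (t * t)) (+-mono-≤ D²≤2c (*-mono-≤ 2t≤D 2t≤D)) (eq t (D b * D b) (cherries b)))
        where eq : ∀ t D c → 2 * (t * t) + (2 * c + D) + 2 * (t * t) ≡ 2 * c + (D + 2 * t * (2 * t))
              eq = solve-∀
    t : Fin n → ℕ
    t b = proj₁ (half-degree b)
    -- Of the 7 in the hypothesis, vertices of low degree use up 2 and the rounding in `halve` 1, as
    -- `x ≤ y * ℓ`.
    ∑t≥ : 4 * (y * ℓ * n) ≤ 2 * x * ∑ t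
    ∑t≥ = linear 0 (+-mono-≤ (≤-trans D≥ xD≤) (*-monoʳ-≤ n x≤yℓ)) (eq n (y * ℓ) (2 * x * ∑ t) x)
      where
      xD≤ : x * ∑ D ≤ n * (2 * (y * ℓ)) + 2 * x * ∑ t + n * x
      xD≤ = begin
        x * ∑ D ≡⟨ S-*ˡ (allFin n) x D ⟨
        (∑ λ b → x * D b) ≤⟨ S-mono (allFin n) (λ b → proj₂ (proj₂ (proj₂ (proj₂ (half-degree b))))) ⟩
        (∑ λ b → 2 * (y * ℓ) + 2 * x * t b + x) ≡⟨ trans (S-+ (allFin n) _ _) (cong (_+ ∑ {n} (λ _ → x)) (S-+ (allFin n) _ _)) ⟩
        ∑ {n} (λ _ → 2 * (y * ℓ)) + ∑ (λ b → 2 * x * t b) + ∑ {n} (λ _ → x)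
          ≡⟨ cong₂ _+_ (cong₂ _+_ (∑-const (2 * (y * ℓ))) (S-*ˡ (allFin n) (2 * x) t)) (∑-const x) ⟩
        n * (2 * (y * ℓ)) + 2 * x * ∑ t + n * x ∎
      eq : ∀ n a b x → 4 * (a * n) + (n * (2 * a) + b + n * x + n * a) + 0 ≡ b + (7 * (a * n) + n * x)
      eq = solve-∀
    -- In units of n²y²ℓ⁴ the left side is at least 4, and the terms with `K` and `n * n` are at
    -- most 2 and 1; the term with `G` has to supply the remaining 1.
    super = supersaturation (x * n) (y * ℓ) ℓ (2 * x) t (λ b → proj₁ (proj₂ (half-degree b)))
      (λ b → proj₁ (proj₂ (proj₂ (half-degree b)))) (λ b → proj₁ (proj₂ (proj₂ (proj₂ (half-degree b)))))
    final : n * n * (y * y * (ℓ * ℓ * (ℓ * ℓ))) ≤ n * n * (4 * (x * x * (x * x)) * G)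
    final = linear 0 (+-mono-≤ (+-mono-≤ super (*-monoʳ-≤ (ℓ * ℓ * (n * (y * ℓ))) ∑t≥)) (*-monoʳ-≤ (ℓ * ℓ * (n * n)) K≤))
      (eq n x y ℓ K G (∑ t))
      where eq : ∀ n x y ℓ K G T → n * n * (y * y * (ℓ * ℓ * (ℓ * ℓ))) +
                   (x * n * (x * n) * (2 * x * (2 * x)) * G + ℓ * ℓ * (x * n * (x * n) * K + n * n * (y * ℓ * (y * ℓ)))
                     + ℓ * ℓ * (n * (y * ℓ)) * (2 * x * T) + ℓ * ℓ * (n * n) * (2 * (y * y * (ℓ * ℓ)))) + 0
                 ≡ n * n * (4 * (x * x * (x * x)) * G) +
                   (2 * (ℓ * ℓ) * (x * n * (y * ℓ)) * T + ℓ * ℓ * (n * (y * ℓ)) * (4 * (y * ℓ * n)) + ℓ * ℓ * (n * n) * (x * x * K))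
            eq = solve-∀
    ℓ⁴≤ : ℓ * ℓ * (ℓ * ℓ) ≤ y * y * (ℓ * ℓ * (ℓ * ℓ))
    ℓ⁴≤ = ≤-trans (≤-reflexive (sym (*-identityˡ _))) (*-monoˡ-≤ (ℓ * ℓ * (ℓ * ℓ)) (*-mono-≤ 1≤y 1≤y))

  -- Stability: the structure forced by few 4-cycles.

  codeg≤D : ∀ x y → codeg x y ≤ D x
  codeg≤D x y = S-mono V λ u → ≤-trans (*-monoʳ-≤ (α x u) (α≤1 u y)) (≤-reflexive (*-identityʳ (α x u)))

  codeg-sym : ∀ x y → codeg x y ≡ codeg y x
  codeg-sym x y = S-cong V λ u → trans (*-comm (α x u) (α u y)) (cong₂ _*_ (α-sym u y) (α-sym x u))

  D+D≤n+codeg : ∀ x y → D x + D y ≤ n + codeg x y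
  D+D≤n+codeg x y = begin
    D x + D y ≡⟨ S-+ V (α x) (α y) ⟨
    (∑ λ u → α x u + α y u) ≤⟨ S-mono V (λ u → subst (λ a → α x u + a ≤ 1 + α x u * α u y) (α-sym u y) (bit (α≤1 x u) (α≤1 u y))) ⟩
    (∑ λ u → 1 + τ x y u) ≡⟨ S-+ V _ _ ⟩
    ∑ {n} (λ _ → 1) + codeg x y ≡⟨ cong (_+ codeg x y) (trans (∑-const 1) (*-identityʳ n)) ⟩
    n + codeg x y ∎
    where
    open ≤-Reasoning
    bit : ∀ {a b} → a ≤ 1 → b ≤ 1 → a + b ≤ 1 + a * b
    bit z≤n q = ≤-trans q (m≤m+n 1 _)
    bit (s≤s z≤n) q = s≤s (≤-reflexive (sym (+-identityʳ _)))

  -- Few edges of α meet vertices of class rest.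
  data Class (f h : ℕ) (b : Fin n) : Set where
    big   : n ≤ f * D b → Class f h b
    rest  : f * D b ≤ n → h ≤ k b → Class f h b
    small : k b ≤ h → Class f h b

  classify : ∀ f h b → Class f h b
  classify f h b with n ≤? f * D b | h ≤? k b
  ... | yes p | _     = big p
  ... | no ¬p | yes q = rest (<⇒≤ (≰⇒> ¬p)) q
  ... | no ¬p | no ¬q = small (<⇒≤ (≰⇒> ¬q))

  -- All errors are kept of order `1 / Q`. The threshold `h` for B-degrees is at most `ℓ / 2Q`, so
  -- that subtracting it from a degree costs little, and at least `ℓ / g`, so that few vertices
  -- reach it. With `f = 2gQ` these few are negligible unless their degree is linear; `z` balances
  -- the two squares in `QYν≤`.
  module Structure (ℓ Q g h f z : ℕ) (1≤ℓ : 1 ≤ ℓ) (1≤n : 1 ≤ n) (1≤Q : 1 ≤ Q) (1≤g : 1 ≤ g) (1≤f : 1 ≤ f)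
    (ℓ≤gh : ℓ ≤ g * h) (2Qh≤ℓ : 2 * Q * h ≤ ℓ) (f≡ : f ≡ 2 * g * Q) (z≡ : z ≡ 64 * (f * f) * Q)
    (8fQℓ≤n : 8 * f * Q * ℓ ≤ n) (2fℓ≤n : 2 * f * ℓ ≤ n) (2zℓ≤n : 2 * z * ℓ ≤ n) (4ℓ≤n : 4 * ℓ ≤ n)
    (K≤ : Q * K ≤ (Q + 1) * (ℓ * ℓ))
    (D≥ : 2 * Q * (ℓ * n) ≤ Q * ∑ D + 2 * (ℓ * n))
    (D≤ : ∑ D ≤ 8 * (ℓ * n))
    (g²QG≤ : g * g * Q * G ≤ ℓ * ℓ * (ℓ * ℓ)) (8QG≤ : 8 * Q * G ≤ ℓ * ℓ * (ℓ * ℓ)) where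

    open ≤-Reasoning

    K≤2ℓ² : K ≤ 2 * (ℓ * ℓ)
    K≤2ℓ² = cancel-≤ 1≤Q (linear 0 (+-mono-≤ K≤ (*-monoˡ-≤ (ℓ * ℓ) 1≤Q)) (eq Q K (ℓ * ℓ)))
      where eq : ∀ Q K l → Q * K + ((Q + 1) * l + Q * l) + 0 ≡ Q * (2 * l) + (Q * K + 1 * l)
            eq = solve-∀

    cls : ∀ b → Class f h b
    cls = classify f h

    β ρ s : Fin n → ℕ
    β b with cls b
    ... | big _    = 1
    ... | rest _ _ = 0
    ... | small _  = 0
    ρ b with cls b
    ... | big _    = 0
    ... | rest _ _ = 1
    ... | small _  = 0
    s b with cls b
    ... | big _    = 0
    ... | rest _ _ = 0
    ... | small _  = 1

    partition : ∀ b → β b + ρ b + s b ≡ 1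
    partition b with cls b
    ... | big _    = refl
    ... | rest _ _ = refl
    ... | small _  = refl

    s≤1 : ∀ b → s b ≤ 1
    s≤1 b with cls b
    ... | big _    = z≤n
    ... | rest _ _ = z≤n
    ... | small _  = ≤-refl

    β≤1 : ∀ b → β b ≤ 1
    β≤1 b with cls b
    ... | big _    = ≤-refl
    ... | rest _ _ = z≤n
    ... | small _  = z≤n

    βn≤fD : ∀ b → n * β b ≤ f * D b
    βn≤fD b with cls b
    ... | big p    = ≤-trans (≤-reflexive (*-identityʳ n)) p
    ... | rest _ _ = ≤-trans (≤-reflexive (*-zeroʳ n)) z≤n
    ... | small _  = ≤-trans (≤-reflexive (*-zeroʳ n)) z≤n

    fρD≤nρ : ∀ b → f * (ρ b * D b) ≤ n * ρ b
    fρD≤nρ b with cls b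
    ... | big _    = ≤-trans (≤-reflexive (*-zeroʳ f)) z≤n
    ... | rest p _ = ≤-trans (≤-reflexive (cong (f *_) (*-identityˡ (D b)))) (≤-trans p (≤-reflexive (sym (*-identityʳ n))))
    ... | small _  = ≤-trans (≤-reflexive (*-zeroʳ f)) z≤n

    hρ≤k : ∀ b → h * ρ b ≤ k b
    hρ≤k b with cls b
    ... | big _    = ≤-trans (≤-reflexive (*-zeroʳ h)) z≤n
    ... | rest _ q = ≤-trans (≤-reflexive (*-identityʳ h)) q
    ... | small _  = ≤-trans (≤-reflexive (*-zeroʳ h)) z≤n

    sk≤hs : ∀ b → s b * k b ≤ s b * h
    sk≤hs b with cls b
    ... | big _    = z≤n
    ... | rest _ _ = z≤n
    ... | small q  = *-monoʳ-≤ 1 q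

    sd : Fin n → ℕ
    sd b = ∑ λ a → α b a * s a

    sd≤n : ∀ b → sd b ≤ n
    sd≤n b = ∑-≤n λ a → *-mono-≤ (α≤1 b a) (s≤1 a)

    -- A small neighbour lies in at most `h` pairs of B, so the loss is `h * sd b` instead of `K`.
    -- This makes degrees near ℓ usable, for which `D²≤cherries+K` says nothing.
    sd²≤ : ∀ b → sd b * sd b ≤ cherries b + h * sd b
    sd²≤ b = begin
      sd b * sd b ≡⟨ ∑-product F F ⟩
      (∑∑ λ u v → F u * F v) ≤⟨ ∑∑-mono step ⟩
      (∑∑ λ u v → α b u * α b v * ν u v + F u * κ u v) ≡⟨ ∑∑-+ _ _ ⟩
      (∑∑ λ u v → α b u * α b v * ν u v) + (∑∑ λ u v → F u * κ u v)
        ≡⟨ cong₂ _+_ (cherries-ν b) (S-cong V λ u → S-*ˡ V (F u) (κ u)) ⟩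
      cherries b + (∑ λ u → F u * k u) ≤⟨ +-monoʳ-≤ (cherries b) (S-mono V step′) ⟩
      cherries b + (∑ λ u → h * F u) ≡⟨ cong (cherries b +_) (S-*ˡ V h F) ⟩
      cherries b + h * sd b ∎
      where
      F : Fin n → ℕ
      F u = α b u * s u
      step : ∀ u v → F u * F v ≤ α b u * α b v * ν u v + F u * κ u v
      step u v = begin
        F u * F v ≡⟨ *-identityʳ _ ⟨
        F u * F v * 1 ≡⟨ cong (F u * F v *_) (ν+κ u v) ⟨
        F u * F v * (ν u v + κ u v) ≡⟨ eq (α b u) (s u) (α b v) (s v) (ν u v) (κ u v) ⟩
        α b u * α b v * ν u v * (s u * s v) + F u * κ u v * F v
          ≤⟨ +-mono-≤ (≤-trans (*-monoʳ-≤ (α b u * α b v * ν u v) (*-mono-≤ (s≤1 u) (s≤1 v))) (≤-reflexive (*-identityʳ (α b u * α b v * ν u v))))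
                      (≤-trans (*-monoʳ-≤ (F u * κ u v) (*-mono-≤ (α≤1 b v) (s≤1 v))) (≤-reflexive (*-identityʳ (F u * κ u v)))) ⟩
        α b u * α b v * ν u v + F u * κ u v ∎
        where eq : ∀ a s b t v k → a * s * (b * t) * (v + k) ≡ a * b * v * (s * t) + a * s * k * (b * t)
              eq = solve-∀
      step′ : ∀ u → F u * k u ≤ h * F u
      step′ u = begin
        α b u * s u * k u ≡⟨ *-assoc (α b u) (s u) (k u) ⟩
        α b u * (s u * k u) ≤⟨ *-monoʳ-≤ (α b u) (sk≤hs u) ⟩
        α b u * (s u * h) ≡⟨ eq (α b u) (s u) h ⟩
        h * F u ∎
        where eq : ∀ a s h → a * (s * h) ≡ h * (a * s)
              eq = solve-∀

    2ℓ≤D : ∀ b → n ≤ f * D b → 2 * ℓ ≤ D b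
    2ℓ≤D b p = cancel-≤ 1≤f (≤-trans (≤-reflexive (eq f ℓ)) (≤-trans 2fℓ≤n p))
      where eq : ∀ f ℓ → f * (2 * ℓ) ≡ 2 * f * ℓ
            eq = solve-∀

    Tuned : Fin n → ℕ → Set
    Tuned b t = (t * t ≤ cherries b) × (t ≤ n) × ((t ≡ 0) ⊎ (ℓ ≤ g * t))
      × (β b * D b + s b * sd b ≤ t + ℓ * β b + 2 * h)

    -- `D b ∸ ℓ` at big vertices and `sd b ∸ h` at small ones are almost the whole degree; halving
    -- degrees as in `dense` would lose the sharp constant.
    tune : ∀ b → Σ ℕ (Tuned b)
    tune b with cls b
    ... | rest _ _ = 0 , z≤n , z≤n , inj₁ refl , z≤n
    ... | big p = gap , sq , ≤-trans (m∸n≤m (D b) ℓ) (D≤n b) ,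
          inj₂ (≤-trans ℓ≤e (≤-trans (≤-reflexive (sym (*-identityˡ gap))) (*-monoˡ-≤ gap 1≤g))) ,
          ≤-trans (≤-reflexive (trans (cong (λ x → 1 * x + 0) D≡) (eq ℓ gap))) (m≤m+n (gap + ℓ * 1) (2 * h))
      where
      gap = D b ∸ ℓ
      ℓ≤D : ℓ ≤ D b
      ℓ≤D = ≤-trans (m≤m+n ℓ _) (2ℓ≤D b p)
      D≡ : D b ≡ ℓ + gap
      D≡ = sym (m+[n∸m]≡n ℓ≤D)
      eq : ∀ ℓ gap → 1 * (ℓ + gap) + 0 ≡ gap + ℓ * 1
      eq = solve-∀
      ℓ≤e : ℓ ≤ gap
      ℓ≤e = +-cancelˡ-≤ ℓ ℓ gap (≤-trans (≤-reflexive (cong (ℓ +_) (sym (+-identityʳ ℓ)))) (subst (2 * ℓ ≤_) D≡ (2ℓ≤D b p)))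
      -- The square of `ℓ + gap` exceeds that of `gap` by at least `3ℓ²`, more than `K`.
      sq : gap * gap ≤ cherries b
      sq = linear (ℓ * ℓ) (+-mono-≤ (+-mono-≤ (subst (λ d → d * d ≤ cherries b + K) D≡ (D²≤cherries+K b)) K≤2ℓ²) (*-monoʳ-≤ (2 * ℓ) ℓ≤e))
             (eq′ ℓ gap (cherries b) K)
        where eq′ : ∀ ℓ gap c K → gap * gap + (c + K + 2 * (ℓ * ℓ) + 2 * ℓ * gap) + ℓ * ℓ ≡ c + ((ℓ + gap) * (ℓ + gap) + K + 2 * ℓ * ℓ)
              eq′ = solve-∀
    ... | small _ with 2 * h ≤? sd b
    ...   | no ¬q = 0 , z≤n , z≤n , inj₁ refl ,
            ≤-trans (≤-reflexive (+-identityʳ (sd b))) (≤-trans (<⇒≤ (≰⇒> ¬q)) (m≤n+m (2 * h) (ℓ * 0)))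
    ...   | yes q = gap , sq , ≤-trans (m∸n≤m (sd b) h) (sd≤n b) , inj₂ (≤-trans ℓ≤gh (*-monoʳ-≤ g h≤e)) ,
            ≤-trans (≤-reflexive (cong (λ x → 1 * x) sd≡)) (linear h z≤n (eq ℓ gap h))
      where
      gap = sd b ∸ h
      sd≡ : sd b ≡ h + gap
      sd≡ = sym (m+[n∸m]≡n (≤-trans (m≤m+n h _) q))
      eq : ∀ ℓ gap h → 1 * (h + gap) + 0 + h ≡ gap + ℓ * 0 + 2 * h + 0
      eq = solve-∀
      h≤e : h ≤ gap
      h≤e = +-cancelˡ-≤ h h gap (≤-trans (≤-reflexive (cong (h +_) (sym (+-identityʳ h)))) (subst (2 * h ≤_) sd≡ q))
      sq : gap * gap ≤ cherries b
      sq = linear (h * gap) (subst (λ d → d * d ≤ cherries b + h * d) sd≡ (sd²≤ b)) (eq′ h gap (cherries b))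
        where eq′ : ∀ h gap c → gap * gap + (c + h * (h + gap)) + h * gap ≡ c + (h + gap) * (h + gap)
              eq′ = solve-∀

    t : Fin n → ℕ
    t b = proj₁ (tune b)

    Dβ Dρ Ds : ℕ
    Dβ = ∑ λ b → β b * D b
    Dρ = ∑ λ b → ρ b * D b
    Ds = ∑ λ b → s b * sd b

    ∑β≤ : ∑ β ≤ 8 * f * ℓ
    ∑β≤ = cancel-≤ 1≤n (begin
      n * ∑ β ≡⟨ S-*ˡ V n β ⟨
      (∑ λ b → n * β b) ≤⟨ S-mono V βn≤fD ⟩
      (∑ λ b → f * D b) ≡⟨ S-*ˡ V f D ⟩
      f * ∑ D ≤⟨ *-monoʳ-≤ f D≤ ⟩
      f * (8 * (ℓ * n)) ≡⟨ eq f ℓ n ⟩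
      n * (8 * f * ℓ) ∎)
      where eq : ∀ f ℓ n → f * (8 * (ℓ * n)) ≡ n * (8 * f * ℓ)
            eq = solve-∀

    -- At most `2gℓ` vertices are of class `rest`, since each has B-degree at least `ℓ / g` and
    -- `K ≤ 2ℓ²`; each has degree at most `n / f`.
    QDρ≤ : Q * Dρ ≤ ℓ * n
    QDρ≤ = cancel-≤ 1≤g (*-cancelˡ-≤ 2 (begin
      2 * (g * (Q * Dρ)) ≡⟨ eq g Q Dρ ⟩
      2 * g * Q * Dρ ≡⟨ cong (_* Dρ) f≡ ⟨
      f * Dρ ≡⟨ S-*ˡ V f (λ b → ρ b * D b) ⟨
      (∑ λ b → f * (ρ b * D b)) ≤⟨ S-mono V fρD≤nρ ⟩
      (∑ λ b → n * ρ b) ≡⟨ S-*ˡ V n ρ ⟩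
      n * ∑ ρ ≤⟨ *-monoʳ-≤ n ∑ρ≤ ⟩
      n * (2 * g * ℓ) ≡⟨ eq′ n g ℓ ⟩
      2 * (g * (ℓ * n)) ∎))
      where
      eq : ∀ g Q d → 2 * (g * (Q * d)) ≡ 2 * g * Q * d
      eq = solve-∀
      eq′ : ∀ n g ℓ → n * (2 * g * ℓ) ≡ 2 * (g * (ℓ * n))
      eq′ = solve-∀
      ∑ρ≤ : ∑ ρ ≤ 2 * g * ℓ
      ∑ρ≤ = cancel-≤ 1≤ℓ (begin
        ℓ * ∑ ρ ≤⟨ *-monoˡ-≤ (∑ ρ) ℓ≤gh ⟩
        g * h * ∑ ρ ≡⟨ *-assoc g h (∑ ρ) ⟩
        g * (h * ∑ ρ) ≡⟨ cong (g *_) (S-*ˡ V h ρ) ⟨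
        g * (∑ λ b → h * ρ b) ≤⟨ *-monoʳ-≤ g (S-mono V hρ≤k) ⟩
        g * K ≤⟨ *-monoʳ-≤ g K≤2ℓ² ⟩
        g * (2 * (ℓ * ℓ)) ≡⟨ eq″ g ℓ ⟩
        ℓ * (2 * g * ℓ) ∎)
        where eq″ : ∀ g ℓ → g * (2 * (ℓ * ℓ)) ≡ ℓ * (2 * g * ℓ)
              eq″ = solve-∀

    -- An edge that meets no vertex of class `big` or `rest` joins two small ones. Such edges are
    -- already counted from both ends in `Ds`, hence its coefficient 1; the gap between 1 and 2 is
    -- what later isolates `Dβ`.
    ∑D≤ : ∑ D ≤ 2 * Dβ + 2 * Dρ + Ds
    ∑D≤ = begin
      (∑∑ λ u v → α u v) ≤⟨ ∑∑-mono step ⟩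
      (∑∑ λ u v → β u * α u v + β v * α v u + (ρ u * α u v + ρ v * α v u) + s u * (α u v * s v))
        ≡⟨ trans (∑∑-+ _ _) (cong₂ _+_ (trans (∑∑-+ _ _) (cong₂ _+_ (∑∑-+ _ _) (∑∑-+ _ _))) (S-cong V λ u → S-*ˡ V (s u) _)) ⟩
      (∑∑ λ u v → β u * α u v) + (∑∑ λ u v → β v * α v u) + ((∑∑ λ u v → ρ u * α u v) + (∑∑ λ u v → ρ v * α v u)) + Ds
        ≡⟨ cong₂ (λ a b → a + b + Ds) (both β) (both ρ) ⟩
      2 * Dβ + 2 * Dρ + Ds ∎
      where
      both : (w : Fin n → ℕ) → (∑∑ λ u v → w u * α u v) + (∑∑ λ u v → w v * α v u) ≡ 2 * (∑ λ b → w b * D b)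
      both w = trans (cong₂ _+_ row (trans (∑∑-swap _) row)) (cong (X +_) (sym (+-identityʳ X)))
        where X = ∑ λ b → w b * D b
              row : (∑∑ λ u v → w u * α u v) ≡ X
              row = S-cong V λ u → S-*ˡ V (w u) (α u)
      cover : ∀ a β ρ s β′ ρ′ s′ → β + ρ + s ≡ 1 → β′ + ρ′ + s′ ≡ 1 →
        a ≤ β * a + β′ * a + (ρ * a + ρ′ * a) + s * (a * s′)
      cover a β ρ s β′ ρ′ s′ p p′ = linear (β * ((β′ + ρ′) * a) + ρ * ((β′ + ρ′) * a)) z≤n (trans
        (cong (λ x → x + 0 + (β * ((β′ + ρ′) * a) + ρ * ((β′ + ρ′) * a)))
          (trans (sym (trans (cong₂ (λ x y → x * y * a) p p′) (*-identityˡ a))) refl))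
        (trans (eq a β ρ s β′ ρ′ s′) (trans (cong₂ (λ x y → β * (a * x) + ρ * (a * x) + (β′ + ρ′) * (a * y) + s * (a * s′)) p′ p) (eq′ a β ρ s β′ ρ′ s′))))
        where
        eq : ∀ a β ρ s β′ ρ′ s′ → (β + ρ + s) * (β′ + ρ′ + s′) * a + 0 + (β * ((β′ + ρ′) * a) + ρ * ((β′ + ρ′) * a))
          ≡ β * (a * (β′ + ρ′ + s′)) + ρ * (a * (β′ + ρ′ + s′)) + (β′ + ρ′) * (a * (β + ρ + s)) + s * (a * s′)
        eq = solve-∀
        eq′ : ∀ a β ρ s β′ ρ′ s′ → β * (a * 1) + ρ * (a * 1) + (β′ + ρ′) * (a * 1) + s * (a * s′)
          ≡ β * a + β′ * a + (ρ * a + ρ′ * a) + s * (a * s′) + 0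
        eq′ = solve-∀
      step : ∀ u v → α u v ≤ β u * α u v + β v * α v u + (ρ u * α u v + ρ v * α v u) + s u * (α u v * s v)
      step u v = subst (λ a → α u v ≤ β u * α u v + β v * a + (ρ u * α u v + ρ v * a) + s u * (α u v * s v)) (α-sym u v)
        (cover (α u v) (β u) (ρ u) (s u) (β v) (ρ v) (s v) (partition u) (partition v))

    Q∑t≤ : Q * ∑ t ≤ (Q + 1) * (ℓ * n)
    Q∑t≤ = cancel-≤ (*-mono-≤ (*-mono-≤ (*-mono-≤ {1} {2} (s≤s z≤n) 1≤ℓ) (*-mono-≤ 1≤ℓ 1≤ℓ)) 1≤n)
      (linear 0 (+-mono-≤ (+-mono-≤ (*-monoʳ-≤ Q super) (*-monoʳ-≤ (n * n) g²QG≤)) (*-monoʳ-≤ (ℓ * ℓ * (n * n)) K≤))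
        (eq Q n ℓ (∑ t) g G K))
      where
      -- As `K` is at most about `ℓ²`, the right ratio is p : r = n : ℓ.
      super = supersaturation n ℓ ℓ g t (λ b → proj₁ (proj₂ (tune b)))
        (λ b → proj₁ (proj₂ (proj₂ (tune b)))) (λ b → proj₁ (proj₂ (proj₂ (proj₂ (tune b)))))
      eq : ∀ Q n ℓ T g G K → 2 * ℓ * (ℓ * ℓ) * n * (Q * T) +
             (Q * (n * n * (g * g) * G + ℓ * ℓ * (n * n * K + n * n * (ℓ * ℓ))) + n * n * (ℓ * ℓ * (ℓ * ℓ)) + ℓ * ℓ * (n * n) * ((Q + 1) * (ℓ * ℓ))) + 0
           ≡ 2 * ℓ * (ℓ * ℓ) * n * ((Q + 1) * (ℓ * n)) +
             (Q * (2 * (ℓ * ℓ) * (n * ℓ) * T) + n * n * (g * g * Q * G) + ℓ * ℓ * (n * n) * (Q * K))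
      eq = solve-∀

    -- Of the two excess units beyond `Q∑t≤`, one pays for the loss of ℓ at each of the at most
    -- `8fℓ` big vertices, where ℓ has to be small compared with n, and one for the loss of `2h` at
    -- every vertex.
    QDβ+QDs≤ : Q * Dβ + Q * Ds ≤ (Q + 3) * (ℓ * n)
    QDβ+QDs≤ = linear 0 (+-mono-≤ (+-mono-≤ (+-mono-≤ (*-monoʳ-≤ Q Dβ+Ds≤) Q∑t≤) (*-monoʳ-≤ (Q * ℓ) ∑β≤))
                          (+-mono-≤ (*-monoʳ-≤ ℓ 8fQℓ≤n) (*-monoʳ-≤ n 2Qh≤ℓ)))
                 (eq Q Dβ Ds (∑ t) ℓ n (∑ β) h f)
      where
      Dβ+Ds≤ : Dβ + Ds ≤ ∑ t + ℓ * ∑ β + n * (2 * h)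
      Dβ+Ds≤ = begin
        Dβ + Ds ≡⟨ S-+ V _ _ ⟨
        (∑ λ b → β b * D b + s b * sd b) ≤⟨ S-mono V (λ b → proj₂ (proj₂ (proj₂ (proj₂ (tune b))))) ⟩
        (∑ λ b → t b + ℓ * β b + 2 * h) ≡⟨ trans (S-+ V _ _) (cong₂ _+_ (trans (S-+ V _ _) (cong (∑ t +_) (S-*ˡ V ℓ β))) (∑-const (2 * h))) ⟩
        ∑ t + ℓ * ∑ β + n * (2 * h) ∎
      eq : ∀ Q a b T ℓ n B h f → Q * a + Q * b +
             (Q * (T + ℓ * B + n * (2 * h)) + (Q + 1) * (ℓ * n) + Q * ℓ * (8 * f * ℓ) + (ℓ * n + n * ℓ)) + 0
           ≡ (Q + 3) * (ℓ * n) + (Q * (a + b) + Q * T + Q * ℓ * B + (ℓ * (8 * f * Q * ℓ) + n * (2 * Q * h)))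
      eq = solve-∀

    -- Compare Dβ + Ds ≲ ℓn with 2ℓn ≲ ∑ D ≲ 2 Dβ + Ds.
    QDβ≥ : Q * (ℓ * n) ≤ Q * Dβ + 7 * (ℓ * n)
    QDβ≥ = linear 0 (+-mono-≤ (+-mono-≤ (+-mono-≤ D≥ (*-monoʳ-≤ Q ∑D≤)) QDβ+QDs≤) (*-monoʳ-≤ 2 QDρ≤))
      (eq Q (ℓ * n) Dβ Dρ Ds (∑ D))
      where eq : ∀ Q m a r s d → Q * m + (Q * d + 2 * m + Q * (2 * a + 2 * r + s) + (Q + 3) * m + 2 * m) + 0
                 ≡ Q * a + 7 * m + (2 * Q * m + Q * d + (Q * a + Q * s) + 2 * (Q * r))
            eq = solve-∀

    bd : Fin n → ℕ
    bd a = ∑ λ u → α a u * β u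

    Yκ Yν : ℕ
    Yκ = ∑∑ λ u v → κ u v * (β u * β v * codeg u v)
    Yν = ∑∑ λ u v → ν u v * (β u * β v * codeg u v)

    ∑bd : ∑ bd ≡ Dβ
    ∑bd = trans (∑∑-swap (λ a u → α a u * β u)) (S-cong V λ u → trans (S-*ʳ V (λ a → α a u) (β u))
      (trans (*-comm _ (β u)) (cong (β u *_) (S-cong V λ a → α-sym a u))))

    ∑bd² : ∑ (λ a → bd a * bd a) ≡ Yκ + Yν
    ∑bd² = begin-equality
      (∑ λ a → bd a * bd a) ≡⟨ (S-cong V λ a → ∑-product (λ u → α a u * β u) (λ v → α a v * β v)) ⟩
      (∑ λ a → ∑∑ λ u v → α a u * β u * (α a v * β v)) ≡⟨ ∑-∑∑-swap _ ⟩
      (∑∑ λ u v → ∑ λ a → α a u * β u * (α a v * β v)) ≡⟨ (∑∑-cong λ u v → trans (S-cong V λ a →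
           trans (cong (λ x → x * β u * (α a v * β v)) (α-sym a u)) (eq (α u a) (β u) (α a v) (β v))) (S-*ˡ V (β u * β v) (τ u v))) ⟩
      (∑∑ λ u v → β u * β v * codeg u v) ≡⟨ (∑∑-cong λ u v → trans (sym (*-identityˡ _)) (trans (cong (_* (β u * β v * codeg u v)) (trans (sym (ν+κ u v)) (+-comm (ν u v) (κ u v)))) (*-distribʳ-+ _ (κ u v) (ν u v)))) ⟩
      (∑∑ λ u v → κ u v * (β u * β v * codeg u v) + ν u v * (β u * β v * codeg u v)) ≡⟨ ∑∑-+ _ _ ⟩
      Yκ + Yν ∎
      where eq : ∀ x b y c → x * b * (y * c) ≡ b * c * (x * y)
            eq = solve-∀

    -- Cauchy-Schwarz as the tangent inequality at `bd a = ℓ`, the number of big neighbours of a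
    -- typical vertex in the extremal example.
    QY≥ : Q * (n * (ℓ * ℓ)) ≤ Q * (Yκ + Yν) + 14 * (n * (ℓ * ℓ))
    QY≥ = linear 0 (+-mono-≤ (*-monoʳ-≤ Q cs) (*-monoʳ-≤ (2 * ℓ) QDβ≥)) (eq Q ℓ n Dβ (Yκ + Yν))
      where
      cs : 2 * ℓ * Dβ ≤ Yκ + Yν + n * (ℓ * ℓ)
      cs = begin
        2 * ℓ * Dβ ≡⟨ cong (2 * ℓ *_) ∑bd ⟨
        2 * ℓ * ∑ bd ≡⟨ S-*ˡ V (2 * ℓ) bd ⟨
        (∑ λ a → 2 * ℓ * bd a) ≤⟨ S-mono V (λ a → ≤-trans (≤-reflexive (trans (*-assoc 2 ℓ (bd a)) (cong (2 *_) (*-comm ℓ (bd a))))) (2ab≤a²+b² (bd a) ℓ)) ⟩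
        (∑ λ a → bd a * bd a + ℓ * ℓ) ≡⟨ trans (S-+ V _ _) (cong₂ _+_ ∑bd² (∑-const (ℓ * ℓ))) ⟩
        Yκ + Yν + n * (ℓ * ℓ) ∎
      eq : ∀ Q ℓ n d y → Q * (n * (ℓ * ℓ)) + (Q * (y + n * (ℓ * ℓ)) + 2 * ℓ * (Q * d + 7 * (ℓ * n))) + 0
         ≡ Q * y + 14 * (n * (ℓ * ℓ)) + (Q * (2 * ℓ * d) + 2 * ℓ * (Q * (ℓ * n)))
      eq = solve-∀

    G≤ℓ⁴ : G ≤ ℓ * ℓ * (ℓ * ℓ)
    G≤ℓ⁴ = ≤-trans (≤-trans (≤-reflexive (sym (*-identityˡ G))) (*-monoˡ-≤ G (*-mono-≤ {1} {8} (s≤s z≤n) 1≤Q))) 8QG≤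

    -- Non-edges of κ between big vertices: many common neighbours would produce too many 4-cycles.
    QYν≤ : Q * Yν ≤ 2 * (ℓ * ℓ * n)
    QYν≤ = cancel-≤ {128 * (f * f) * n} (*-mono-≤ {1} {128 * (f * f)} (*-mono-≤ {1} {128} (s≤s z≤n) (*-mono-≤ 1≤f 1≤f)) 1≤n) (begin
      128 * (f * f) * n * (Q * Yν) ≡⟨ eq f n Q Yν ⟩
      2 * n * (64 * (f * f) * Q) * Yν ≡⟨ cong (λ w → 2 * n * w * Yν) z≡ ⟨
      2 * n * z * Yν ≤⟨ amgm ⟩
      z * z * G + ∑ β * ∑ β * (z * z * K + n * n)
        ≤⟨ +-mono-≤ (≤-trans (*-monoʳ-≤ (z * z) G≤ℓ⁴) z²ℓ⁴≤) (*-mono-≤ (*-mono-≤ ∑β≤ ∑β≤) z²K≤) ⟩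
      f * f * (ℓ * ℓ) * (n * n) + 8 * f * ℓ * (8 * f * ℓ) * (2 * (n * n)) ≤⟨ linear (127 * (f * f * (ℓ * ℓ) * (n * n))) z≤n (eq′ f ℓ n) ⟩
      128 * (f * f) * n * (2 * (ℓ * ℓ * n)) ∎)
      where
      eq : ∀ f n Q Y → 128 * (f * f) * n * (Q * Y) ≡ 2 * n * (64 * (f * f) * Q) * Y
      eq = solve-∀
      eq′ : ∀ f ℓ n → f * f * (ℓ * ℓ) * (n * n) + 8 * f * ℓ * (8 * f * ℓ) * (2 * (n * n)) + 0 + 127 * (f * f * (ℓ * ℓ) * (n * n))
        ≡ 128 * (f * f) * n * (2 * (ℓ * ℓ * n)) + 0
      eq′ = solve-∀
      4z²ℓ²≤ : 4 * (z * z * (ℓ * ℓ)) ≤ n * n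
      4z²ℓ²≤ = ≤-trans (≤-reflexive (eq″ z ℓ)) (*-mono-≤ 2zℓ≤n 2zℓ≤n)
        where eq″ : ∀ z ℓ → 4 * (z * z * (ℓ * ℓ)) ≡ 2 * z * ℓ * (2 * z * ℓ)
              eq″ = solve-∀
      z²K≤ : z * z * K + n * n ≤ 2 * (n * n)
      z²K≤ = linear (2 * (z * z * (ℓ * ℓ))) (+-mono-≤ (*-monoʳ-≤ (z * z) K≤2ℓ²) 4z²ℓ²≤) (eq″ (z * z) K (ℓ * ℓ) (n * n))
        where eq″ : ∀ z K l n → z * K + n + (z * (2 * l) + n) + 2 * (z * l) ≡ 2 * n + (z * K + 4 * (z * l))
              eq″ = solve-∀
      z²ℓ⁴≤ : z * z * (ℓ * ℓ * (ℓ * ℓ)) ≤ f * f * (ℓ * ℓ) * (n * n)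
      z²ℓ⁴≤ = begin
        z * z * (ℓ * ℓ * (ℓ * ℓ)) ≡⟨ eq″ (z * z) (ℓ * ℓ) ⟩
        ℓ * ℓ * (1 * (z * z * (ℓ * ℓ))) ≤⟨ *-monoʳ-≤ (ℓ * ℓ) (*-monoˡ-≤ (z * z * (ℓ * ℓ)) {1} {4} (s≤s z≤n)) ⟩
        ℓ * ℓ * (4 * (z * z * (ℓ * ℓ))) ≤⟨ *-monoʳ-≤ (ℓ * ℓ) 4z²ℓ²≤ ⟩
        ℓ * ℓ * (n * n) ≡⟨ *-identityˡ _ ⟨
        1 * (ℓ * ℓ * (n * n)) ≤⟨ *-monoˡ-≤ (ℓ * ℓ * (n * n)) (*-mono-≤ 1≤f 1≤f) ⟩
        f * f * (ℓ * ℓ * (n * n)) ≡⟨ *-assoc (f * f) (ℓ * ℓ) (n * n) ⟨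
        f * f * (ℓ * ℓ) * (n * n) ∎
        where eq″ : ∀ z l → z * (l * l) ≡ l * (1 * (z * l))
              eq″ = solve-∀
      -- `2 (z codeg) n` is bounded by the sum of the squares, and `codeg²` by `opp + K`; the sum of
      -- `opp` over pairs outside B is `G`.
      amgm : 2 * n * z * Yν ≤ z * z * G + ∑ β * ∑ β * (z * z * K + n * n)
      amgm = begin
        2 * n * z * Yν ≡⟨ ∑∑-*ˡ (2 * n * z) _ ⟨
        (∑∑ λ u v → 2 * n * z * (ν u v * (β u * β v * codeg u v))) ≤⟨ ∑∑-mono step ⟩
        (∑∑ λ u v → z * z * (ν u v * opp u v) + β u * β v * (z * z * K + n * n)) ≡⟨ ∑∑-+ _ _ ⟩
        (∑∑ λ u v → z * z * (ν u v * opp u v)) + (∑∑ λ u v → β u * β v * (z * z * K + n * n))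
          ≡⟨ cong₂ _+_ (trans (∑∑-*ˡ (z * z) _) (cong (z * z *_) (sym G-opp)))
                       (trans (∑∑-*ʳ _ (z * z * K + n * n)) (cong (_* (z * z * K + n * n)) (sym (∑-product β β)))) ⟩
        z * z * G + ∑ β * ∑ β * (z * z * K + n * n) ∎
        where
        step : ∀ u v → 2 * n * z * (ν u v * (β u * β v * codeg u v)) ≤ z * z * (ν u v * opp u v) + β u * β v * (z * z * K + n * n)
        step u v = begin
          2 * n * z * (ν u v * (β u * β v * codeg u v)) ≡⟨ eq₁ n z (ν u v) (β u * β v) (codeg u v) ⟩
          ν u v * (β u * β v) * (2 * (z * codeg u v * n)) ≤⟨ *-monoʳ-≤ (ν u v * (β u * β v)) (2ab≤a²+b² (z * codeg u v) n) ⟩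
          ν u v * (β u * β v) * (z * codeg u v * (z * codeg u v) + n * n)
            ≤⟨ *-monoʳ-≤ (ν u v * (β u * β v)) (+-monoˡ-≤ (n * n) (≤-trans (≤-reflexive (eq₂ z (codeg u v))) (*-monoʳ-≤ (z * z) (codeg²≤opp+K u v)))) ⟩
          ν u v * (β u * β v) * (z * z * (opp u v + K) + n * n) ≡⟨ eq₃ (ν u v) (β u * β v) (z * z) (opp u v) K (n * n) ⟩
          β u * β v * (z * z * (ν u v * opp u v)) + ν u v * (β u * β v * (z * z * K + n * n))
            ≤⟨ +-mono-≤ (≤-trans (*-monoˡ-≤ (z * z * (ν u v * opp u v)) (*-mono-≤ (β≤1 u) (β≤1 v))) (≤-reflexive (*-identityˡ _)))
                        (≤-trans (*-monoˡ-≤ (β u * β v * (z * z * K + n * n)) (ν≤1 u v)) (≤-reflexive (*-identityˡ _))) ⟩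
          z * z * (ν u v * opp u v) + β u * β v * (z * z * K + n * n) ∎
          where
          eq₁ : ∀ n z v b c → 2 * n * z * (v * (b * c)) ≡ v * b * (2 * (z * c * n))
          eq₁ = solve-∀
          eq₂ : ∀ z c → z * c * (z * c) ≡ z * z * (c * c)
          eq₂ = solve-∀
          eq₃ : ∀ v b z o K m → v * b * (z * (o + K) + m) ≡ b * (z * (v * o)) + v * (b * (z * K + m))
          eq₃ = solve-∀

    core : Fin n → Bool
    core b = 3 * n ≤ᵇ 4 * D b

    κcore νcore : ℕ
    κcore = ∑∑ λ u v → κ u v * (⟦ core u ⟧ * ⟦ core v ⟧)
    νcore = ∑∑ λ u v → ν u v * (⟦ core u ⟧ * ⟦ core v ⟧)

    4codeg≤ : ∀ u v → 4 * codeg u v ≤ 3 * n + n * (⟦ core u ⟧ * ⟦ core v ⟧)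
    4codeg≤ u v with core u in p | core v in q
    ... | true  | true  = ≤-trans (*-monoʳ-≤ 4 (≤-trans (codeg≤D u v) (D≤n u))) (≤-reflexive (eq n))
      where eq : ∀ n → 4 * n ≡ 3 * n + n * (1 * 1)
            eq = solve-∀
    ... | true  | false = ≤-trans (≤-trans (*-monoʳ-≤ 4 (≤-trans (≤-reflexive (codeg-sym u v)) (codeg≤D v u))) (<⇒≤ (≤ᵇ-false (3 * n) (4 * D v) q))) (m≤m+n (3 * n) _)
    ... | false | _     = ≤-trans (≤-trans (*-monoʳ-≤ 4 (codeg≤D u v)) (<⇒≤ (≤ᵇ-false (3 * n) (4 * D u) p))) (m≤m+n (3 * n) _)

    -- Almost `nℓ²` paths join big pairs of B, of which there are hardly more than `ℓ²`, so nearly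
    -- all of them need close to `n` paths. A pair not inside the core has at most `3n / 4`. The
    -- constant is 4·14 + 4·2 + 3.
    κcore≥ : Q * (ℓ * ℓ) ≤ Q * κcore + 67 * (ℓ * ℓ)
    κcore≥ = cancel-≤ 1≤n (linear 0 (+-mono-≤ (+-mono-≤ (*-monoʳ-≤ 4 QY≥) (*-monoʳ-≤ Q 4Yκ≤)) (+-mono-≤ (*-monoʳ-≤ 4 QYν≤) (*-monoʳ-≤ (3 * n) K≤)))
      (eq Q n (ℓ * ℓ) Yκ Yν K κcore))
      where
      4Yκ≤ : 4 * Yκ ≤ 3 * n * K + n * κcore
      4Yκ≤ = begin
        4 * Yκ ≡⟨ ∑∑-*ˡ 4 _ ⟨
        (∑∑ λ u v → 4 * (κ u v * (β u * β v * codeg u v))) ≤⟨ ∑∑-mono step ⟩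
        (∑∑ λ u v → 3 * n * κ u v + n * (κ u v * (⟦ core u ⟧ * ⟦ core v ⟧))) ≡⟨ trans (∑∑-+ _ _) (cong₂ _+_ (∑∑-*ˡ (3 * n) κ) (∑∑-*ˡ n _)) ⟩
        3 * n * K + n * κcore ∎
        where
        step : ∀ u v → 4 * (κ u v * (β u * β v * codeg u v)) ≤ 3 * n * κ u v + n * (κ u v * (⟦ core u ⟧ * ⟦ core v ⟧))
        step u v = begin
          4 * (κ u v * (β u * β v * codeg u v)) ≡⟨ eq₁ (κ u v) (β u * β v) (codeg u v) ⟩
          β u * β v * (κ u v * (4 * codeg u v)) ≤⟨ *-monoˡ-≤ _ (*-mono-≤ (β≤1 u) (β≤1 v)) ⟩
          1 * (κ u v * (4 * codeg u v)) ≤⟨ *-monoʳ-≤ 1 (*-monoʳ-≤ (κ u v) (4codeg≤ u v)) ⟩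
          1 * (κ u v * (3 * n + n * (⟦ core u ⟧ * ⟦ core v ⟧))) ≡⟨ eq₂ (κ u v) n (⟦ core u ⟧ * ⟦ core v ⟧) ⟩
          3 * n * κ u v + n * (κ u v * (⟦ core u ⟧ * ⟦ core v ⟧)) ∎
          where
          eq₁ : ∀ k b c → 4 * (k * (b * c)) ≡ b * (k * (4 * c))
          eq₁ = solve-∀
          eq₂ : ∀ k n w → 1 * (k * (3 * n + n * w)) ≡ 3 * n * k + n * (k * w)
          eq₂ = solve-∀
      eq : ∀ Q n l a b K c → n * (Q * l) +
             (4 * (Q * (a + b) + 14 * (n * l)) + Q * (3 * n * K + n * c) + (4 * (2 * (l * n)) + 3 * n * ((Q + 1) * l))) + 0
           ≡ n * (Q * c + 67 * l) + (4 * (Q * (n * l)) + Q * (4 * a) + (4 * (Q * b) + 3 * n * (Q * K)))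
      eq = solve-∀

    -- Two core vertices share at least `n / 2` neighbours, and these span at least
    -- `n² / 4 - K ≥ n² / 8` pairs outside B. Each core pair outside B is thus a diagonal of many
    -- cycles counted by `G`.
    νcore≤ : Q * νcore ≤ ℓ * ℓ
    νcore≤ = cancel-≤ (*-mono-≤ 1≤n 1≤n) (begin
      n * n * (Q * νcore) ≡⟨ eq (n * n) Q νcore ⟩
      Q * (n * n * νcore) ≡⟨ cong (Q *_) (∑∑-*ˡ (n * n) _) ⟨
      Q * (∑∑ λ u v → n * n * (ν u v * (⟦ core u ⟧ * ⟦ core v ⟧))) ≤⟨ *-monoʳ-≤ Q (∑∑-mono step) ⟩
      Q * (∑∑ λ u v → 8 * (ν u v * opp u v)) ≡⟨ cong (Q *_) (trans (∑∑-*ˡ 8 _) (cong (8 *_) (sym G-opp))) ⟩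
      Q * (8 * G) ≡⟨ eq′ Q G ⟩
      8 * Q * G ≤⟨ 8QG≤ ⟩
      ℓ * ℓ * (ℓ * ℓ) ≤⟨ *-monoˡ-≤ (ℓ * ℓ) (*-mono-≤ ℓ≤n ℓ≤n) ⟩
      n * n * (ℓ * ℓ) ∎)
      where
      eq : ∀ n Q c → n * (Q * c) ≡ Q * (n * c)
      eq = solve-∀
      eq′ : ∀ Q G → Q * (8 * G) ≡ 8 * Q * G
      eq′ = solve-∀
      ℓ≤n : ℓ ≤ n
      ℓ≤n = ≤-trans (m≤m+n ℓ _) 4ℓ≤n
      dense-pair : ∀ u v → 3 * n ≤ 4 * D u → 3 * n ≤ 4 * D v → n * n ≤ 8 * opp u v
      dense-pair u v p q = linear 0
        (+-mono-≤ (+-mono-≤ (*-monoʳ-≤ 2 (*-mono-≤ n≤2m n≤2m)) (*-monoʳ-≤ 8 (≤-trans (codeg²≤opp+K u v) (+-monoʳ-≤ (opp u v) K≤2ℓ²)))) (*-mono-≤ 4ℓ≤n 4ℓ≤n))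
        (eq₁ n (opp u v) ℓ (codeg u v))
        where
        n≤2m : n ≤ 2 * codeg u v
        n≤2m = *-cancelˡ-≤ 2 (linear 0 (+-mono-≤ (+-mono-≤ p q) (*-monoʳ-≤ 4 (D+D≤n+codeg u v))) (eq₂ n (codeg u v) (D u) (D v)))
          where eq₂ : ∀ n m a b → 2 * n + (4 * a + 4 * b + 4 * (n + m)) + 0 ≡ 2 * (2 * m) + (3 * n + 3 * n + 4 * (a + b))
                eq₂ = solve-∀
        eq₁ : ∀ n o ℓ m → n * n + (2 * (2 * m * (2 * m)) + 8 * (o + 2 * (ℓ * ℓ)) + n * n) + 0 ≡ 8 * o + (2 * (n * n) + 8 * (m * m) + 4 * ℓ * (4 * ℓ))
        eq₁ = solve-∀
      step : ∀ u v → n * n * (ν u v * (⟦ core u ⟧ * ⟦ core v ⟧)) ≤ 8 * (ν u v * opp u v)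
      step u v with core u in p | core v in q
      ... | true  | true  = ≤-trans (≤-reflexive (eq₁ (n * n) (ν u v))) (≤-trans (*-monoʳ-≤ (ν u v)
              (dense-pair u v (≤ᵇ-true (3 * n) (4 * D u) p) (≤ᵇ-true (3 * n) (4 * D v) q))) (≤-reflexive (eq₂ (ν u v) (opp u v))))
        where eq₁ : ∀ n v → n * (v * (1 * 1)) ≡ v * n
              eq₁ = solve-∀
              eq₂ : ∀ v o → v * (8 * o) ≡ 8 * (v * o)
              eq₂ = solve-∀
      ... | true  | false = ≤-trans (≤-reflexive (zero-factor (n * n) (ν u v))) z≤n
        where zero-factor : ∀ n v → n * (v * (1 * 0)) ≡ 0
              zero-factor = solve-∀
      ... | false | _     = ≤-trans (≤-reflexive (zero-factor (n * n) (ν u v))) z≤n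
        where zero-factor : ∀ n v → n * (v * 0) ≡ 0
              zero-factor = solve-∀

-- Boolean reflection.

<ᵇ-true : ∀ m n → (m <ᵇ n) ≡ true → m < n
<ᵇ-true m n h = <ᵇ⇒< m n (subst T (sym h) _)

<ᵇ-false : ∀ m n → (m <ᵇ n) ≡ false → n ≤ m
<ᵇ-false m n h = ≮⇒≥ λ p → subst T h (<⇒<ᵇ p)

<⇒<ᵇ≡ : ∀ {m n} → m < n → (m <ᵇ n) ≡ true
<⇒<ᵇ≡ {m} {n} p with m <ᵇ n in eq
... | true  = refl
... | false = ⊥-elim (<⇒≱ p (<ᵇ-false m n eq))

∧-true : ∀ {b c} → b ∧ c ≡ true → (b ≡ true) × (c ≡ true)
∧-true {true} h = refl , h

∧-intro : ∀ {b c} → b ≡ true → c ≡ true → b ∧ c ≡ true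
∧-intro refl q = q

∨-false : ∀ {b c} → b ∨ c ≡ false → (b ≡ false) × (c ≡ false)
∨-false {false} h = refl , h

∨-true : ∀ {b c} → b ∨ c ≡ true → (b ≡ true) ⊎ (c ≡ true)
∨-true {true}  h = inj₁ refl
∨-true {false} h = inj₂ h

∨-introˡ : ∀ {b} c → b ≡ true → b ∨ c ≡ true
∨-introˡ c refl = refl

∨-introʳ : ∀ b {c} → c ≡ true → b ∨ c ≡ true
∨-introʳ true  q = refl
∨-introʳ false q = q

not-true : ∀ {b} → not b ≡ true → b ≡ false
not-true {false} _ = refl

≢⇒==false : ∀ {n} {x y : Fin n} → x ≢ y → (x == y) ≡ false
≢⇒==false {x = x} {y} p with x == y in eq
... | true  = ⊥-elim (p (==⇒≡ eq))
... | false = refl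

-- Edge sets

module _ {n : ℕ} (X : EdgeSet n) where

  adj-split : ∀ x y → ⟦ adj X x y ⟧ ≡ ⟦ (x <ᶠ y) ∧ X x y ⟧ + ⟦ (y <ᶠ x) ∧ X y x ⟧
  adj-split x y with x <ᶠ y in p | y <ᶠ x in q
  ... | true  | true  = ⊥-elim (<-asym (<ᵇ-true (toℕ x) (toℕ y) p) (<ᵇ-true (toℕ y) (toℕ x) q))
  ... | true  | false = sym (+-identityʳ _)
  ... | false | true  = refl
  ... | false | false = refl

  adj-sym : ∀ x y → adj X x y ≡ adj X y x
  adj-sym x y with x <ᶠ y in p | y <ᶠ x in q
  ... | true  | true  = ⊥-elim (<-asym (<ᵇ-true (toℕ x) (toℕ y) p) (<ᵇ-true (toℕ y) (toℕ x) q))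
  ... | true  | false = refl
  ... | false | true  = refl
  ... | false | false = refl

  adj-irrefl : ∀ x → adj X x x ≡ false
  adj-irrefl x with x <ᶠ x in p
  ... | true  = ⊥-elim (<-irrefl refl (<ᵇ-true (toℕ x) (toℕ x) p))
  ... | false = refl

  ∑∑adj : ∑∑ (λ x y → ⟦ adj X x y ⟧) ≡ 2 * e X
  ∑∑adj = begin
    ∑∑ (λ x y → ⟦ adj X x y ⟧)         ≡⟨ ∑∑-cong adj-split ⟩
    ∑∑ (λ x y → up x y + up y x)       ≡⟨ ∑∑-+ up (λ x y → up y x) ⟩
    ∑∑ up + ∑∑ (λ x y → up y x)        ≡⟨ cong (∑∑ up +_) (∑∑-swap up) ⟨
    ∑∑ up + ∑∑ up                      ≡⟨ cong₂ _+_ (S-pairs f) (S-pairs f) ⟨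
    e X + e X                          ≡⟨ cong (e X +_) (+-identityʳ (e X)) ⟨
    2 * e X                            ∎
    where
    open FinSums n
    open Relation.Binary.PropositionalEquality.≡-Reasoning
    f : Fin n × Fin n → ℕ
    f (x , y) = ⟦ (x <ᶠ y) ∧ X x y ⟧
    up : Fin n → Fin n → ℕ
    up x y = f (x , y)

restrict : ∀ {n} → EdgeSet n → VSet n → EdgeSet n
restrict X U x y = X x y ∧ U x ∧ U y

adj-restrict : ∀ {n} (X : EdgeSet n) U x y → adj (restrict X U) x y ≡ adj X x y ∧ U x ∧ U y
adj-restrict X U x y with x <ᶠ y | y <ᶠ x
... | true  | _     = refl
... | false | true  = cong (X y x ∧_) (∧-comm (U y) (U x))
... | false | false = refl

-- Quadruples and their symmetries

module _ {n : ℕ} where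

  rot ref : Quad n → Quad n
  rot (a , b , c , d) = b , c , d , a
  ref (a , b , c , d) = a , d , c , b

  chord : Quad n → Fin n → Fin n → Bool
  chord (a , b , c , d) x y = samePair x y a c ∨ samePair x y b d

  samePair-swap : (x y a b : Fin n) → samePair x y a b ≡ samePair y x a b
  samePair-swap x y a b = trans (∨-comm ((x == a) ∧ (y == b)) _)
    (cong₂ _∨_ (∧-comm (x == b) (y == a)) (∧-comm (x == a) (y == b)))

  samePair-swapʳ : (x y a b : Fin n) → samePair x y a b ≡ samePair x y b a
  samePair-swapʳ x y a b = ∨-comm ((x == a) ∧ (y == b)) _

  samePair-refl : (x y : Fin n) → samePair x y x y ≡ true
  samePair-refl x y rewrite ==-refl x | ==-refl y = refl

  samePair⇒ : (x y a b : Fin n) → samePair x y a b ≡ true → ((x ≡ a) × (y ≡ b)) ⊎ ((x ≡ b) × (y ≡ a))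
  samePair⇒ x y a b h with ∨-true h
  ... | inj₁ p = inj₁ (==⇒≡ (proj₁ (∧-true p)) , ==⇒≡ (proj₂ (∧-true p)))
  ... | inj₂ p = inj₂ (==⇒≡ (proj₁ (∧-true p)) , ==⇒≡ (proj₂ (∧-true p)))

  inCycle-sym : ∀ t (x y : Fin n) → inCycle t x y ≡ inCycle t y x
  inCycle-sym (a , b , c , d) x y rewrite samePair-swap x y a b | samePair-swap x y b c | samePair-swap x y c d | samePair-swap x y d a = refl

  chord-sym : ∀ t (x y : Fin n) → chord t x y ≡ chord t y x
  chord-sym (a , b , c , d) x y rewrite samePair-swap x y a c | samePair-swap x y b d = refl

  ∨-rotate : ∀ p q r s → q ∨ r ∨ s ∨ p ≡ p ∨ q ∨ r ∨ s
  ∨-rotate true  true  _ _ = refl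
  ∨-rotate true  false true  _ = refl
  ∨-rotate true  false false true  = refl
  ∨-rotate true  false false false = refl
  ∨-rotate false true  _ _ = refl
  ∨-rotate false false true  _ = refl
  ∨-rotate false false false true  = refl
  ∨-rotate false false false false = refl

  ∨-reverse : ∀ p q r s → s ∨ r ∨ q ∨ p ≡ p ∨ q ∨ r ∨ s
  ∨-reverse p q r true  = sym (trans (cong (λ v → p ∨ q ∨ v) (∨-comm r true)) (trans (cong (p ∨_) (∨-comm q true)) (∨-comm p true)))
  ∨-reverse true  q true  false = refl
  ∨-reverse true  true false false = refl
  ∨-reverse true  false false false = refl
  ∨-reverse false true true false = refl
  ∨-reverse false false true false = refl
  ∨-reverse false true false false = refl
  ∨-reverse false false false false = refl

  -- Degrees see a member of the family only through its edges and diagonals, so this is the sense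
  -- in which the eight representations of a 4-cycle are interchangeable.
  SameCycle : Quad n → Quad n → Set
  SameCycle t u = (∀ x y → inCycle t x y ≡ inCycle u x y) × (∀ x y → chord t x y ≡ chord u x y)

  same-refl : ∀ t → SameCycle t t
  same-refl t = (λ _ _ → refl) , (λ _ _ → refl)

  same-trans : ∀ {t u v} → SameCycle t u → SameCycle u v → SameCycle t v
  same-trans (p , q) (p′ , q′) = (λ x y → trans (p x y) (p′ x y)) , (λ x y → trans (q x y) (q′ x y))

  same-rot : ∀ t → SameCycle (rot t) t
  same-rot (a , b , c , d) = (λ x y → ∨-rotate (samePair x y a b) (samePair x y b c) (samePair x y c d) (samePair x y d a)) ,
    (λ x y → trans (cong (samePair x y b d ∨_) (samePair-swapʳ x y c a)) (∨-comm (samePair x y b d) _))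

  same-ref : ∀ t → SameCycle (ref t) t
  same-ref (a , b , c , d) =
    (λ x y → trans (cong₂ _∨_ (samePair-swapʳ x y a d) (cong₂ _∨_ (samePair-swapʳ x y d c) (cong₂ _∨_ (samePair-swapʳ x y c b) (samePair-swapʳ x y b a))))
                   (∨-reverse (samePair x y a b) (samePair x y b c) (samePair x y c d) (samePair x y d a))) ,
    (λ x y → cong (samePair x y a c ∨_) (samePair-swapʳ x y d b))

  samePair-elim : (R : Fin n → Fin n → Set) → (∀ {x y} → R x y → R y x) →
    ∀ x y u v → R u v → samePair x y u v ≡ true → R x y
  samePair-elim R R-sym x y u v w k with samePair⇒ x y u v k
  ... | inj₁ (refl , refl) = w
  ... | inj₂ (refl , refl) = R-sym w

  inCycle-elim : ∀ a b c d (R : Fin n → Fin n → Set) → (∀ {x y} → R x y → R y x) →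
    R a b → R b c → R c d → R d a → ∀ x y → inCycle (a , b , c , d) x y ≡ true → R x y
  inCycle-elim a b c d R R-sym p q r s x y h with ∨-true {samePair x y a b} h
  ... | inj₁ k = samePair-elim R R-sym x y a b p k
  ... | inj₂ h′ with ∨-true {samePair x y b c} h′
  ... | inj₁ k = samePair-elim R R-sym x y b c q k
  ... | inj₂ h″ with ∨-true {samePair x y c d} h″
  ... | inj₁ k = samePair-elim R R-sym x y c d r k
  ... | inj₂ k = samePair-elim R R-sym x y d a s k

  chord-elim : ∀ a b c d (R : Fin n → Fin n → Set) → (∀ {x y} → R x y → R y x) →
    R a c → R b d → ∀ x y → chord (a , b , c , d) x y ≡ true → R x y
  chord-elim a b c d R R-sym p q x y h with ∨-true {samePair x y a c} h
  ... | inj₁ k = samePair-elim R R-sym x y a c p k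
  ... | inj₂ k = samePair-elim R R-sym x y b d q k

  cycle-edges : ∀ a b c d → let C = inCycle (a , b , c , d) in
    (C a b ≡ true) × (C b c ≡ true) × (C c d ≡ true) × (C d a ≡ true)
  cycle-edges a b c d =
    ∨-introˡ _ (samePair-refl a b) ,
    ∨-introʳ (samePair b c a b) (∨-introˡ _ (samePair-refl b c)) ,
    ∨-introʳ (samePair c d a b) (∨-introʳ (samePair c d b c) (∨-introˡ _ (samePair-refl c d))) ,
    ∨-introʳ (samePair d a a b) (∨-introʳ (samePair d a b c) (∨-introʳ (samePair d a c d) (samePair-refl d a)))

  chord-diagonals : ∀ a b c d → (chord (a , b , c , d) a c ≡ true) × (chord (a , b , c , d) b d ≡ true)
  chord-diagonals a b c d = ∨-introˡ _ (samePair-refl a c) , ∨-introʳ (samePair b d a c) (samePair-refl b d)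

  Orbit : (Quad n → Set) → Quad n → Set
  Orbit R t = (R t × R (rot t) × R (rot (rot t)) × R (rot (rot (rot t)))) ×
    (R (ref t) × R (ref (rot t)) × R (ref (rot (rot t))) × R (ref (rot (rot (rot t)))))

  -- `R` may depend on the quadruple and not only on the cycle, as absence from a family does; it is
  -- therefore demanded of all eight representations.
  canonicalise : (R : Quad n → Set) → ∀ a b c d → a ≢ b → b ≢ c → c ≢ d → d ≢ a → a ≢ c → b ≢ d →
    Orbit R (a , b , c , d) → Σ (Quad n) λ t → (canonical t ≡ true) × SameCycle t (a , b , c , d) × R t
  canonicalise R a b c d a≢b b≢c c≢d d≢a a≢c b≢d ((r₀ , r₁ , r₂ , r₃) , (s₀ , s₁ , s₂ , s₃)) =
    by-order (compare a≢c) (compare b≢d)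
    where
    t₀ : Quad n
    t₀ = a , b , c , d
    _⊏_ : Fin n → Fin n → Set
    x ⊏ y = toℕ x < toℕ y
    compare : ∀ {x y : Fin n} → x ≢ y → (x ⊏ y) ⊎ (y ⊏ x)
    compare {x} {y} p with <-cmp (toℕ x) (toℕ y)
    ... | tri< q _ _ = inj₁ q
    ... | tri≈ _ q _ = ⊥-elim (p (toℕ-injective q))
    ... | tri> _ _ q = inj₂ q
    Goal = Σ (Quad n) λ t → (canonical t ≡ true) × SameCycle t t₀ × R t
    finish : ∀ w x y z → w ⊏ x → w ⊏ y → w ⊏ z → x ≢ y → y ≢ z → x ≢ z →
      SameCycle (w , x , y , z) t₀ → R (w , x , y , z) → R (w , z , y , x) → Goal
    finish w x y z p q r x≢y y≢z x≢z same u v with compare x≢z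
    ... | inj₁ k = (w , x , y , z) ,
      ∧-intro (<⇒<ᵇ≡ p) (∧-intro (<⇒<ᵇ≡ q) (∧-intro (<⇒<ᵇ≡ k) (∧-intro (cong not (≢⇒==false x≢y)) (cong not (≢⇒==false y≢z))))) , same , u
    ... | inj₂ k = (w , z , y , x) ,
      ∧-intro (<⇒<ᵇ≡ r) (∧-intro (<⇒<ᵇ≡ q) (∧-intro (<⇒<ᵇ≡ k) (∧-intro (cong not (≢⇒==false (y≢z ∘ sym))) (cong not (≢⇒==false (x≢y ∘ sym)))))) ,
      same-trans (same-ref (w , x , y , z)) same , v
    from-a : a ⊏ b → a ⊏ c → a ⊏ d → Goal
    from-a p q r = finish a b c d p q r b≢c c≢d b≢d (same-refl t₀) r₀ s₀
    same₁ = same-rot t₀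
    same₂ = same-trans (same-rot (rot t₀)) same₁
    same₃ = same-trans (same-rot (rot (rot t₀))) same₂
    from-b : b ⊏ c → b ⊏ d → b ⊏ a → Goal
    from-b p q r = finish b c d a p q r c≢d d≢a (a≢c ∘ sym) same₁ r₁ s₁
    from-c : c ⊏ d → c ⊏ a → c ⊏ b → Goal
    from-c p q r = finish c d a b p q r d≢a a≢b (b≢d ∘ sym) same₂ r₂ s₂
    from-d : d ⊏ a → d ⊏ b → d ⊏ c → Goal
    from-d p q r = finish d a b c p q r a≢b b≢c a≢c same₃ r₃ s₃
    -- Comparing opposite vertices first leaves two candidates for the least vertex, and these are
    -- adjacent on the cycle.
    by-order : (a ⊏ c) ⊎ (c ⊏ a) → (b ⊏ d) ⊎ (d ⊏ b) → Goal
    by-order (inj₁ ac) (inj₁ bd) with compare a≢b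
    ... | inj₁ ab = from-a ab ac (<-trans ab bd)
    ... | inj₂ ba = from-b (<-trans ba ac) bd ba
    by-order (inj₁ ac) (inj₂ db) with compare d≢a
    ... | inj₁ da = from-d da db (<-trans da ac)
    ... | inj₂ ad = from-a (<-trans ad db) ac ad
    by-order (inj₂ ca) (inj₁ bd) with compare b≢c
    ... | inj₁ bc = from-b bc bd (<-trans bc ca)
    ... | inj₂ cb = from-c (<-trans cb bd) ca cb
    by-order (inj₂ ca) (inj₂ db) with compare c≢d
    ... | inj₁ cd = from-c cd ca (<-trans cd db)
    ... | inj₂ dc = from-d (<-trans dc ca) db dc

  quads-rot : (f : Quad n → ℕ) → S (quads n) (f ∘ rot) ≡ S (quads n) f
  quads-rot f = trans (S-quads (f ∘ rot)) (trans (S-swap V V _) (trans (S-cong V λ b →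
    trans (S-swap V V _) (S-cong V λ c → S-swap V V _)) (sym (S-quads f))))
    where V = allFin n

  quads-ref : (f : Quad n → ℕ) → S (quads n) (f ∘ ref) ≡ S (quads n) f
  quads-ref f = trans (S-quads (f ∘ ref)) (trans (S-cong V λ a → reverse (λ d c b → f (a , d , c , b))) (sym (S-quads f)))
    where
    V = allFin n
    open FinSums n
    reverse : (g : Fin n → Fin n → Fin n → ℕ) →
      (∑ λ b → ∑∑ λ c d → g d c b) ≡ (∑ λ d → ∑∑ λ c b → g d c b)
    reverse g = trans (∑-∑∑-swap (λ b c d → g d c b)) (∑∑-swap (λ c d → ∑ λ b → g d c b))

-- Degrees in a family of 4-cycles and their totals.

∑-term : ∀ {n} (f : Fin n → ℕ) a → f a ≤ ∑ f
∑-term {suc n} f F.zero    = subst (f F.zero ≤_) (sym (∑-suc f)) (m≤m+n _ _)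
∑-term {suc n} f (F.suc a) = subst (f (F.suc a) ≤_) (sym (∑-suc f))
  (≤-trans (∑-term (f ∘ F.suc) a) (m≤n+m _ (f F.zero)))

module _ {n : ℕ} where

  open FinSums n

  deg : Hyp n → (Quad n → Bool) → ℕ
  deg H φ = count (quads n) (λ t → H t ∧ φ t)

  deg-cong : ∀ H {φ ψ : Quad n → Bool} → (∀ t → φ t ≡ ψ t) → deg H φ ≡ deg H ψ
  deg-cong H h = S-cong (quads n) λ t → cong (λ b → ⟦ H t ∧ b ⟧) (h t)

  deg-total : {I : Set} (is : List I) (H : Hyp n) (φ : I → Quad n → Bool) (c : ℕ) →
    (∀ t → S is (λ i → ⟦ φ i t ⟧) ≤ c) → S is (λ i → deg H (φ i)) ≤ c * eH H
  deg-total is H φ c h = begin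
    S is (λ i → S (quads n) λ t → ⟦ H t ∧ φ i t ⟧) ≡⟨ S-swap is (quads n) _ ⟩
    S (quads n) (λ t → S is λ i → ⟦ H t ∧ φ i t ⟧) ≤⟨ S-mono (quads n) (λ t → begin
        S is (λ i → ⟦ H t ∧ φ i t ⟧)   ≡⟨ S-cong is (λ i → ⟦⟧-∧ (H t) (φ i t)) ⟩
        S is (λ i → ⟦ H t ⟧ * ⟦ φ i t ⟧) ≡⟨ S-*ˡ is ⟦ H t ⟧ (λ i → ⟦ φ i t ⟧) ⟩
        ⟦ H t ⟧ * S is (λ i → ⟦ φ i t ⟧) ≤⟨ *-monoʳ-≤ ⟦ H t ⟧ (h t) ⟩
        ⟦ H t ⟧ * c                    ≡⟨ *-comm ⟦ H t ⟧ c ⟩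
        c * ⟦ H t ⟧                    ∎) ⟩
    S (quads n) (λ t → c * ⟦ H t ⟧) ≡⟨ S-*ˡ (quads n) c (λ t → ⟦ H t ⟧) ⟩
    c * eH H ∎
    where open ≤-Reasoning

  samePair-total : ∀ a b → ∑∑ {n} (λ x y → ⟦ samePair x y a b ⟧) ≤ 2
  samePair-total a b = begin
    ∑∑ (λ x y → ⟦ samePair x y a b ⟧) ≤⟨ ∑∑-mono (λ x y → ≤-trans (⟦⟧-∨ ((x == a) ∧ (y == b)) _)
                                          (≤-reflexive (cong₂ _+_ (⟦⟧-∧ (x == a) (y == b)) (⟦⟧-∧ (x == b) (y == a))))) ⟩
    ∑∑ (λ x y → ⟦ x == a ⟧ * ⟦ y == b ⟧ + ⟦ x == b ⟧ * ⟦ y == a ⟧) ≡⟨ ∑∑-+ (λ x y → ⟦ x == a ⟧ * ⟦ y == b ⟧) (λ x y → ⟦ x == b ⟧ * ⟦ y == a ⟧) ⟩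
    ∑∑ (λ x y → ⟦ x == a ⟧ * ⟦ y == b ⟧) + ∑∑ (λ x y → ⟦ x == b ⟧ * ⟦ y == a ⟧) ≡⟨ cong₂ _+_ (point a b) (point b a) ⟩
    2 ∎
    where
    open ≤-Reasoning
    point : ∀ a b → ∑∑ (λ x y → ⟦ x == a ⟧ * ⟦ y == b ⟧) ≡ 1
    point a b = trans (sym (∑-product (λ x → ⟦ x == a ⟧) (λ y → ⟦ y == b ⟧))) (cong₂ _*_ (∑-δ a) (∑-δ b))

  inCycle-total : ∀ t → ∑∑ {n} (λ x y → ⟦ inCycle t x y ⟧) ≤ 8
  inCycle-total (a , b , c , d) = begin
    ∑∑ (λ x y → ⟦ inCycle (a , b , c , d) x y ⟧)
      ≤⟨ ∑∑-mono (λ x y → ≤-trans (⟦⟧-∨ (samePair x y a b) _) (+-monoʳ-≤ ⟦ samePair x y a b ⟧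
           (≤-trans (⟦⟧-∨ (samePair x y b c) _) (+-monoʳ-≤ ⟦ samePair x y b c ⟧ (⟦⟧-∨ (samePair x y c d) (samePair x y d a)))))) ⟩
    ∑∑ (λ x y → p a b x y + (p b c x y + (p c d x y + p d a x y)))
      ≡⟨ trans (∑∑-+ (p a b) _) (cong (∑∑ (p a b) +_) (trans (∑∑-+ (p b c) _) (cong (∑∑ (p b c) +_) (∑∑-+ (p c d) (p d a))))) ⟩
    ∑∑ (p a b) + (∑∑ (p b c) + (∑∑ (p c d) + ∑∑ (p d a)))
      ≤⟨ +-mono-≤ (samePair-total a b) (+-mono-≤ (samePair-total b c) (+-mono-≤ (samePair-total c d) (samePair-total d a))) ⟩
    8 ∎
    where
    open ≤-Reasoning
    p : Fin n → Fin n → Fin n → Fin n → ℕ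
    p u v x y = ⟦ samePair x y u v ⟧

  inA-total : ∀ (X : EdgeSet n) t → ∑∑ (λ x y → ⟦ inA X t x y ⟧) ≤ 4
  inA-total X (a , b , c , d) = begin
    ∑∑ (λ x y → ⟦ inA X (a , b , c , d) x y ⟧) ≤⟨ ∑∑-mono (λ x y → bound (inCycle (a , b , c , d) x y) (samePair x y a c) (samePair x y b d) (adj X x y)) ⟩
    ∑∑ (λ x y → ⟦ samePair x y a c ⟧ + ⟦ samePair x y b d ⟧) ≡⟨ ∑∑-+ (λ x y → ⟦ samePair x y a c ⟧) (λ x y → ⟦ samePair x y b d ⟧) ⟩
    ∑∑ (λ x y → ⟦ samePair x y a c ⟧) + ∑∑ (λ x y → ⟦ samePair x y b d ⟧) ≤⟨ +-mono-≤ (samePair-total a c) (samePair-total b d) ⟩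
    4 ∎
    where
    open ≤-Reasoning
    bound : ∀ i p q m → ⟦ (i ∨ p ∨ q) ∧ not i ∧ m ⟧ ≤ ⟦ p ⟧ + ⟦ q ⟧
    bound true  p q m = z≤n
    bound false true  q m = ≤-trans (⟦⟧≤1 m) (m≤m+n 1 ⟦ q ⟧)
    bound false false true m = ⟦⟧≤1 m
    bound false false false m = z≤n

  module _ (P : Pregraph n) (H : Hyp n) where

    deg01-total : ∑∑ (deg01 H) ≤ 8 * eH H
    deg01-total = subst (_≤ 8 * eH H) (S-pairs (λ p → deg01 H (proj₁ p) (proj₂ p)))
      (deg-total (pairs n) H (λ p t → inCycle t (proj₁ p) (proj₂ p)) 8
        (λ t → subst (_≤ 8) (sym (S-pairs (λ p → ⟦ inCycle t (proj₁ p) (proj₂ p) ⟧))) (inCycle-total t)))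

    deg10-total : ∑∑ (deg10 P H) ≤ 4 * eH H
    deg10-total = subst (_≤ 4 * eH H) (S-pairs (λ p → deg10 P H (proj₁ p) (proj₂ p)))
      (deg-total (pairs n) H (λ p t → inA (M P) t (proj₁ p) (proj₂ p)) 4
        (λ t → subst (_≤ 4) (sym (S-pairs (λ p → ⟦ inA (M P) t (proj₁ p) (proj₂ p) ⟧))) (inA-total (M P) t)))

    deg02Q : Quad n → ℕ
    deg02Q (x , y , u , v) = deg02 H x y u v

    deg02-total : S (quads n) deg02Q ≤ 64 * eH H
    deg02-total = deg-total (quads n) H φ 64 λ t → begin
        S (quads n) (λ q → ⟦ φ q t ⟧) ≡⟨ S-quads (λ q → ⟦ φ q t ⟧) ⟩
        ∑∑ (λ x y → ∑∑ λ u v → ⟦ inCycle t x y ∧ inCycle t u v ⟧) ≡⟨ ∑∑-cong (λ x y → trans (∑∑-cong λ u v → ⟦⟧-∧ (inCycle t x y) (inCycle t u v)) (∑∑-*ˡ ⟦ inCycle t x y ⟧ (λ u v → ⟦ inCycle t u v ⟧))) ⟩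
        ∑∑ (λ x y → ⟦ inCycle t x y ⟧ * C t) ≡⟨ ∑∑-*ʳ (λ x y → ⟦ inCycle t x y ⟧) (C t) ⟩
        C t * C t ≤⟨ *-mono-≤ (inCycle-total t) (inCycle-total t) ⟩
        64 ∎
      where
      open ≤-Reasoning
      φ : Quad n → Quad n → Bool
      φ (x , y , u , v) t = inCycle t x y ∧ inCycle t u v
      C : Quad n → ℕ
      C t = ∑∑ λ x y → ⟦ inCycle t x y ⟧

    deg01-sym : ∀ x y → deg01 H x y ≡ deg01 H y x
    deg01-sym x y = deg-cong H λ t → inCycle-sym t x y

    inA-sym : ∀ t x y → inA (M P) t x y ≡ inA (M P) t y x
    inA-sym t x y = cong₂ _∧_ (cong₂ _∨_ (inCycle-sym t x y) (chord-sym t x y))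
      (cong₂ _∧_ (cong not (inCycle-sym t x y)) (adj-sym (M P) x y))

    deg10-sym : ∀ x y → deg10 P H x y ≡ deg10 P H y x
    deg10-sym x y = deg-cong H λ t → inA-sym t x y

    deg02-comm : ∀ x y u v → deg02 H x y u v ≡ deg02 H u v x y
    deg02-comm x y u v = deg-cong H λ t → ∧-comm (inCycle t x y) (inCycle t u v)

    deg02-swapˡ : ∀ x y u v → deg02 H x y u v ≡ deg02 H y x u v
    deg02-swapˡ x y u v = deg-cong H λ t → cong (_∧ inCycle t u v) (inCycle-sym t x y)

    deg02-swapʳ : ∀ x y u v → deg02 H x y u v ≡ deg02 H x y v u
    deg02-swapʳ x y u v = deg-cong H λ t → cong (inCycle t x y ∧_) (inCycle-sym t u v)

∧-≤ᵇ-false : ∀ L m z → (L <ᵇ m) ∧ (m ≤ᵇ z) ≡ false → (m ≤ L) ⊎ ((L ≤ m) × (z ≤ m))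
∧-≤ᵇ-false L m z h with L <ᵇ m in q
... | false = inj₁ (<ᵇ-false L m q)
... | true  = inj₂ (<⇒≤ (<ᵇ-true L m q) , <⇒≤ (≤ᵇ-false m z h))

-- Saturated elements with respect to a partial choice H

module Saturation {n : ℕ} (P : Pregraph n) (ℓ : ℕ) (M₀ E₀ : EdgeSet n) (H : Hyp n) where

  open FinSums n
  private
    V = allFin n
    h = eH H

  satEdge satChord dead bad A : Fin n → Fin n → Bool
  satPath : Fin n → Fin n → Fin n → Bool
  α ν κ Z m : Fin n → Fin n → ℕ

  -- The cap `ℓ³ / n` need not be an integer, so saturation means that one further cycle would
  -- exceed it.
  satEdge x y = ℓ ^ 3 <ᵇ n * suc (deg01 H x y)
  A x y = adj M₀ x y ∧ not (satEdge x y)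
  α x y = ⟦ A x y ⟧
  satPath x z y = ℓ ≤ᵇ deg02 H x z z y
  Z x y = ∑ λ z → ⟦ satPath x z y ⟧
  m x y = ∑ λ z → α x z * α z y
  -- Dead pairs are treated like edges of E. There are few of them, as each one accounts for
  -- at least ℓ / 8 saturated paths; for the other pairs saturated paths kill few 4-cycles.
  dead x y = (2 * ℓ <ᵇ m x y) ∧ (m x y ≤ᵇ 16 * Z x y)
  satChord x y = ℓ ^ 2 ≤ᵇ deg10 P H x y
  bad x y = (x == y) ∨ adj E₀ x y ∨ satChord x y ∨ dead x y
  κ x y = ⟦ bad x y ⟧
  ν x y = ⟦ not (bad x y) ⟧

  A-sym : ∀ x y → A x y ≡ A y x
  A-sym x y = cong₂ _∧_ (adj-sym M₀ x y) (cong (λ d → not (ℓ ^ 3 <ᵇ n * suc d)) (deg01-sym P H x y))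

  satPath-sym : ∀ x z y → satPath x z y ≡ satPath y z x
  satPath-sym x z y = cong (ℓ ≤ᵇ_) (trans (deg02-comm P H x z z y) (trans (deg02-swapˡ P H z y x z) (deg02-swapʳ P H y z x z)))

  α-sym : ∀ x y → α x y ≡ α y x
  α-sym x y = cong ⟦_⟧ (A-sym x y)

  dead-sym : ∀ x y → dead x y ≡ dead y x
  dead-sym x y = cong₂ (λ a b → (2 * ℓ <ᵇ a) ∧ (a ≤ᵇ 16 * b)) m-sym Z-sym
    where
    m-sym : m x y ≡ m y x
    m-sym = S-cong V λ z → trans (*-comm (α x z) (α z y)) (cong₂ _*_ (α-sym z y) (α-sym x z))
    Z-sym : Z x y ≡ Z y x
    Z-sym = S-cong V λ z → cong ⟦_⟧ (satPath-sym x z y)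

  bad-sym : ∀ x y → bad x y ≡ bad y x
  bad-sym x y = cong₂ _∨_ (==-sym x y) (cong₂ _∨_ (adj-sym E₀ x y)
    (cong₂ _∨_ (cong (ℓ ^ 2 ≤ᵇ_) (deg10-sym P H x y)) (dead-sym x y)))

  open Counting α ν κ (λ x y → ⟦⟧≤1 (A x y)) α-sym (λ x y → cong ⟦_⟧ (bad-sym x y)) (λ x y → ⟦⟧-not (bad x y)) public
    using (K; G; D; opp; τ; G-opp; codeg²≤opp+K; dense; module Structure)

  module _ (2n≤ℓ³ : 2 * n ≤ ℓ ^ 3) where

    -- Because of `2n ≤ ℓ³` the `suc` in `satEdge` costs only a factor 2: saturated edges have
    -- degree at least `ℓ³ / 2n`.
    satEdge-total : ℓ ^ 3 * ∑∑ (λ x y → ⟦ satEdge x y ⟧) ≤ 16 * n * h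
    satEdge-total = begin
      ℓ ^ 3 * ∑∑ (λ x y → ⟦ satEdge x y ⟧) ≡⟨ ∑∑-*ˡ (ℓ ^ 3) (λ x y → ⟦ satEdge x y ⟧) ⟨
      ∑∑ (λ x y → ℓ ^ 3 * ⟦ satEdge x y ⟧) ≤⟨ ∑∑-mono step ⟩
      ∑∑ (λ x y → 2 * n * deg01 H x y) ≡⟨ ∑∑-*ˡ (2 * n) (deg01 H) ⟩
      2 * n * ∑∑ (deg01 H) ≤⟨ *-monoʳ-≤ (2 * n) (deg01-total P H) ⟩
      2 * n * (8 * h) ≡⟨ eq n h ⟩
      16 * n * h ∎
      where
      open ≤-Reasoning
      eq : ∀ n h → 2 * n * (8 * h) ≡ 16 * n * h
      eq = solve-∀
      step : ∀ x y → ℓ ^ 3 * ⟦ satEdge x y ⟧ ≤ 2 * n * deg01 H x y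
      step x y with satEdge x y in p
      ... | false = ≤-trans (≤-reflexive (*-zeroʳ (ℓ ^ 3))) z≤n
      ... | true  = linear 0 (+-mono-≤ (*-monoʳ-≤ 2 (<⇒≤ (<ᵇ-true (ℓ ^ 3) (n * suc (deg01 H x y)) p))) 2n≤ℓ³) (eq′ (ℓ ^ 3) n (deg01 H x y))
        where eq′ : ∀ l n d → l * 1 + (2 * (n * (1 + d)) + l) + 0 ≡ 2 * n * d + (2 * l + 2 * n)
              eq′ = solve-∀

    edges-left : 2 * e M₀ ≤ ∑ D + ∑∑ (λ x y → ⟦ satEdge x y ⟧)
    edges-left = begin
      2 * e M₀ ≡⟨ ∑∑adj M₀ ⟨
      ∑∑ (λ x y → ⟦ adj M₀ x y ⟧) ≤⟨ ∑∑-mono (λ x y → bit (adj M₀ x y) (satEdge x y)) ⟩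
      ∑∑ (λ x y → α x y + ⟦ satEdge x y ⟧) ≡⟨ ∑∑-+ α (λ x y → ⟦ satEdge x y ⟧) ⟩
      ∑ D + ∑∑ (λ x y → ⟦ satEdge x y ⟧) ∎
      where
      open ≤-Reasoning
      bit : ∀ a s → ⟦ a ⟧ ≤ ⟦ a ∧ not s ⟧ + ⟦ s ⟧
      bit false s = z≤n
      bit true true = ≤-refl
      bit true false = ≤-refl

  ∑D≤ : ∑ D ≤ 2 * e M₀
  ∑D≤ = ≤-trans (∑∑-mono λ x y → bit (adj M₀ x y) (satEdge x y)) (≤-reflexive (∑∑adj M₀))
    where
    bit : ∀ a s → ⟦ a ∧ not s ⟧ ≤ ⟦ a ⟧
    bit false s = z≤n
    bit true s = ⟦⟧≤1 (not s)

  satChord-total : ℓ ^ 2 * ∑∑ (λ x y → ⟦ satChord x y ⟧) ≤ 4 * h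
  satChord-total = ≤-trans (≤-reflexive (sym (∑∑-*ˡ (ℓ ^ 2) (λ x y → ⟦ satChord x y ⟧)))) (≤-trans (∑∑-mono step) (deg10-total P H))
    where
    step : ∀ x y → ℓ ^ 2 * ⟦ satChord x y ⟧ ≤ deg10 P H x y
    step x y with satChord x y in p
    ... | false = ≤-trans (≤-reflexive (*-zeroʳ (ℓ ^ 2))) z≤n
    ... | true  = ≤-trans (≤-reflexive (*-identityʳ (ℓ ^ 2))) (≤ᵇ-true (ℓ ^ 2) (deg10 P H x y) p)

  threshold : ∀ d → ℓ * ⟦ ℓ ≤ᵇ d ⟧ ≤ d
  threshold d with ℓ ≤ᵇ d in p
  ... | false = ≤-trans (≤-reflexive (*-zeroʳ ℓ)) z≤n
  ... | true  = ≤-trans (≤-reflexive (*-identityʳ ℓ)) (≤ᵇ-true ℓ d p)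

  satPath-total : ℓ * ∑∑ Z ≤ 64 * h
  satPath-total = begin
    ℓ * ∑∑ Z ≡⟨ ∑∑-*ˡ ℓ Z ⟨
    ∑∑ (λ x y → ℓ * Z x y) ≡⟨ ∑∑-cong (λ x y → S-*ˡ V ℓ (λ z → ⟦ satPath x z y ⟧)) ⟨
    ∑∑ (λ x y → ∑ λ z → ℓ * ⟦ satPath x z y ⟧) ≤⟨ ∑∑-mono (λ x y → S-mono V λ z → ≤-trans (threshold (deg02 H x z z y)) (∑-term (λ u → deg02 H x z u y) z)) ⟩
    ∑∑ (λ x y → ∑ λ z → ∑ λ u → deg02 H x z u y) ≡⟨ (S-cong V λ x → ∑-∑∑-swap (λ y z u → deg02 H x z u y)) ⟩
    ∑ (λ x → ∑∑ λ z u → ∑ λ y → deg02 H x z u y) ≡⟨ S-quads (deg02Q P H) ⟨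
    S (quads n) (deg02Q P H) ≤⟨ deg02-total P H ⟩
    64 * h ∎
    where open ≤-Reasoning

  dead-total : ℓ * ℓ * ∑∑ (λ x y → ⟦ dead x y ⟧) ≤ 512 * h
  dead-total = *-cancelˡ-≤ 2 (begin
    2 * (ℓ * ℓ * Y) ≡⟨ eq ℓ Y ⟩
    ℓ * (2 * ℓ * Y) ≡⟨ cong (ℓ *_) (∑∑-*ˡ (2 * ℓ) (λ x y → ⟦ dead x y ⟧)) ⟨
    ℓ * ∑∑ (λ x y → 2 * ℓ * ⟦ dead x y ⟧) ≤⟨ *-monoʳ-≤ ℓ (∑∑-mono step) ⟩
    ℓ * ∑∑ (λ x y → 16 * Z x y) ≡⟨ cong (ℓ *_) (∑∑-*ˡ 16 Z) ⟩
    ℓ * (16 * ∑∑ Z) ≡⟨ eq′ ℓ (∑∑ Z) ⟩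
    16 * (ℓ * ∑∑ Z) ≤⟨ *-monoʳ-≤ 16 satPath-total ⟩
    16 * (64 * h) ≡⟨ eq″ h ⟩
    2 * (512 * h) ∎)
    where
    open ≤-Reasoning
    Y = ∑∑ (λ x y → ⟦ dead x y ⟧)
    eq : ∀ ℓ Y → 2 * (ℓ * ℓ * Y) ≡ ℓ * (2 * ℓ * Y)
    eq = solve-∀
    eq′ : ∀ ℓ Z → ℓ * (16 * Z) ≡ 16 * (ℓ * Z)
    eq′ = solve-∀
    eq″ : ∀ h → 16 * (64 * h) ≡ 2 * (512 * h)
    eq″ = solve-∀
    step : ∀ x y → 2 * ℓ * ⟦ dead x y ⟧ ≤ 16 * Z x y
    step x y with dead x y in p
    ... | false = ≤-trans (≤-reflexive (*-zeroʳ (2 * ℓ))) z≤n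
    ... | true  = ≤-trans (≤-reflexive (*-identityʳ (2 * ℓ))) (≤-trans (<⇒≤ (<ᵇ-true (2 * ℓ) (m x y) (proj₁ q))) (≤ᵇ-true (m x y) (16 * Z x y) (proj₂ q)))
      where q = ∧-true {2 * ℓ <ᵇ m x y} p

  -- What B adds to `E₀`. Its diagonal part has total `n`, independently of the family.
  excess : Fin n → Fin n → ℕ
  excess x y = ⟦ x == y ⟧ + (⟦ satChord x y ⟧ + ⟦ dead x y ⟧)

  κ≤ : ∀ x y → κ x y ≤ ⟦ adj E₀ x y ⟧ + excess x y
  κ≤ x y = ≤-trans (⟦⟧-∨ (x == y) _) (≤-trans (+-monoʳ-≤ ⟦ x == y ⟧ (≤-trans (⟦⟧-∨ (adj E₀ x y) _)
    (+-monoʳ-≤ ⟦ adj E₀ x y ⟧ (⟦⟧-∨ (satChord x y) (dead x y))))) (≤-reflexive (eq ⟦ x == y ⟧ ⟦ adj E₀ x y ⟧ _)))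
    where eq : ∀ a b c → a + (b + c) ≡ b + (a + c)
          eq = solve-∀

  excess-total : ℓ * ℓ * ∑∑ excess ≤ ℓ * ℓ * n + 516 * h
  excess-total = begin
    ℓ * ℓ * ∑∑ excess ≡⟨ cong (ℓ * ℓ *_) (trans (∑∑-+ (λ x y → ⟦ x == y ⟧) _) (cong₂ _+_ diagonal (∑∑-+ (λ x y → ⟦ satChord x y ⟧) (λ x y → ⟦ dead x y ⟧)))) ⟩
    ℓ * ℓ * (n + (Y + Y′)) ≡⟨ eq ℓ n Y Y′ ⟩
    ℓ * ℓ * n + (ℓ * (ℓ * 1) * Y + ℓ * ℓ * Y′) ≤⟨ +-monoʳ-≤ (ℓ * ℓ * n) (+-mono-≤ satChord-total dead-total) ⟩
    ℓ * ℓ * n + (4 * h + 512 * h) ≡⟨ cong (ℓ * ℓ * n +_) (sym (*-distribʳ-+ h 4 512)) ⟩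
    ℓ * ℓ * n + 516 * h ∎
    where
    open ≤-Reasoning
    Y = ∑∑ (λ x y → ⟦ satChord x y ⟧)
    Y′ = ∑∑ (λ x y → ⟦ dead x y ⟧)
    eq : ∀ ℓ n a b → ℓ * ℓ * (n + (a + b)) ≡ ℓ * ℓ * n + (ℓ * (ℓ * 1) * a + ℓ * ℓ * b)
    eq = solve-∀
    diagonal : ∑∑ {n} (λ x y → ⟦ x == y ⟧) ≡ n
    diagonal = trans (S-cong V λ x → trans (S-cong V λ y → cong ⟦_⟧ (==-sym x y)) (∑-δ x)) (trans (∑-const 1) (*-identityʳ n))

  K≤ : K ≤ 2 * e E₀ + ∑∑ excess
  K≤ = ≤-trans (∑∑-mono κ≤) (≤-reflexive (trans (∑∑-+ (λ x y → ⟦ adj E₀ x y ⟧) excess) (cong (_+ ∑∑ excess) (∑∑adj E₀))))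

  weight : Quad n → ℕ
  weight (a , b , c , d) = (α a b * α b c) * (α c d * α d a) * (ν a c * ν b d)

  weight-rot : ∀ t → weight (rot t) ≡ weight t
  weight-rot (a , b , c , d) = trans (cong (λ v → (α b c * α c d) * (α d a * α a b) * (ν b d * v)) (cong (λ v → ⟦ not v ⟧) (bad-sym c a)))
    (eq (α a b) (α b c) (α c d) (α d a) (ν a c) (ν b d))
    where eq : ∀ a b c d x y → (b * c) * (d * a) * (y * x) ≡ (a * b) * (c * d) * (x * y)
          eq = solve-∀

  -- A 4-cycle has six pairs of edges: four paths, met by `blockedPath` at t and `rot t`, and two
  -- opposite pairs, met by `blockedOpp` at t and `rot t`. A cycle is used if the family contains
  -- any of its eight representations.
  blockedPath blockedOpp used blocked : Quad n → Bool
  blockedPath (a , b , c , d) = satPath a b c ∨ satPath a d c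
  blockedOpp (a , b , c , d) = ℓ ≤ᵇ deg02 H a b c d
  used t = (H t ∨ H (rot t) ∨ H (rot (rot t)) ∨ H (rot (rot (rot t)))) ∨
    (H (ref t) ∨ H (ref (rot t)) ∨ H (ref (rot (rot t))) ∨ H (ref (rot (rot (rot t)))))
  blocked t = blockedPath t ∨ blockedPath (rot t) ∨ blockedOpp t ∨ blockedOpp (rot t) ∨ used t

  -- A blocked cycle consists of one saturated and one arbitrary path between a and c; the factor 2
  -- says which of the two is saturated.
  path-weight : S (quads n) (λ t → weight t * ⟦ blockedPath t ⟧) ≤ 2 * ∑∑ (λ a c → ν a c * (Z a c * m a c))
  path-weight = begin
    S (quads n) (λ t → weight t * ⟦ blockedPath t ⟧) ≡⟨ S-quads (λ t → weight t * ⟦ blockedPath t ⟧) ⟩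
    ∑∑ (λ a b → ∑∑ λ c d → weight (a , b , c , d) * ⟦ satPath a b c ∨ satPath a d c ⟧)
      ≡⟨ (S-cong V λ a → S-swap V V (λ b c → ∑ λ d → weight (a , b , c , d) * ⟦ satPath a b c ∨ satPath a d c ⟧)) ⟩
    ∑∑ (λ a c → ∑∑ λ b d → weight (a , b , c , d) * ⟦ satPath a b c ∨ satPath a d c ⟧) ≤⟨ ∑∑-mono inner ⟩
    ∑∑ (λ a c → 2 * (ν a c * (Z a c * m a c))) ≡⟨ ∑∑-*ˡ 2 (λ a c → ν a c * (Z a c * m a c)) ⟩
    2 * ∑∑ (λ a c → ν a c * (Z a c * m a c)) ∎
    where
    open ≤-Reasoning
    drop : ∀ {x} y → x ≤ 1 → x * y ≤ y
    drop y p = ≤-trans (*-monoˡ-≤ y p) (≤-reflexive (*-identityˡ y))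
    inner : ∀ a c → (∑∑ λ b d → weight (a , b , c , d) * ⟦ satPath a b c ∨ satPath a d c ⟧) ≤ 2 * (ν a c * (Z a c * m a c))
    inner a c = begin
      (∑∑ λ b d → weight (a , b , c , d) * ⟦ satPath a b c ∨ satPath a d c ⟧) ≤⟨ ∑∑-mono step ⟩
      (∑∑ λ b d → ν a c * (s b * τ a c d + τ a c b * s d)) ≡⟨ ∑∑-*ˡ (ν a c) (λ b d → s b * τ a c d + τ a c b * s d) ⟩
      ν a c * (∑∑ λ b d → s b * τ a c d + τ a c b * s d)
        ≡⟨ cong (ν a c *_) (trans (∑∑-+ (λ b d → s b * τ a c d) (λ b d → τ a c b * s d)) (cong₂ _+_ (sym (∑-product s (τ a c))) (sym (∑-product (τ a c) s)))) ⟩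
      ν a c * (Z a c * m a c + m a c * Z a c) ≡⟨ eq (ν a c) (Z a c) (m a c) ⟩
      2 * (ν a c * (Z a c * m a c)) ∎
      where
      s : Fin n → ℕ
      s b = ⟦ satPath a b c ⟧
      eq : ∀ v z m → v * (z * m + m * z) ≡ 2 * (v * (z * m))
      eq = solve-∀
      step : ∀ b d → weight (a , b , c , d) * ⟦ satPath a b c ∨ satPath a d c ⟧ ≤ ν a c * (s b * τ a c d + τ a c b * s d)
      step b d = begin
        weight (a , b , c , d) * ⟦ satPath a b c ∨ satPath a d c ⟧ ≤⟨ *-monoʳ-≤ (weight (a , b , c , d)) (⟦⟧-∨ (satPath a b c) (satPath a d c)) ⟩
        weight (a , b , c , d) * (s b + s d) ≡⟨ cong₂ (λ p q → (α a b * α b c) * (p * q) * (ν a c * ν b d) * (s b + s d)) (α-sym c d) (α-sym d a) ⟩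
        (α a b * α b c) * (α d c * α a d) * (ν a c * ν b d) * (s b + s d) ≡⟨ eq₁ (α a b * α b c) (α d c) (α a d) (ν a c) (ν b d) (s b) (s d) ⟩
        ν b d * (ν a c * (τ a c b * (s b * τ a c d) + τ a c d * (τ a c b * s d))) ≤⟨ drop _ (⟦⟧≤1 (not (bad b d))) ⟩
        ν a c * (τ a c b * (s b * τ a c d) + τ a c d * (τ a c b * s d))
          ≤⟨ *-monoʳ-≤ (ν a c) (+-mono-≤ (drop (s b * τ a c d) (*-mono-≤ (⟦⟧≤1 (A a b)) (⟦⟧≤1 (A b c)))) (drop (τ a c b * s d) (*-mono-≤ (⟦⟧≤1 (A a d)) (⟦⟧≤1 (A d c))))) ⟩
        ν a c * (s b * τ a c d + τ a c b * s d) ∎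
        where eq₁ : ∀ x p q v w s t → x * (p * q) * (v * w) * (s + t) ≡ w * (v * (x * (s * (q * p)) + (q * p) * (x * t)))
              eq₁ = solve-∀

  module _ (1≤ℓ : 1 ≤ ℓ) (K≤2ℓ² : K ≤ 2 * (ℓ * ℓ)) where

    open ≤-Reasoning

    -- As ac is not dead, it has at most `2ℓ` connecting paths, or `16 * Z` is at most `m`. In the
    -- latter case `m ≥ 2ℓ` gives `K ≤ m² / 2`, hence `m² ≤ 2 opp`, and the loss is a fraction of
    -- the cycles through a and c.
    pair-bound : ∀ a c → 16 * (ν a c * (Z a c * m a c)) ≤ 32 * ℓ * Z a c + 2 * (ν a c * opp a c)
    pair-bound a c = unless (bad a c) {Z a c * m a c} {32 * ℓ * Z a c} {opp a c} λ p →
      [ few-paths , many-paths ]′ (∧-≤ᵇ-false (2 * ℓ) (m a c) (16 * Z a c)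
        (proj₂ (∨-false {satChord a c} (proj₂ (∨-false {adj E₀ a c} (proj₂ (∨-false {a == c} p)))))))
      where
      unless : ∀ b {x y z} → (b ≡ false → 16 * x ≤ y + 2 * z) → 16 * (⟦ not b ⟧ * x) ≤ y + 2 * (⟦ not b ⟧ * z)
      unless true  h = z≤n
      unless false {x} {y} {z} h = ≤-trans (*-monoʳ-≤ 16 (≤-reflexive (*-identityˡ x)))
        (≤-trans (h refl) (≤-reflexive (cong (λ v → y + 2 * v) (sym (*-identityˡ z)))))
      few-paths : m a c ≤ 2 * ℓ → 16 * (Z a c * m a c) ≤ 32 * ℓ * Z a c + 2 * opp a c
      few-paths q = linear (2 * opp a c) (*-monoʳ-≤ (16 * Z a c) q) (eq (Z a c) (m a c) ℓ (opp a c))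
        where eq : ∀ z m ℓ o → 16 * (z * m) + 16 * z * (2 * ℓ) + 2 * o ≡ 32 * ℓ * z + 2 * o + 16 * z * m
              eq = solve-∀
      many-paths : (2 * ℓ ≤ m a c) × (16 * Z a c ≤ m a c) → 16 * (Z a c * m a c) ≤ 32 * ℓ * Z a c + 2 * opp a c
      many-paths (q , r) = ≤-trans (linear 0 (+-mono-≤ (*-monoˡ-≤ (m a c) r)
          (+-mono-≤ (*-monoʳ-≤ 2 (codeg²≤opp+K a c)) (+-mono-≤ (*-monoʳ-≤ 2 K≤2ℓ²) (*-mono-≤ q q)))) (eq (Z a c) (m a c) (opp a c) K ℓ))
        (m≤n+m (2 * opp a c) (32 * ℓ * Z a c))
        where eq : ∀ z m o K ℓ → 16 * (z * m) + (m * m + (2 * (o + K) + (2 * (2 * (ℓ * ℓ)) + m * m))) + 0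
                ≡ 2 * o + (16 * z * m + (2 * (m * m) + (2 * K + 2 * ℓ * (2 * ℓ))))
              eq = solve-∀

    path-total : 8 * S (quads n) (λ t → weight t * ⟦ blockedPath t ⟧) ≤ 2 * G + 2048 * h
    path-total = begin
      8 * S (quads n) (λ t → weight t * ⟦ blockedPath t ⟧) ≤⟨ *-monoʳ-≤ 8 path-weight ⟩
      8 * (2 * Y) ≡⟨ *-assoc 8 2 Y ⟨
      16 * Y ≡⟨ ∑∑-*ˡ 16 (λ a c → ν a c * (Z a c * m a c)) ⟨
      ∑∑ (λ a c → 16 * (ν a c * (Z a c * m a c))) ≤⟨ ∑∑-mono pair-bound ⟩
      ∑∑ (λ a c → 32 * ℓ * Z a c + 2 * (ν a c * opp a c)) ≡⟨ trans (∑∑-+ (λ a c → 32 * ℓ * Z a c) (λ a c → 2 * (ν a c * opp a c)))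
                                                             (cong₂ _+_ (∑∑-*ˡ (32 * ℓ) Z) (trans (∑∑-*ˡ 2 (λ a c → ν a c * opp a c)) (cong (2 *_) (sym G-opp)))) ⟩
      32 * ℓ * ∑∑ Z + 2 * G ≤⟨ linear 0 (*-monoʳ-≤ 32 satPath-total) (eq ℓ (∑∑ Z) G h) ⟩
      2 * G + 2048 * h ∎
      where
      Y = ∑∑ λ a c → ν a c * (Z a c * m a c)
      eq : ∀ ℓ z G h → 32 * ℓ * z + 2 * G + 32 * (64 * h) + 0 ≡ 2 * G + 2048 * h + 32 * (ℓ * z)
      eq = solve-∀

    -- The blocked pair of edges is the whole quadruple here, so the total of the degrees bounds the
    -- loss directly.
    opp-total : S (quads n) (λ t → ⟦ blockedOpp t ⟧) ≤ 64 * h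
    opp-total = begin
      S (quads n) (λ t → ⟦ blockedOpp t ⟧) ≡⟨ *-identityˡ _ ⟨
      1 * S (quads n) (λ t → ⟦ blockedOpp t ⟧) ≤⟨ *-monoˡ-≤ _ 1≤ℓ ⟩
      ℓ * S (quads n) (λ t → ⟦ blockedOpp t ⟧) ≡⟨ S-*ˡ (quads n) ℓ (λ t → ⟦ blockedOpp t ⟧) ⟨
      S (quads n) (λ t → ℓ * ⟦ blockedOpp t ⟧) ≤⟨ S-mono (quads n) (λ t → threshold (deg02Q P H t)) ⟩
      S (quads n) (deg02Q P H) ≤⟨ deg02-total P H ⟩
      64 * h ∎

    used-total : S (quads n) (λ t → ⟦ used t ⟧) ≤ 8 * h
    used-total = begin
      S (quads n) (λ t → ⟦ used t ⟧) ≤⟨ S-mono (quads n) (λ t → ≤-trans (⟦⟧-∨ (H t ∨ H (rot t) ∨ H (rot (rot t)) ∨ H (rot (rot (rot t)))) _)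
                                          (+-mono-≤ (four (H t) (H (rot t)) (H (rot (rot t))) (H (rot (rot (rot t)))))
                                                    (four (H (ref t)) (H (ref (rot t))) (H (ref (rot (rot t)))) (H (ref (rot (rot (rot t)))))))) ⟩
      S (quads n) (λ t → sum₄ f t + sum₄ (f ∘ ref) t) ≡⟨ S-+ (quads n) (sum₄ f) (sum₄ (f ∘ ref)) ⟩
      S (quads n) (sum₄ f) + S (quads n) (sum₄ (f ∘ ref)) ≡⟨ cong₂ _+_ (rotations f) (trans (rotations (f ∘ ref)) (cong (4 *_) (quads-ref f))) ⟩
      4 * h + 4 * h ≡⟨ *-distribʳ-+ h 4 4 ⟨
      8 * h ∎
      where
      f : Quad n → ℕ
      f t = ⟦ H t ⟧
      sum₄ : (Quad n → ℕ) → Quad n → ℕ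
      sum₄ g t = g t + (g (rot t) + (g (rot (rot t)) + g (rot (rot (rot t)))))
      four : ∀ a b c d → ⟦ a ∨ b ∨ c ∨ d ⟧ ≤ ⟦ a ⟧ + (⟦ b ⟧ + (⟦ c ⟧ + ⟦ d ⟧))
      four a b c d = ≤-trans (⟦⟧-∨ a _) (+-monoʳ-≤ ⟦ a ⟧ (≤-trans (⟦⟧-∨ b _) (+-monoʳ-≤ ⟦ b ⟧ (⟦⟧-∨ c d))))
      rotations : (g : Quad n → ℕ) → S (quads n) (sum₄ g) ≡ 4 * S (quads n) g
      rotations g = trans (S-+ L g _) (cong (S L g +_) (trans (trans (S-+ L (g ∘ rot) _) (cong₂ _+_ r₁ (trans (S-+ L (g ∘ rot ∘ rot) _) (cong₂ _+_ r₂ r₃)))) (eq (S L g))))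
        where
        L = quads n
        r₁ : S L (g ∘ rot) ≡ S L g
        r₁ = quads-rot g
        r₂ : S L (g ∘ rot ∘ rot) ≡ S L g
        r₂ = trans (quads-rot (g ∘ rot)) r₁
        r₃ : S L (g ∘ rot ∘ rot ∘ rot) ≡ S L g
        r₃ = trans (quads-rot (g ∘ rot ∘ rot)) r₂
        eq : ∀ x → x + (x + x) ≡ x + (x + (x + 0))
        eq = solve-∀

    -- Up to a multiple of `h`, only saturated paths matter, and they destroy at most half of the
    -- cycles. The constant is (2048 + 512 + 32) / 2, from paths, opposite pairs and used cycles.
    blocked-total : 2 * S (quads n) (λ t → weight t * ⟦ blocked t ⟧) ≤ G + 1296 * h
    blocked-total = *-cancelˡ-≤ 2 (begin
      2 * (2 * S L (λ t → weight t * ⟦ blocked t ⟧)) ≤⟨ *-monoʳ-≤ 2 (*-monoʳ-≤ 2 split) ⟩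
      2 * (2 * (2 * S L w + (2 * S L o + S L u))) ≤⟨ linear 0 (+-mono-≤ path-total (+-mono-≤ (*-monoʳ-≤ 8 opp-total) (*-monoʳ-≤ 4 used-total))) (eq (S L w) (S L o) (S L u) G h) ⟩
      2 * (G + 1296 * h) ∎)
      where
      L = quads n
      w o u : Quad n → ℕ
      w t = weight t * ⟦ blockedPath t ⟧
      o t = ⟦ blockedOpp t ⟧
      u t = ⟦ used t ⟧
      eq : ∀ w o u G h → 2 * (2 * (2 * w + (2 * o + u))) + (2 * G + 2048 * h + (8 * (64 * h) + 4 * (8 * h))) + 0
         ≡ 2 * (G + 1296 * h) + (8 * w + (8 * o + 4 * u))
      eq = solve-∀
      weight≤1 : ∀ t → weight t ≤ 1
      weight≤1 (a , b , c , d) = *-mono-≤ (*-mono-≤ (*-mono-≤ (⟦⟧≤1 (A a b)) (⟦⟧≤1 (A b c))) (*-mono-≤ (⟦⟧≤1 (A c d)) (⟦⟧≤1 (A d a))))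
        (*-mono-≤ (⟦⟧≤1 (not (bad a c))) (⟦⟧≤1 (not (bad b d))))
      pointwise : ∀ t → weight t * ⟦ blocked t ⟧ ≤ (w t + w (rot t)) + ((o t + o (rot t)) + u t)
      pointwise t = begin
        weight t * ⟦ blocked t ⟧ ≤⟨ *-monoʳ-≤ (weight t) (≤-trans (⟦⟧-∨ (blockedPath t) _) (+-monoʳ-≤ ⟦ blockedPath t ⟧
                                     (≤-trans (⟦⟧-∨ (blockedPath (rot t)) _) (+-monoʳ-≤ ⟦ blockedPath (rot t) ⟧
                                     (≤-trans (⟦⟧-∨ (blockedOpp t) _) (+-monoʳ-≤ (o t) (⟦⟧-∨ (blockedOpp (rot t)) (used t)))))))) ⟩
        weight t * (⟦ blockedPath t ⟧ + (⟦ blockedPath (rot t) ⟧ + (o t + (o (rot t) + u t)))) ≡⟨ eq₁ (weight t) ⟦ blockedPath t ⟧ ⟦ blockedPath (rot t) ⟧ (o t) (o (rot t)) (u t) ⟩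
        (w t + weight t * ⟦ blockedPath (rot t) ⟧) + weight t * ((o t + o (rot t)) + u t)
          ≤⟨ +-mono-≤ (≤-reflexive (cong (λ v → w t + v * ⟦ blockedPath (rot t) ⟧) (sym (weight-rot t)))) (≤-trans (*-monoˡ-≤ _ (weight≤1 t)) (≤-reflexive (*-identityˡ _))) ⟩
        (w t + w (rot t)) + ((o t + o (rot t)) + u t) ∎
        where eq₁ : ∀ W a b c d e → W * (a + (b + (c + (d + e)))) ≡ (W * a + W * b) + W * ((c + d) + e)
              eq₁ = solve-∀
      split : S L (λ t → weight t * ⟦ blocked t ⟧) ≤ 2 * S L w + (2 * S L o + S L u)
      split = begin
        S L (λ t → weight t * ⟦ blocked t ⟧) ≤⟨ S-mono L pointwise ⟩
        S L (λ t → (w t + w (rot t)) + ((o t + o (rot t)) + u t))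
          ≡⟨ trans (S-+ L (λ t → w t + w (rot t)) (λ t → (o t + o (rot t)) + u t)) (cong₂ _+_ (twice w) (trans (S-+ L (λ t → o t + o (rot t)) u) (cong (_+ S L u) (twice o)))) ⟩
        2 * S L w + (2 * S L o + S L u) ∎
        where
        twice : (f : Quad n → ℕ) → S L (λ t → f t + f (rot t)) ≡ 2 * S L f
        twice f = trans (S-+ L f (f ∘ rot)) (cong (S L f +_) (trans (quads-rot f) (sym (+-identityʳ (S L f)))))

    survivor : 1296 * h < G → Σ (Quad n) λ t → (1 ≤ weight t) × (blocked t ≡ false)
    survivor p = proj₁ found , positive (blocked (proj₁ found)) (proj₂ found)
      where
      fewer : S (quads n) (λ t → weight t * ⟦ blocked t ⟧) < S (quads n) weight
      fewer = *-cancelˡ-< 2 _ _ (≤-<-trans blocked-total (<-≤-trans (+-monoʳ-< G p)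
        (≤-reflexive (trans (cong (G +_) (sym (+-identityʳ G))) (cong (2 *_) (sym (S-quads weight)))))))
      found : Σ (Quad n) λ t → weight t * ⟦ blocked t ⟧ < weight t
      found = S-< (quads n) {λ t → weight t * ⟦ blocked t ⟧} {weight} fewer
      positive : ∀ b {w} → w * ⟦ b ⟧ < w → (1 ≤ w) × (b ≡ false)
      positive false q = ≤-trans (s≤s z≤n) q , refl
      positive true {w} q = ⊥-elim (<-irrefl (*-identityʳ w) q)

-- Adding one 4-cycle to a family.

true≢false : true ≢ false
true≢false ()

1≤⟦⟧ : ∀ {b} → 1 ≤ ⟦ b ⟧ → b ≡ true
1≤⟦⟧ {true} _ = refl

1≤-* : ∀ m n → 1 ≤ m * n → (1 ≤ m) × (1 ≤ n)
1≤-* (suc m) zero    h = ⊥-elim (<⇒≱ h (≤-reflexive (*-zeroʳ m)))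
1≤-* (suc m) (suc n) h = s≤s z≤n , s≤s z≤n

module _ {n : ℕ} where

  open FinSums n

  eqQuad : Quad n → Quad n → Bool
  eqQuad (a , b , c , d) (a′ , b′ , c′ , d′) = (a == a′) ∧ (b == b′) ∧ (c == c′) ∧ (d == d′)

  eqQuad⇒≡ : ∀ t u → eqQuad t u ≡ true → t ≡ u
  eqQuad⇒≡ (a , b , c , d) (a′ , b′ , c′ , d′) h with ∧-true {a == a′} h
  ... | p , h₁ with ∧-true {b == b′} h₁
  ... | q , h₂ with ∧-true {c == c′} h₂
  ... | r , s rewrite ==⇒≡ {x = a} {a′} p | ==⇒≡ {x = b} {b′} q | ==⇒≡ {x = c} {c′} r | ==⇒≡ {x = d} {d′} s = refl

  eqQuad-total : ∀ u → S (quads n) (λ t → ⟦ eqQuad t u ⟧) ≡ 1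
  eqQuad-total u@(a′ , b′ , c′ , d′) = begin
    S (quads n) (λ t → ⟦ eqQuad t u ⟧) ≡⟨ S-quads (λ t → ⟦ eqQuad t u ⟧) ⟩
    ∑∑ (λ a b → ∑∑ λ c d → ⟦ (a == a′) ∧ (b == b′) ∧ (c == c′) ∧ (d == d′) ⟧)
      ≡⟨ ∑∑-cong (λ a b → trans (∑∑-cong λ c d → trans (⟦⟧-∧ (a == a′) _) (cong (δ a a′ *_) (trans (⟦⟧-∧ (b == b′) _) (cong (δ b b′ *_) (⟦⟧-∧ (c == c′) (d == d′))))))
           (trans (∑∑-*ˡ (δ a a′) _) (cong (δ a a′ *_) (trans (∑∑-*ˡ (δ b b′) _) (cong (δ b b′ *_) (point c′ d′)))))) ⟩
    ∑∑ (λ a b → δ a a′ * (δ b b′ * 1)) ≡⟨ ∑∑-cong (λ a b → cong (δ a a′ *_) (*-identityʳ (δ b b′))) ⟩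
    ∑∑ (λ a b → δ a a′ * δ b b′) ≡⟨ point a′ b′ ⟩
    1 ∎
    where
    open Relation.Binary.PropositionalEquality.≡-Reasoning
    δ : Fin n → Fin n → ℕ
    δ x y = ⟦ x == y ⟧
    point : ∀ a b → ∑∑ (λ x y → δ x a * δ y b) ≡ 1
    point a b = trans (sym (∑-product (λ x → δ x a) (λ y → δ y b))) (cong₂ _*_ (∑-δ a) (∑-δ b))

  insert : Hyp n → Quad n → Hyp n
  insert H u t = H t ∨ eqQuad t u

  eH-insert : ∀ H u → H u ≡ false → eH (insert H u) ≡ suc (eH H)
  eH-insert H u h = trans (S-cong (quads n) pointwise) (trans (S-+ (quads n) (λ t → ⟦ H t ⟧) (λ t → ⟦ eqQuad t u ⟧))
    (trans (cong (eH H +_) (eqQuad-total u)) (+-comm (eH H) 1)))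
    where
    pointwise : ∀ t → ⟦ H t ∨ eqQuad t u ⟧ ≡ ⟦ H t ⟧ + ⟦ eqQuad t u ⟧
    pointwise t with H t in p | eqQuad t u in q
    ... | true  | true  = ⊥-elim (true≢false (trans (sym p) (trans (cong H (eqQuad⇒≡ t u q)) h)))
    ... | true  | false = refl
    ... | false | true  = refl
    ... | false | false = refl

  deg-insert : ∀ H u φ → deg (insert H u) φ ≤ deg H φ + ⟦ φ u ⟧
  deg-insert H u φ = ≤-trans (S-mono (quads n) pointwise) (≤-reflexive
    (trans (S-+ (quads n) (λ t → ⟦ H t ∧ φ t ⟧) (λ t → ⟦ eqQuad t u ⟧ * ⟦ φ u ⟧))
      (cong (deg H φ +_) (trans (S-*ʳ (quads n) (λ t → ⟦ eqQuad t u ⟧) ⟦ φ u ⟧) (trans (cong (_* ⟦ φ u ⟧) (eqQuad-total u)) (*-identityˡ ⟦ φ u ⟧))))))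
    where
    pointwise : ∀ t → ⟦ (H t ∨ eqQuad t u) ∧ φ t ⟧ ≤ ⟦ H t ∧ φ t ⟧ + ⟦ eqQuad t u ⟧ * ⟦ φ u ⟧
    pointwise t with H t | eqQuad t u in q
    ... | true  | _     = m≤m+n ⟦ φ t ⟧ _
    ... | false | false = z≤n
    ... | false | true  = ≤-reflexive (trans (cong (λ v → ⟦ φ v ⟧) (eqQuad⇒≡ t u q)) (sym (*-identityˡ ⟦ φ u ⟧)))

  deg-insert-cap : ∀ H u φ {c} → deg H φ ≤ c → (φ u ≡ true → suc (deg H φ) ≤ c) → deg (insert H u) φ ≤ c
  deg-insert-cap H u φ p q with φ u in r | deg-insert H u φ
  ... | true  | h = ≤-trans h (≤-trans (≤-reflexive (+-comm (deg H φ) 1)) (q refl))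
  ... | false | h = ≤-trans h (≤-trans (≤-reflexive (+-identityʳ (deg H φ))) p)

-- Families here mix cycles that induce 4, 5 and 6 elements of `M`. The three levels are separated
-- only at the end and inherit the caps.
record Admissible {n : ℕ} (P : Pregraph n) (ℓ : ℕ) (H : Hyp n) : Set where
  field
    good  : ∀ t → H t ≡ true → canonical t ∧ goodC4 P t ≡ true
    cap01 : ∀ x y → n * deg01 H x y ≤ ℓ ^ 3
    cap02 : ∀ x y u v → samePair x y u v ≡ false → deg02 H x y u v ≤ ℓ
    cap10 : ∀ x y → deg10 P H x y ≤ ℓ ^ 2

empty-admissible : ∀ {n} (P : Pregraph n) ℓ → Admissible P ℓ (λ _ → false)
empty-admissible {n} P ℓ = record
  { good  = λ t ()
  ; cap01 = λ x y → ≤-trans (≤-reflexive (trans (cong (n *_) nothing) (*-zeroʳ n))) z≤n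
  ; cap02 = λ x y u v _ → ≤-trans (≤-reflexive nothing) z≤n
  ; cap10 = λ x y → ≤-trans (≤-reflexive nothing) z≤n }
  where nothing : S (quads n) (λ _ → 0) ≡ 0
        nothing = trans (S-const (quads n) 0) (*-zeroʳ (length (quads n)))

adj-disjoint : ∀ {n} (P : Pregraph n) x y → adj (M P) x y ≡ true → adj (E P) x y ≡ false
adj-disjoint P x y h with x <ᶠ y in p | y <ᶠ x in q
... | true  | _     = disjoint P x y (<ᵇ-true (toℕ x) (toℕ y) p) h
... | false | true  = disjoint P y x (<ᵇ-true (toℕ y) (toℕ x) q) h
... | false | false = refl

-- Case (M3) looks for cycles in `Uᶜ` only, hence the subgraph `M₀`; `E₀` has to contain those edges
-- of `E` that join vertices touched by `M₀`, among them all possible diagonals.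
module Extension {n : ℕ} (P : Pregraph n) (ℓ : ℕ) (M₀ E₀ : EdgeSet n)
  (M₀⊆M : ∀ x y → adj M₀ x y ≡ true → adj (M P) x y ≡ true)
  (E₀-enough : ∀ x y u v → adj M₀ x u ≡ true → adj M₀ y v ≡ true → adj E₀ x y ≡ false → adj (E P) x y ≡ false)
  (H : Hyp n) (adm : Admissible P ℓ H) where

  open Saturation P ℓ M₀ E₀ H
  open Admissible adm

  Low : Fin n → Fin n → Fin n → Fin n → Set
  Low x y u v = deg02 H x y u v < ℓ

  low-comm : ∀ {x y u v} → Low x y u v → Low u v x y
  low-comm {x} {y} {u} {v} = subst (_< ℓ) (deg02-comm P H x y u v)

  low-swapˡ : ∀ {x y u v} → Low x y u v → Low y x u v
  low-swapˡ {x} {y} {u} {v} = subst (_< ℓ) (deg02-swapˡ P H x y u v)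

  low-swapʳ : ∀ {x y u v} → Low x y u v → Low x y v u
  low-swapʳ {x} {y} {u} {v} = subst (_< ℓ) (deg02-swapʳ P H x y u v)

  module _ (a b c d : Fin n) (ab-bc : Low a b b c) (ab-cd : Low a b c d) (ab-da : Low a b d a)
    (bc-cd : Low b c c d) (bc-da : Low b c d a) (cd-da : Low c d d a) where

    private
      t : Quad n
      t = a , b , c , d

      Unless : Fin n → Fin n → Fin n → Fin n → Set
      Unless x y u v = samePair x y u v ≡ false → Low x y u v

      R : Fin n → Fin n → Set
      R x y = ∀ u v → inCycle t u v ≡ true → Unless x y u v

      R-sym : ∀ {x y} → R x y → R y x
      R-sym {x} {y} r u v k s = low-swapˡ {x} {y} {u} {v} (r u v k (trans (samePair-swap x y u v) s))

      edge : ∀ x y → Unless x y a b → Unless x y b c → Unless x y c d → Unless x y d a → R x y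
      edge x y = inCycle-elim a b c d (Unless x y)
        (λ {u} {v} r s → low-swapʳ {x} {y} {u} {v} (r (trans (samePair-swapʳ x y u v) s)))

      same : ∀ x y → Unless x y x y
      same x y k = ⊥-elim (true≢false (trans (sym (samePair-refl x y)) k))

    cycle-capacity : ∀ x y → inCycle t x y ≡ true → R x y
    cycle-capacity = inCycle-elim a b c d R (λ {x} {y} → R-sym {x} {y})
      (edge a b (same a b) (λ _ → ab-bc) (λ _ → ab-cd) (λ _ → ab-da))
      (edge b c (λ _ → low-comm {a} {b} {b} {c} ab-bc) (same b c) (λ _ → bc-cd) (λ _ → bc-da))
      (edge c d (λ _ → low-comm {a} {b} {c} {d} ab-cd) (λ _ → low-comm {b} {c} {c} {d} bc-cd) (same c d) (λ _ → cd-da))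
      (edge d a (λ _ → low-comm {a} {b} {d} {a} ab-da) (λ _ → low-comm {b} {c} {d} {a} bc-da) (λ _ → low-comm {c} {d} {d} {a} cd-da) (same d a))

  -- Phrased through `inCycle` and `chord` alone, so that it passes to the canonical representation.
  record Addable (t : Quad n) : Set where
    field
      edges    : ∀ x y → inCycle t x y ≡ true → A x y ≡ true
      chords   : ∀ x y → chord t x y ≡ true → bad x y ≡ false
      capacity : ∀ x y → inCycle t x y ≡ true → ∀ u v → inCycle t u v ≡ true → samePair x y u v ≡ false → Low x y u v

  addable-same : ∀ {t u} → SameCycle u t → Addable t → Addable u
  addable-same (p , q) r = record
    { edges    = λ x y h → edges x y (trans (sym (p x y)) h)
    ; chords   = λ x y h → chords x y (trans (sym (q x y)) h)
    ; capacity = λ x y h u v k → capacity x y (trans (sym (p x y)) h) u v (trans (sym (p u v)) k) }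
    where open Addable r

  addable-survivor : ∀ t → 1 ≤ weight t → blocked t ≡ false →
    Σ (Quad n) λ u → (canonical u ≡ true) × Addable u × (H u ≡ false)
  addable-survivor t@(a , b , c , d) pos free =
    let u , can , same , fresh = canonicalise (λ v → H v ≡ false) a b c d
          (distinct ab) (distinct bc) (distinct cd) (distinct da) (apart ac) (apart bd) orbit
    in u , can , addable-same same addable , fresh
    where
    w₀ = 1≤-* ((α a b * α b c) * (α c d * α d a)) (ν a c * ν b d) pos
    w₁ = 1≤-* (α a b * α b c) (α c d * α d a) (proj₁ w₀)
    w₂ = 1≤-* (α a b) (α b c) (proj₁ w₁)
    w₃ = 1≤-* (α c d) (α d a) (proj₂ w₁)
    w₄ = 1≤-* (ν a c) (ν b d) (proj₂ w₀)
    ab : A a b ≡ true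
    ab = 1≤⟦⟧ (proj₁ w₂)
    bc : A b c ≡ true
    bc = 1≤⟦⟧ (proj₂ w₂)
    cd : A c d ≡ true
    cd = 1≤⟦⟧ (proj₁ w₃)
    da : A d a ≡ true
    da = 1≤⟦⟧ (proj₂ w₃)
    ac : bad a c ≡ false
    ac = not-true (1≤⟦⟧ (proj₁ w₄))
    bd : bad b d ≡ false
    bd = not-true (1≤⟦⟧ (proj₂ w₄))
    distinct : ∀ {x y} → A x y ≡ true → x ≢ y
    distinct {x} h refl = true≢false (trans (sym (proj₁ (∧-true {adj M₀ x x} h))) (adj-irrefl M₀ x))
    apart : ∀ {x y} → bad x y ≡ false → x ≢ y
    apart {x} h refl = true≢false (trans (sym (==-refl x)) (proj₁ (∨-false {x == x} h)))
    f₁ = ∨-false {blockedPath t} free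
    f₂ = ∨-false {blockedPath (rot t)} (proj₂ f₁)
    f₃ = ∨-false {blockedOpp t} (proj₂ f₂)
    f₄ = ∨-false {blockedOpp (rot t)} (proj₂ f₃)
    p₁ = ∨-false {satPath a b c} (proj₁ f₁)
    p₂ = ∨-false {satPath b c d} (proj₁ f₂)
    low : ∀ x y u v → (ℓ ≤ᵇ deg02 H x y u v) ≡ false → Low x y u v
    low x y u v = ≤ᵇ-false ℓ (deg02 H x y u v)
    addable : Addable t
    addable = record
      { edges    = inCycle-elim a b c d (λ x y → A x y ≡ true) (λ {x} {y} h → trans (A-sym y x) h) ab bc cd da
      ; chords   = chord-elim a b c d (λ x y → bad x y ≡ false) (λ {x} {y} h → trans (bad-sym y x) h) ac bd
      ; capacity = cycle-capacity a b c d (low a b b c (proj₁ p₁)) (low a b c d (proj₁ f₃))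
          (low-swapʳ {a} {b} {a} {d} (low-swapˡ {b} {a} {a} {d} (low b a a d (proj₂ p₂))))
          (low b c c d (proj₁ p₂)) (low b c d a (proj₁ f₄))
          (low-swapʳ {c} {d} {a} {d} (low-swapˡ {d} {c} {a} {d} (low-comm {a} {d} {d} {c} (low a d d c (proj₂ p₁))))) }
    orbit : Orbit (λ v → H v ≡ false) t
    orbit = four (H t) (H (rot t)) (H (rot (rot t))) (H (rot (rot (rot t)))) (proj₁ f₅) ,
            four (H (ref t)) (H (ref (rot t))) (H (ref (rot (rot t)))) (H (ref (rot (rot (rot t))))) (proj₂ f₅)
      where
      f₅ = ∨-false {H t ∨ H (rot t) ∨ H (rot (rot t)) ∨ H (rot (rot (rot t)))} (proj₂ f₄)
      four : ∀ p q r s → p ∨ q ∨ r ∨ s ≡ false → (p ≡ false) × (q ≡ false) × (r ≡ false) × (s ≡ false)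
      four false false false false h = refl , refl , refl , refl

  addable-good : ∀ t → Addable t → goodC4 P t ≡ true
  addable-good t@(a , b , c , d) r =
    ∧-intro ab (∧-intro bc (∧-intro cd (∧-intro da none)))
    where
    open Addable r
    M₀-edge : ∀ x y → inCycle t x y ≡ true → adj M₀ x y ≡ true
    M₀-edge x y h = proj₁ (∧-true {adj M₀ x y} (edges x y h))
    edge : ∀ x y → inCycle t x y ≡ true → adj (M P) x y ≡ true
    edge x y h = M₀⊆M x y (M₀-edge x y h)
    in-ab = proj₁ (cycle-edges a b c d)
    in-bc = proj₁ (proj₂ (cycle-edges a b c d))
    in-cd = proj₁ (proj₂ (proj₂ (cycle-edges a b c d)))
    in-da = proj₂ (proj₂ (proj₂ (cycle-edges a b c d)))
    ab = edge a b in-ab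
    bc = edge b c in-bc
    cd = edge c d in-cd
    da = edge d a in-da
    no-E : ∀ x y u v → adj M₀ x u ≡ true → adj M₀ y v ≡ true → bad x y ≡ false → adj (E P) x y ≡ false
    no-E x y u v p q h = E₀-enough x y u v p q (proj₁ (∨-false {adj E₀ x y} (proj₂ (∨-false {x == y} h))))
    ac : adj (E P) a c ≡ false
    ac = no-E a c b d (M₀-edge a b in-ab) (M₀-edge c d in-cd) (chords a c (proj₁ (chord-diagonals a b c d)))
    bd : adj (E P) b d ≡ false
    bd = no-E b d c a (M₀-edge b c in-bc) (M₀-edge d a in-da) (chords b d (proj₂ (chord-diagonals a b c d)))
    none : (induced (E P) t ≡ᵇ 0) ≡ true
    none rewrite adj-disjoint P a b ab | adj-disjoint P b c bc | adj-disjoint P c d cd | adj-disjoint P d a da | ac | bd = refl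

  insert-admissible : ∀ t → canonical t ≡ true → Addable t → Admissible P ℓ (insert H t)
  insert-admissible t can r = record { good = good′ ; cap01 = cap01′ ; cap02 = cap02′ ; cap10 = cap10′ }
    where
    open Addable r
    good′ : ∀ u → H u ∨ eqQuad u t ≡ true → canonical u ∧ goodC4 P u ≡ true
    good′ u h with ∨-true {H u} h
    ... | inj₁ p = good u p
    ... | inj₂ p = subst (λ v → canonical v ∧ goodC4 P v ≡ true) (sym (eqQuad⇒≡ u t p)) (∧-intro can (addable-good t r))
    cap01′ : ∀ x y → n * deg01 (insert H t) x y ≤ ℓ ^ 3
    cap01′ x y = bounded (inCycle t x y) refl
      where
      φ : Quad n → Bool
      φ u = inCycle u x y
      bounded : ∀ b → inCycle t x y ≡ b → n * deg (insert H t) φ ≤ ℓ ^ 3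
      bounded true  p = ≤-trans (*-monoʳ-≤ n (≤-trans (deg-insert H t φ) (≤-trans (+-monoʳ-≤ (deg H φ) (⟦⟧≤1 (φ t))) (≤-reflexive (+-comm (deg H φ) 1)))))
        (<ᵇ-false (ℓ ^ 3) (n * suc (deg01 H x y)) (not-true (proj₂ (∧-true {adj M₀ x y} (edges x y p)))))
      bounded false p = ≤-trans (*-monoʳ-≤ n (≤-trans (deg-insert H t φ) (≤-reflexive (trans (cong (λ b → deg H φ + ⟦ b ⟧) p) (+-identityʳ (deg H φ)))))) (cap01 x y)
    cap02′ : ∀ x y u v → samePair x y u v ≡ false → deg02 (insert H t) x y u v ≤ ℓ
    cap02′ x y u v h = deg-insert-cap H t (λ q → inCycle q x y ∧ inCycle q u v) (cap02 x y u v h)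
      λ p → capacity x y (proj₁ (∧-true {inCycle t x y} p)) u v (proj₂ (∧-true {inCycle t x y} p)) h
    cap10′ : ∀ x y → deg10 P (insert H t) x y ≤ ℓ ^ 2
    cap10′ x y = deg-insert-cap H t (λ q → inA (M P) q x y) (cap10 x y) λ p →
      ≤ᵇ-false (ℓ ^ 2) (deg10 P H x y) (proj₁ (∨-false {satChord x y} (proj₂ (∨-false {adj E₀ x y} (proj₂ (∨-false {x == y}
        (chords x y (chord-of (inCycle t x y) (chord t x y) p))))))))
      where
      chord-of : ∀ i k {z} → (i ∨ k) ∧ not i ∧ z ≡ true → k ≡ true
      chord-of false true p = refl

  extend : 1 ≤ ℓ → K ≤ 2 * (ℓ * ℓ) → 1296 * eH H < G →
    Σ (Hyp n) λ H′ → Admissible P ℓ H′ × (eH H′ ≡ suc (eH H))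
  extend 1≤ℓ K≤ G> =
    let t , pos , free = survivor 1≤ℓ K≤ G>
        u , can , add , fresh = addable-survivor t pos free
    in insert H u , insert-admissible u can add , eH-insert H u fresh

-- Squares, square roots and binomial coefficients.

*-self-cancel-≤ : ∀ {a b} → a * a ≤ b * b → a ≤ b
*-self-cancel-≤ {a} {b} h with a ≤? b
... | yes p = p
... | no ¬p = ⊥-elim (<⇒≱ (*-mono-< (≰⇒> ¬p) (≰⇒> ¬p)) h)

scale-≤ : ∀ {a} b → 1 ≤ a → b ≤ a * b
scale-≤ b p = ≤-trans (≤-reflexive (sym (*-identityˡ b))) (*-monoˡ-≤ b p)

ceil-sqrt : ∀ N → Σ ℕ λ y → (y * y ≤ N) × (N ≤ suc y * suc y)
ceil-sqrt zero = 0 , z≤n , z≤n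
ceil-sqrt (suc N) with ceil-sqrt N
... | y , p , q with suc N ≤? suc y * suc y
... | yes r = y , m≤n⇒m≤1+n p , r
... | no ¬r = suc y , <⇒≤ (≰⇒> ¬r) , ≤-trans (s≤s q) (linear (2 + 2 * y) z≤n (eq y))
  where eq : ∀ y → 1 + (1 + y) * (1 + y) + 0 + (2 + 2 * y) ≡ (2 + y) * (2 + y) + 0
        eq = solve-∀

2*nC2+n : ∀ n → 2 * (n C 2) + n ≡ n * n
2*nC2+n zero = refl
2*nC2+n (suc n) = trans (cong (λ v → 2 * v + suc n) (sym (nCk+nC[k+1]≡[n+1]C[k+1] n 1)))
  (trans (cong (λ v → 2 * (v + n C 2) + suc n) (nC1≡n n)) (trans (eq n (n C 2)) (trans (cong (λ v → v + (2 * n + 1)) (2*nC2+n n)) (eq′ n))))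
  where eq : ∀ n c → 2 * (n + c) + (1 + n) ≡ 2 * c + n + (2 * n + 1)
        eq = solve-∀
        eq′ : ∀ n → n * n + (2 * n + 1) ≡ (1 + n) * (1 + n)
        eq′ = solve-∀

-- Passing from one 4-cycle at a time to the hypergraph

Supersaturated : ∀ {n} → Pregraph n → ℕ → ℕ → Set
Supersaturated {n} P ℓ b =
  Σ (Fin 3) λ i → Σ (Hyp n) λ H →
    SubHyp P i H ×
    (ℓ ^ 4 ≤ b * eH H) ×
    ((x y : Fin n) → IsMEdge P x y → n * deg01 H x y ≤ ℓ ^ 3) ×
    ((x y u v : Fin n) → IsMEdge P x y → IsMEdge P u v →
       ¬ ((x ≡ u) × (y ≡ v)) → deg02 H x y u v ≤ ℓ) ×
    (0 < toℕ i → (x y : Fin n) → IsMEdge P x y → deg10 P H x y ≤ ℓ ^ 2)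

Extendable : ∀ {n} → Pregraph n → ℕ → ℕ → Set
Extendable {n} P ℓ b = (H : Hyp n) → Admissible P ℓ H → b * eH H < ℓ ^ 4 →
  Σ (Hyp n) λ H′ → Admissible P ℓ H′ × (eH H′ ≡ suc (eH H))

module _ {n : ℕ} (P : Pregraph n) (ℓ b : ℕ) where

  grow : Extendable P ℓ b → ∀ k → Σ (Hyp n) λ H → Admissible P ℓ H × ((k ≤ eH H) ⊎ (ℓ ^ 4 ≤ b * eH H))
  grow ext zero = (λ _ → false) , empty-admissible P ℓ , inj₁ z≤n
  grow ext (suc k) with grow ext k
  ... | H , adm , inj₂ q = H , adm , inj₂ q
  ... | H , adm , inj₁ p with ℓ ^ 4 ≤? b * eH H
  ... | yes q = H , adm , inj₂ q
  ... | no ¬q with ext H adm (≰⇒> ¬q)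
  ... | H′ , adm′ , eq = H′ , adm′ , inj₁ (subst (suc k ≤_) (sym eq) (s≤s p))

  level : Hyp n → Fin 3 → Hyp n
  level H i t = H t ∧ (induced (M P) t ≡ᵇ 4 + toℕ i)

  goodC4-induced : ∀ t → goodC4 P t ≡ true →
    ⟦ induced (M P) t ≡ᵇ 4 ⟧ + (⟦ induced (M P) t ≡ᵇ 5 ⟧ + ⟦ induced (M P) t ≡ᵇ 6 ⟧) ≡ 1
  goodC4-induced (a , b , c , d) h with ∧-true {adj (M P) a b} h
  ... | ab , h₁ with ∧-true {adj (M P) b c} h₁
  ... | bc , h₂ with ∧-true {adj (M P) c d} h₂
  ... | cd , h₃ with ∧-true {adj (M P) d a} h₃
  ... | da , _ rewrite ab | bc | cd | da with adj (M P) a c | adj (M P) b d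
  ... | true  | true  = refl
  ... | true  | false = refl
  ... | false | true  = refl
  ... | false | false = refl

  module _ (H : Hyp n) (adm : Admissible P ℓ H) where
    open Admissible adm

    levels-total : eH H ≡ eH (level H F.zero) + (eH (level H (F.suc F.zero)) + eH (level H (F.suc (F.suc F.zero))))
    levels-total = trans (S-cong (quads n) pointwise) (trans (S-+ (quads n) (f 4) _) (cong (S (quads n) (f 4) +_) (S-+ (quads n) (f 5) (f 6))))
      where
      f : ℕ → Quad n → ℕ
      f k t = ⟦ H t ∧ (induced (M P) t ≡ᵇ k) ⟧
      pointwise : ∀ t → ⟦ H t ⟧ ≡ f 4 t + (f 5 t + f 6 t)
      pointwise t with H t in p
      ... | true  = sym (goodC4-induced t (proj₂ (∧-true {canonical t} (good t p))))
      ... | false = refl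

    deg-level : ∀ i φ → deg (level H i) φ ≤ deg H φ
    deg-level i φ = S-mono (quads n) λ t → bit (H t) (induced (M P) t ≡ᵇ 4 + toℕ i) (φ t)
      where
      bit : ∀ a b c → ⟦ (a ∧ b) ∧ c ⟧ ≤ ⟦ a ∧ c ⟧
      bit false b c = z≤n
      bit true true c = ≤-refl
      bit true false c = z≤n

    level-subHyp : ∀ i → SubHyp P i (level H i)
    level-subHyp i t h with ∧-true {H t} h
    ... | p , q with ∧-true {canonical t} (good t p)
    ... | r , s = ∧-intro r (∧-intro s q)

    large-level : Σ (Fin 3) λ i → eH H ≤ 3 * eH (level H i)
    large-level = pick (eH (level H F.zero)) (eH (level H (F.suc F.zero))) (eH (level H (F.suc (F.suc F.zero)))) refl refl refl
      where
      three : ∀ {x a b c} → x ≡ a + (b + c) → a ≤ c → b ≤ c → x ≤ 3 * c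
      three {c = c} refl p q = ≤-trans (+-mono-≤ p (+-monoˡ-≤ c q)) (≤-reflexive (cong (λ v → c + (c + v)) (sym (+-identityʳ c))))
      pick : ∀ a b c → eH (level H F.zero) ≡ a → eH (level H (F.suc F.zero)) ≡ b → eH (level H (F.suc (F.suc F.zero))) ≡ c →
        Σ (Fin 3) λ i → eH H ≤ 3 * eH (level H i)
      pick a b c refl refl refl with ≤-total a b | ≤-total b c | ≤-total a c
      ... | inj₁ p | inj₁ q | _      = F.suc (F.suc F.zero) , three levels-total (≤-trans p q) q
      ... | inj₁ p | inj₂ q | _      = F.suc F.zero , three (trans levels-total (cong (a +_) (+-comm b c))) p q
      ... | inj₂ p | _      | inj₁ r = F.suc (F.suc F.zero) , three levels-total r (≤-trans p r)
      ... | inj₂ p | _      | inj₂ r = F.zero , three (trans levels-total (trans (+-comm a (b + c)) (+-assoc b c a))) p r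

    supersaturated-of : ℓ ^ 4 ≤ b * eH H → Supersaturated P ℓ (3 * b)
    supersaturated-of big with large-level
    ... | i , p = i , level H i , level-subHyp i ,
      ≤-trans big (≤-trans (*-monoʳ-≤ b p) (≤-reflexive (trans (sym (*-assoc b 3 _)) (cong (_* eH (level H i)) (*-comm b 3))))) ,
      (λ x y _ → ≤-trans (*-monoʳ-≤ n (deg-level i (λ t → inCycle t x y))) (cap01 x y)) ,
      (λ x y u v xy uv ≢ → ≤-trans (deg-level i (λ t → inCycle t x y ∧ inCycle t u v)) (cap02 x y u v (different x y u v (proj₁ xy) (proj₁ uv) ≢))) ,
      (λ _ x y _ → ≤-trans (deg-level i (λ t → inA (M P) t x y)) (cap10 x y))
      where
      different : ∀ x y u v → toℕ x < toℕ y → toℕ u < toℕ v → ¬ ((x ≡ u) × (y ≡ v)) → samePair x y u v ≡ false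
      different x y u v p q r with samePair x y u v in eq
      ... | false = refl
      ... | true with samePair⇒ x y u v eq
      ...   | inj₁ s = ⊥-elim (r s)
      ...   | inj₂ (refl , refl) = ⊥-elim (<-asym p q)

  supersaturated : 1 ≤ b → Extendable P ℓ b → Supersaturated P ℓ (3 * b)
  -- Since `b ≥ 1`, a family of `ℓ ^ 4` cycles is large enough, so this many steps always suffice.
  supersaturated 1≤b ext with grow ext (ℓ ^ 4)
  ... | H , adm , inj₁ p = supersaturated-of H adm (≤-trans p (scale-≤ (eH H) 1≤b))
  ... | H , adm , inj₂ p = supersaturated-of H adm p

-- Closeness to a clique

∣∣ᵛ-suc : ∀ {n} (U : VSet (suc n)) → ∣ U ∣ᵛ ≡ ⟦ U F.zero ⟧ + ∣ (U ∘ F.suc) ∣ᵛ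
∣∣ᵛ-suc U = ∑-suc (λ x → ⟦ U x ⟧)

_⊆ᵛ_ : ∀ {n} → VSet n → VSet n → Set
U ⊆ᵛ W = ∀ x → ⟦ U x ⟧ ≤ ⟦ W x ⟧

cons : ∀ {n} → Bool → VSet n → VSet (suc n)
cons b W F.zero    = b
cons b W (F.suc x) = W x

enlarge : ∀ {n} (U : VSet n) ℓ → ∣ U ∣ᵛ ≤ ℓ → ℓ ≤ n → Σ (VSet n) λ W → (∣ W ∣ᵛ ≡ ℓ) × (U ⊆ᵛ W)
enlarge {zero}  U zero    p q = U , refl , λ ()
enlarge {suc n} U ℓ p q with U F.zero in eq | subst (_≤ ℓ) (∣∣ᵛ-suc U) p
enlarge {suc n} U (suc ℓ) p (s≤s q) | true | s≤s r with enlarge (U ∘ F.suc) ℓ r q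
... | W , w , s = cons true W , trans (∣∣ᵛ-suc (cons true W)) (cong suc w) , λ { F.zero → ⟦⟧≤1 (U F.zero) ; (F.suc x) → s x }
enlarge {suc n} U ℓ p q | false | r with ℓ ≤? n
... | yes ℓ≤n = let W , w , s = enlarge (U ∘ F.suc) ℓ r ℓ≤n in
  cons false W , trans (∣∣ᵛ-suc (cons false W)) w , λ { F.zero → ≤-reflexive (cong ⟦_⟧ eq) ; (F.suc x) → s x }
... | no ℓ≰n = (λ _ → true) , trans (FinSums.∑-const (suc n) 1) (trans (*-identityʳ (suc n)) (≤-antisym (≰⇒> ℓ≰n) q)) , λ x → ⟦⟧≤1 (U x)

shrink : ∀ {n} (U : VSet n) ℓ → ℓ ≤ ∣ U ∣ᵛ → Σ (VSet n) λ W → (∣ W ∣ᵛ ≡ ℓ) × (W ⊆ᵛ U)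
shrink {n} U zero p = (λ _ → false) , trans (FinSums.∑-const n 0) (*-zeroʳ n) , λ x → z≤n
shrink {suc n} U (suc ℓ) p with U F.zero in eq | subst (suc ℓ ≤_) (∣∣ᵛ-suc U) p
... | true  | s≤s r = let W , w , s = shrink (U ∘ F.suc) ℓ r in
  cons true W , trans (∣∣ᵛ-suc (cons true W)) (cong suc w) , λ { F.zero → ≤-reflexive (cong ⟦_⟧ (sym eq)) ; (F.suc x) → s x }
... | false | r = let W , w , s = shrink (U ∘ F.suc) (suc ℓ) r in
  cons false W , trans (∣∣ᵛ-suc (cons false W)) w , λ { F.zero → z≤n ; (F.suc x) → s x }

module _ {n : ℕ} (X : EdgeSet n) where

  open FinSums n
  private V = allFin n

  edgesIn : VSet n → ℕ
  edgesIn U = ∑∑ λ x y → ⟦ adj X x y ⟧ * (⟦ U x ⟧ * ⟦ U y ⟧)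

  -- Twice |X Δ Y| + 2|X ∩ Y| = |X| + |Y| for Y the complete graph on `W`: `edgesIn` counts ordered
  -- pairs, and the slack is the diagonal of `W`.
  symDiff-bound : ∀ W → 2 * symDiffK X W + 2 * edgesIn W ≤ 2 * e X + ∣ W ∣ᵛ * ∣ W ∣ᵛ
  symDiff-bound W = begin
    2 * symDiffK X W + 2 * edgesIn W ≡⟨ cong₂ _+_ (∑∑adj X′) (∑∑-*ˡ 2 (λ x y → ⟦ adj X x y ⟧ * (⟦ W x ⟧ * ⟦ W y ⟧))) ⟨
    ∑∑ (λ x y → ⟦ adj X′ x y ⟧) + ∑∑ (λ x y → 2 * (⟦ adj X x y ⟧ * (⟦ W x ⟧ * ⟦ W y ⟧))) ≡⟨ ∑∑-+ (λ x y → ⟦ adj X′ x y ⟧) _ ⟨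
    ∑∑ (λ x y → ⟦ adj X′ x y ⟧ + 2 * (⟦ adj X x y ⟧ * (⟦ W x ⟧ * ⟦ W y ⟧))) ≤⟨ ∑∑-mono pointwise ⟩
    ∑∑ (λ x y → ⟦ adj X x y ⟧ + ⟦ W x ⟧ * ⟦ W y ⟧) ≡⟨ ∑∑-+ (λ x y → ⟦ adj X x y ⟧) _ ⟩
    ∑∑ (λ x y → ⟦ adj X x y ⟧) + ∑∑ (λ x y → ⟦ W x ⟧ * ⟦ W y ⟧) ≡⟨ cong₂ _+_ (∑∑adj X) (sym (∑-product (λ x → ⟦ W x ⟧) (λ y → ⟦ W y ⟧))) ⟩
    2 * e X + ∣ W ∣ᵛ * ∣ W ∣ᵛ ∎
    where
    open ≤-Reasoning
    X′ : EdgeSet n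
    X′ x y = X x y xor (W x ∧ W y)
    bits : ∀ a u v → ⟦ a xor (u ∧ v) ⟧ + 2 * (⟦ a ⟧ * (⟦ u ⟧ * ⟦ v ⟧)) ≡ ⟦ a ⟧ + ⟦ u ⟧ * ⟦ v ⟧
    bits true  true  true  = refl
    bits true  true  false = refl
    bits true  false v     = refl
    bits false true  true  = refl
    bits false true  false = refl
    bits false false v     = refl
    pointwise : ∀ x y → ⟦ adj X′ x y ⟧ + 2 * (⟦ adj X x y ⟧ * (⟦ W x ⟧ * ⟦ W y ⟧)) ≤ ⟦ adj X x y ⟧ + ⟦ W x ⟧ * ⟦ W y ⟧
    pointwise x y with x <ᶠ y | y <ᶠ x
    ... | true  | _     = ≤-reflexive (bits (X x y) (W x) (W y))
    ... | false | true  = ≤-reflexive (trans (cong (λ v → ⟦ X y x xor (W y ∧ W x) ⟧ + 2 * (⟦ X y x ⟧ * v)) (*-comm ⟦ W x ⟧ ⟦ W y ⟧))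
                            (trans (bits (X y x) (W y) (W x)) (cong (⟦ X y x ⟧ +_) (*-comm ⟦ W y ⟧ ⟦ W x ⟧))))
    ... | false | false = z≤n

  -- `U` is resized to exactly ℓ vertices. Enlarging loses no edges. Removing `r` vertices from
  -- `ℓ + r` loses at most 2r(ℓ + r) ≤ 2((ℓ + r)² - ℓ²) ≤ 4ℓ² / Q ordered pairs, whence 72 = 68 + 4.
  near-clique : ∀ Q ℓ → (U : VSet n) → ℓ ≤ n → 2 * e X ≤ ℓ * ℓ → Q * (∣ U ∣ᵛ * ∣ U ∣ᵛ) ≤ (Q + 2) * (ℓ * ℓ) →
    Q * (ℓ * ℓ) ≤ Q * edgesIn U + 68 * (ℓ * ℓ) → Σ (VSet n) λ W → (∣ W ∣ᵛ ≡ ℓ) × (Q * symDiffK X W ≤ 72 * (ℓ * ℓ))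
  near-clique Q ℓ U ℓ≤n eX U≤ U≥ = let W , w , h = resized in W , w , close W w h
    where
    open ≤-Reasoning
    close : ∀ W → ∣ W ∣ᵛ ≡ ℓ → Q * (ℓ * ℓ) ≤ Q * edgesIn W + 72 * (ℓ * ℓ) → Q * symDiffK X W ≤ 72 * (ℓ * ℓ)
    close W refl h = *-cancelˡ-≤ 2 (linear 0 (+-mono-≤ (+-mono-≤ (*-monoʳ-≤ Q (symDiff-bound W)) (*-monoʳ-≤ Q eX)) (*-monoʳ-≤ 2 h))
      (eq Q (symDiffK X W) (ℓ * ℓ) (e X) (edgesIn W)))
      where eq : ∀ Q s l x w → 2 * (Q * s) + (Q * (2 * x + l) + Q * l + 2 * (Q * w + 72 * l)) + 0
              ≡ 2 * (72 * l) + (Q * (2 * s + 2 * w) + Q * (2 * x) + 2 * (Q * l))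
            eq = solve-∀
    resized : Σ (VSet n) λ W → (∣ W ∣ᵛ ≡ ℓ) × (Q * (ℓ * ℓ) ≤ Q * edgesIn W + 72 * (ℓ * ℓ))
    resized with ≤-total ∣ U ∣ᵛ ℓ
    ... | inj₁ p = let W , w , s = enlarge U ℓ p ℓ≤n in W , w , ≤-trans U≥ (+-mono-≤
            (*-monoʳ-≤ Q (∑∑-mono λ x y → *-monoʳ-≤ ⟦ adj X x y ⟧ (*-mono-≤ (s x) (s y)))) (*-monoˡ-≤ (ℓ * ℓ) (m≤m+n 68 4)))
    ... | inj₂ p = let W , w , s = shrink U ℓ p in W , w , smaller W w s
      where
      smaller : ∀ W → ∣ W ∣ᵛ ≡ ℓ → W ⊆ᵛ U → Q * (ℓ * ℓ) ≤ Q * edgesIn W + 72 * (ℓ * ℓ)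
      smaller W refl s = linear (2 * (Q * (ℓ * r))) (+-mono-≤ (+-mono-≤ U≥ (*-monoʳ-≤ Q lost)) (*-monoʳ-≤ 2 (subst (λ v → Q * (v * v) ≤ (Q + 2) * (ℓ * ℓ)) U≡ U≤)))
          (eq Q ℓ r (edgesIn U) (edgesIn W))
        where
        rem : Fin n → ℕ
        rem x = ⟦ U x ⟧ ∸ ⟦ W x ⟧
        r = ∑ rem
        U≡x : ∀ x → ⟦ U x ⟧ ≡ ⟦ W x ⟧ + rem x
        U≡x x = sym (m+[n∸m]≡n (s x))
        U≡ : ∣ U ∣ᵛ ≡ ℓ + r
        U≡ = trans (S-cong V U≡x) (S-+ V (λ x → ⟦ W x ⟧) rem)
        lost : edgesIn U ≤ edgesIn W + 2 * (r * (ℓ + r))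
        lost = begin
          edgesIn U ≤⟨ ∑∑-mono pointwise ⟩
          ∑∑ (λ x y → ⟦ adj X x y ⟧ * (⟦ W x ⟧ * ⟦ W y ⟧) + (rem x * ⟦ U y ⟧ + ⟦ U x ⟧ * rem y))
            ≡⟨ trans (∑∑-+ (λ x y → ⟦ adj X x y ⟧ * (⟦ W x ⟧ * ⟦ W y ⟧)) _) (cong (edgesIn W +_) (trans (∑∑-+ (λ x y → rem x * ⟦ U y ⟧) _)
                 (cong₂ _+_ (sym (∑-product rem (λ y → ⟦ U y ⟧))) (sym (∑-product (λ x → ⟦ U x ⟧) rem))))) ⟩
          edgesIn W + (r * ∣ U ∣ᵛ + ∣ U ∣ᵛ * r) ≡⟨ cong (λ v → edgesIn W + (r * v + v * r)) U≡ ⟩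
          edgesIn W + (r * (ℓ + r) + (ℓ + r) * r) ≡⟨ cong (edgesIn W +_) (eq′ r (ℓ + r)) ⟩
          edgesIn W + 2 * (r * (ℓ + r)) ∎
          where
          eq′ : ∀ r v → r * v + v * r ≡ 2 * (r * v)
          eq′ = solve-∀
          expand : ∀ a w r w′ r′ → a ≤ 1 → a * ((w + r) * (w′ + r′)) ≤ a * (w * w′) + (r * (w′ + r′) + (w + r) * r′)
          expand a w r w′ r′ p = linear (r * r′) (*-monoˡ-≤ (r * (w′ + r′) + w * r′) p) (eq″ a w r w′ r′)
            where eq″ : ∀ a w r w′ r′ → a * ((w + r) * (w′ + r′)) + 1 * (r * (w′ + r′) + w * r′) + r * r′
                    ≡ a * (w * w′) + (r * (w′ + r′) + (w + r) * r′) + a * (r * (w′ + r′) + w * r′)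
                  eq″ = solve-∀
          pointwise : ∀ x y → ⟦ adj X x y ⟧ * (⟦ U x ⟧ * ⟦ U y ⟧) ≤ ⟦ adj X x y ⟧ * (⟦ W x ⟧ * ⟦ W y ⟧) + (rem x * ⟦ U y ⟧ + ⟦ U x ⟧ * rem y)
          pointwise x y = subst₂ (λ u v → ⟦ adj X x y ⟧ * (u * v) ≤ ⟦ adj X x y ⟧ * (⟦ W x ⟧ * ⟦ W y ⟧) + (rem x * v + u * rem y))
            (sym (U≡x x)) (sym (U≡x y)) (expand ⟦ adj X x y ⟧ ⟦ W x ⟧ (rem x) ⟦ W y ⟧ (rem y) (⟦⟧≤1 (adj X x y)))
            where open Relation.Binary.PropositionalEquality using (subst₂)
        eq : ∀ Q ℓ r u w → Q * (ℓ * ℓ) + (Q * u + 68 * (ℓ * ℓ) + Q * (w + 2 * (r * (ℓ + r))) + 2 * ((Q + 2) * (ℓ * ℓ))) + 2 * (Q * (ℓ * r))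
          ≡ Q * w + 72 * (ℓ * ℓ) + (Q * (ℓ * ℓ) + Q * u + 2 * (Q * ((ℓ + r) * (ℓ + r))))
        eq = solve-∀

-- Small families can be extended.

ℓ^4≡ : ∀ ℓ → ℓ ^ 4 ≡ ℓ * ℓ * (ℓ * ℓ)
ℓ^4≡ = eq
  where eq : ∀ ℓ → ℓ * (ℓ * (ℓ * (ℓ * 1))) ≡ ℓ * ℓ * (ℓ * ℓ)
        eq = solve-∀

1≤-square : ∀ {ℓ} → 1 ≤ ℓ * ℓ → 1 ≤ ℓ
1≤-square {suc ℓ} _ = s≤s z≤n

module Saturated {n : ℕ} (P : Pregraph n) (ℓ : ℕ) (M₀ E₀ : EdgeSet n) (H : Hyp n)
  (b : ℕ) (1≤ℓ : 1 ≤ ℓ) (bh : b * eH H ≤ ℓ ^ 4) where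

  open Saturation P ℓ M₀ E₀ H
  open ≤-Reasoning

  private
    h = eH H
    bh′ : b * h ≤ ℓ * ℓ * (ℓ * ℓ)
    bh′ = subst (b * h ≤_) (ℓ^4≡ ℓ) bh

  -- Half of the `ℓ²` is reserved for the diagonal and half for saturated and dead pairs, whence
  -- 1032 = 2 · 516.
  excess-small : ∀ c → 2 * c * n ≤ ℓ * ℓ → 1032 * c ≤ b → c * ∑∑ excess ≤ ℓ * ℓ
  excess-small c p q = *-cancelˡ-≤ 2 (cancel-≤ (*-mono-≤ 1≤ℓ 1≤ℓ)
    (linear 0 (+-mono-≤ (+-mono-≤ (*-monoʳ-≤ (2 * c) excess-total) (*-monoʳ-≤ (ℓ * ℓ) p)) (+-mono-≤ (*-monoˡ-≤ h q) bh′))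
      (eq (ℓ * ℓ) c n (∑∑ excess) h b)))
    where eq : ∀ l c n X h b → l * (2 * (c * X)) + (2 * c * (l * n + 516 * h) + l * l + (b * h + l * l)) + 0
            ≡ l * (2 * l) + (2 * c * (l * X) + l * (2 * c * n) + (1032 * c * h + b * h))
          eq = solve-∀

  module _ (2n≤ℓ² : 2 * n ≤ ℓ * ℓ) where

    2n≤ℓ³ : 2 * n ≤ ℓ ^ 3
    2n≤ℓ³ = ≤-trans 2n≤ℓ² (≤-trans (scale-≤ (ℓ * ℓ) 1≤ℓ) (≤-reflexive (cong (λ v → ℓ * (ℓ * v)) (sym (*-identityʳ ℓ)))))

    satEdge-small : ∀ c → 16 * c ≤ b → c * ∑∑ (λ x y → ⟦ satEdge x y ⟧) ≤ ℓ * n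
    satEdge-small c q = cancel-≤ (*-mono-≤ 1≤ℓ (*-mono-≤ 1≤ℓ (*-mono-≤ 1≤ℓ (s≤s z≤n))))
      (linear 0 (+-mono-≤ (*-monoʳ-≤ c (satEdge-total 2n≤ℓ³)) (+-mono-≤ (*-monoʳ-≤ n (*-monoˡ-≤ h q)) (*-monoʳ-≤ n bh′)))
        (eq ℓ c n (∑∑ (λ x y → ⟦ satEdge x y ⟧)) h b))
      where eq : ∀ ℓ c n Y h b → ℓ * (ℓ * (ℓ * 1)) * (c * Y) + (c * (16 * n * h) + (n * (b * h) + n * (ℓ * ℓ * (ℓ * ℓ)))) + 0
              ≡ ℓ * (ℓ * (ℓ * 1)) * (ℓ * n) + (c * (ℓ * (ℓ * (ℓ * 1)) * Y) + (n * (16 * c * h) + n * (b * h)))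
            eq = solve-∀

    degrees-left : ∀ c → 16 * c ≤ b → c * (2 * e M₀) ≤ c * ∑ D + ℓ * n
    degrees-left c q = ≤-trans (*-monoʳ-≤ c (edges-left 2n≤ℓ³)) (≤-trans (≤-reflexive (*-distribˡ-+ c (∑ D) _)) (+-monoʳ-≤ (c * ∑ D) (satEdge-small c q)))

module _ {n : ℕ} (P : Pregraph n) (ℓ b : ℕ) (M₀ E₀ : EdgeSet n)
  (M₀⊆M : ∀ x y → adj M₀ x y ≡ true → adj (M P) x y ≡ true)
  (E₀-enough : ∀ x y u v → adj M₀ x u ≡ true → adj M₀ y v ≡ true → adj E₀ x y ≡ false → adj (E P) x y ≡ false)
  (1≤n : 1 ≤ n) where

  -- Combines `ℓ⁴ ≤ 4x⁴G` from `dense` with the requirement `1296 * eH H < G` of `extend`; 5184 is 4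
  -- · 1296.
  dense-extendable : ∀ x y → 1 ≤ x → 1 ≤ y → 2 * (x * x) * n ≤ ℓ * ℓ → 5184 * (x * x * (x * x)) ≤ b →
    2 * e E₀ ≤ ℓ * ℓ → x * x * (2 * e E₀) ≤ y * y * (ℓ * ℓ) → 4 * (y * ℓ * n) ≤ x * e M₀ → Extendable P ℓ b
  dense-extendable x y 1≤x 1≤y nb hb eE eE′ eM H adm bh = extend 1≤ℓ K≤2ℓ² G>
    where
    1≤xx : 1 ≤ x * x
    1≤xx = *-mono-≤ 1≤x 1≤x
    1≤ℓ : 1 ≤ ℓ
    1≤ℓ = 1≤-square (≤-trans (*-mono-≤ (*-mono-≤ {1} {2} (s≤s z≤n) 1≤xx) 1≤n) nb)
    open Saturation P ℓ M₀ E₀ H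
    open Extension P ℓ M₀ E₀ M₀⊆M E₀-enough H adm using (extend)
    open Saturated P ℓ M₀ E₀ H b 1≤ℓ (<⇒≤ bh)
    2n≤ℓ² : 2 * n ≤ ℓ * ℓ
    2n≤ℓ² = ≤-trans (*-monoˡ-≤ n (≤-trans (scale-≤ 2 1≤xx) (≤-reflexive (*-comm (x * x) 2)))) nb
    x²≤x⁴ : x * x ≤ x * x * (x * x)
    x²≤x⁴ = scale-≤ (x * x) 1≤xx
    xxX≤ : x * x * ∑∑ excess ≤ ℓ * ℓ
    xxX≤ = excess-small (x * x) nb (≤-trans (*-mono-≤ (m≤m+n 1032 4152) x²≤x⁴) hb)
    K≤2ℓ² : K ≤ 2 * (ℓ * ℓ)
    K≤2ℓ² = ≤-trans K≤ (≤-trans (+-mono-≤ eE (≤-trans (scale-≤ (∑∑ excess) 1≤xx) xxX≤)) (≤-reflexive (cong (ℓ * ℓ +_) (sym (+-identityʳ (ℓ * ℓ))))))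
    xxK≤ : x * x * K ≤ 2 * (y * y * (ℓ * ℓ))
    xxK≤ = linear 0 (+-mono-≤ (*-monoʳ-≤ (x * x) K≤) (+-mono-≤ eE′ (≤-trans xxX≤ (scale-≤ (ℓ * ℓ) (*-mono-≤ 1≤y 1≤y)))))
      (eq (x * x) K (e E₀) (∑∑ excess) (y * y * (ℓ * ℓ)))
      where eq : ∀ x K e X L → x * K + (x * (2 * e + X) + (L + L)) + 0 ≡ 2 * L + (x * K + (x * (2 * e) + x * X))
            eq = solve-∀
    x≤yℓ : x ≤ y * ℓ
    x≤yℓ = ≤-trans (*-self-cancel-≤ (≤-trans (≤-trans (scale-≤ (x * x) (≤-trans 1≤n (m≤m+n n (n + 0)))) (≤-reflexive (eq n (x * x)))) nb)) (scale-≤ ℓ 1≤y)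
      where eq : ∀ n x → 2 * n * x ≡ 2 * x * n
            eq = solve-∀
    -- The sum of the degrees in `M₀` gives 8 units of `yℓn`, and saturated edges take away at most
    -- one.
    D≥ : 7 * (y * ℓ * n) ≤ x * ∑ D
    D≥ = linear 0 (+-mono-≤ (+-mono-≤ (degrees-left 2n≤ℓ² x (≤-trans (*-mono-≤ (m≤m+n 16 5168) (≤-trans (scale-≤ x 1≤x) x²≤x⁴)) hb)) (*-monoʳ-≤ 2 eM))
        (≤-trans (scale-≤ (ℓ * n) 1≤y) (≤-reflexive (sym (*-assoc y ℓ n)))))
      (eq (y * ℓ * n) x (e M₀) (∑ D) (ℓ * n))
      where eq : ∀ L x m d l → 7 * L + (x * d + l + 2 * (x * m) + L) + 0 ≡ x * d + (x * (2 * m) + 2 * (4 * L) + l)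
            eq = solve-∀
    ℓ⁴≤ : ℓ * ℓ * (ℓ * ℓ) ≤ 4 * (x * x * (x * x)) * G
    ℓ⁴≤ = dense ℓ x y 1≤n 1≤x 1≤y x≤yℓ xxK≤ D≥
    G> : 1296 * eH H < G
    G> = *-cancelˡ-< (4 * (x * x * (x * x))) _ _ (≤-<-trans
      (≤-trans (≤-reflexive (eq (x * x * (x * x)) (eH H))) (*-monoˡ-≤ (eH H) hb))
      (<-≤-trans bh (≤-trans (≤-reflexive (ℓ^4≡ ℓ)) ℓ⁴≤)))
      where eq : ∀ x h → 4 * x * (1296 * h) ≡ 5184 * x * h
            eq = solve-∀

module _ {n : ℕ} (P : Pregraph n) (ℓ b : ℕ) (1≤n : 1 ≤ n) where

  -- Here too few cycles are not excluded by counting alone: if `G ≤ 1296 * eH H`, then `G` is at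
  -- most `ℓ⁴ / (g²Q)` and the core of `Structure` shows that E is close to a clique.
  sparse-extendable : ∀ Q → 1 ≤ Q → let g = 4 * Q ; f = 2 * g * Q ; z = 64 * (f * f) * Q in
    g * g * n ≤ ℓ * ℓ → 2 * z * ℓ ≤ n → 1296 * (g * g * Q) ≤ b →
    2 * e (E P) ≤ ℓ * ℓ → 2 * Q * (ℓ * n) ≤ 2 * Q * e (M P) + ℓ * n → e (M P) ≤ 4 * (ℓ * n) →
    ¬ (Σ (VSet n) λ W → (∣ W ∣ᵛ ≡ ℓ) × (Q * symDiffK (E P) W ≤ 72 * (ℓ * ℓ))) → Extendable P ℓ b
  sparse-extendable Q 1≤Q nb 2zℓ≤n hb eE eM≥ eM≤ far H adm bh = extend 1≤ℓ K≤2ℓ² G>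
    where
    g f z : ℕ
    g = 4 * Q
    f = 2 * g * Q
    z = 64 * (f * f) * Q
    1≤g : 1 ≤ g
    1≤g = *-mono-≤ {1} {4} (s≤s z≤n) 1≤Q
    1≤f : 1 ≤ f
    1≤f = *-mono-≤ (*-mono-≤ {1} {2} (s≤s z≤n) 1≤g) 1≤Q
    1≤ℓ : 1 ≤ ℓ
    1≤ℓ = 1≤-square (≤-trans (*-mono-≤ (*-mono-≤ 1≤g 1≤g) 1≤n) nb)
    open Saturation P ℓ (M P) (E P) H
    open Extension P ℓ (M P) (E P) (λ _ _ p → p) (λ _ _ _ _ _ _ p → p) H adm using (extend)
    open Saturated P ℓ (M P) (E P) H b 1≤ℓ (<⇒≤ bh)
    open FinSums n
    Q≤g²Q : Q ≤ g * g * Q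
    Q≤g²Q = scale-≤ Q (*-mono-≤ 1≤g 1≤g)
    2Qn≤ℓ² : 2 * Q * n ≤ ℓ * ℓ
    2Qn≤ℓ² = ≤-trans (*-monoˡ-≤ n (≤-trans (*-monoˡ-≤ Q {2} {4} (s≤s (s≤s z≤n))) (scale-≤ g 1≤g))) nb
    2n≤ℓ² : 2 * n ≤ ℓ * ℓ
    2n≤ℓ² = ≤-trans (*-monoˡ-≤ n (≤-trans (scale-≤ 2 1≤Q) (≤-reflexive (*-comm Q 2)))) 2Qn≤ℓ²
    QX≤ : Q * ∑∑ excess ≤ ℓ * ℓ
    QX≤ = excess-small Q 2Qn≤ℓ² (≤-trans (*-mono-≤ (m≤m+n 1032 264) Q≤g²Q) hb)
    QK≤ : Q * K ≤ (Q + 1) * (ℓ * ℓ)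
    QK≤ = linear 0 (+-mono-≤ (*-monoʳ-≤ Q K≤) (+-mono-≤ (*-monoʳ-≤ Q eE) QX≤)) (eq Q K (e (E P)) (∑∑ excess) (ℓ * ℓ))
      where eq : ∀ Q K e X l → Q * K + (Q * (2 * e + X) + (Q * l + l)) + 0 ≡ (Q + 1) * l + (Q * K + (Q * (2 * e) + Q * X))
            eq = solve-∀
    K≤2ℓ² : K ≤ 2 * (ℓ * ℓ)
    K≤2ℓ² = ≤-trans K≤ (≤-trans (+-mono-≤ eE (≤-trans (scale-≤ (∑∑ excess) 1≤Q) QX≤)) (≤-reflexive (cong (ℓ * ℓ +_) (sym (+-identityʳ (ℓ * ℓ))))))
    D≥ : 2 * Q * (ℓ * n) ≤ Q * ∑ D + 2 * (ℓ * n)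
    D≥ = linear 0 (+-mono-≤ eM≥ (degrees-left 2n≤ℓ² Q (≤-trans (*-mono-≤ (m≤m+n 16 1280) Q≤g²Q) hb))) (eq Q (ℓ * n) (e (M P)) (∑ D))
      where eq : ∀ Q l m d → 2 * Q * l + (2 * Q * m + l + (Q * d + l)) + 0 ≡ Q * d + 2 * l + (2 * Q * l + Q * (2 * m))
            eq = solve-∀
    D≤8ℓn : ∑ D ≤ 8 * (ℓ * n)
    D≤8ℓn = ≤-trans ∑D≤ (≤-trans (*-monoʳ-≤ 2 eM≤) (≤-reflexive (eq (ℓ * n))))
      where eq : ∀ l → 2 * (4 * l) ≡ 8 * l
            eq = solve-∀
    g≤ℓ : g ≤ ℓ
    g≤ℓ = *-self-cancel-≤ (≤-trans (≤-trans (scale-≤ (g * g) 1≤n) (≤-reflexive (*-comm n (g * g)))) nb)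
    rounded = round-up g ℓ 1≤g
    r = proj₁ rounded
    -- Rounding `ℓ / g` up at most doubles it since `g ≤ ℓ`; the choice `g = 4 * Q` leaves room for
    -- this factor.
    2Qr≤ℓ : 2 * Q * r ≤ ℓ
    2Qr≤ℓ = *-cancelˡ-≤ 2 (≤-trans (≤-reflexive (eq Q r)) (≤-trans (proj₂ (proj₂ rounded)) (≤-trans (+-monoʳ-≤ ℓ g≤ℓ) (≤-reflexive (cong (ℓ +_) (sym (+-identityʳ ℓ)))))))
      where eq : ∀ Q r → 2 * (2 * Q * r) ≡ 4 * Q * r
            eq = solve-∀
    1≤Qf : 1 ≤ f * f * Q
    1≤Qf = *-mono-≤ (*-mono-≤ 1≤f 1≤f) 1≤Q
    large : ∀ {c} d → 1 ≤ d → d * c ≡ 2 * z → c * ℓ ≤ n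
    large {c} d 1≤d eq = ≤-trans (*-monoˡ-≤ ℓ (≤-trans (scale-≤ c 1≤d) (≤-reflexive eq))) 2zℓ≤n
    8fQℓ≤n : 8 * f * Q * ℓ ≤ n
    8fQℓ≤n = large (16 * f) (*-mono-≤ {1} {16} (s≤s z≤n) 1≤f) (eq f Q)
      where eq : ∀ f Q → 16 * f * (8 * f * Q) ≡ 2 * (64 * (f * f) * Q)
            eq = solve-∀
    2fℓ≤n : 2 * f * ℓ ≤ n
    2fℓ≤n = large (64 * (f * Q)) (*-mono-≤ {1} {64} (s≤s z≤n) (*-mono-≤ 1≤f 1≤Q)) (eq f Q)
      where eq : ∀ f Q → 64 * (f * Q) * (2 * f) ≡ 2 * (64 * (f * f) * Q)
            eq = solve-∀
    4ℓ≤n : 4 * ℓ ≤ n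
    4ℓ≤n = large (32 * (f * f * Q)) (*-mono-≤ {1} {32} (s≤s z≤n) 1≤Qf) (eq f Q)
      where eq : ∀ f Q → 32 * (f * f * Q) * 4 ≡ 2 * (64 * (f * f) * Q)
            eq = solve-∀
    absurd : G ≤ 1296 * eH H → ⊥
    absurd G≤ = far (near-clique (E P) Q ℓ core ℓ≤n eE core≤ core≥)
      where
      open ≤-Reasoning
      ℓ≤n : ℓ ≤ n
      ℓ≤n = ≤-trans (m≤m+n ℓ _) 4ℓ≤n
      g²QG≤ : g * g * Q * G ≤ ℓ * ℓ * (ℓ * ℓ)
      g²QG≤ = begin
        g * g * Q * G ≤⟨ *-monoʳ-≤ (g * g * Q) G≤ ⟩
        g * g * Q * (1296 * eH H) ≡⟨ eq (g * g * Q) (eH H) ⟩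
        1296 * (g * g * Q) * eH H ≤⟨ *-monoˡ-≤ (eH H) hb ⟩
        b * eH H ≤⟨ <⇒≤ bh ⟩
        ℓ ^ 4 ≡⟨ ℓ^4≡ ℓ ⟩
        ℓ * ℓ * (ℓ * ℓ) ∎
        where eq : ∀ x h → x * (1296 * h) ≡ 1296 * x * h
              eq = solve-∀
      8≤g² : 8 ≤ g * g
      8≤g² = ≤-trans (m≤m+n 8 8) (*-mono-≤ (*-monoʳ-≤ 4 1≤Q) (*-monoʳ-≤ 4 1≤Q))
      open Structure ℓ Q g r f z 1≤ℓ 1≤n 1≤Q 1≤g 1≤f (proj₁ (proj₂ rounded)) 2Qr≤ℓ refl refl 8fQℓ≤n 2fℓ≤n 2zℓ≤n 4ℓ≤n
        QK≤ D≥ D≤8ℓn g²QG≤ (≤-trans (*-monoˡ-≤ G (*-monoˡ-≤ Q 8≤g²)) g²QG≤) using (core; κcore; νcore; κcore≥; νcore≤)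
      w : Fin n → Fin n → ℕ
      w x y = ⟦ core x ⟧ * ⟦ core y ⟧
      w≤1 : ∀ x y → w x y ≤ 1
      w≤1 x y = *-mono-≤ (⟦⟧≤1 (core x)) (⟦⟧≤1 (core y))
      drop : ∀ a x y → a * w x y ≤ a
      drop a x y = ≤-trans (*-monoʳ-≤ a (w≤1 x y)) (≤-reflexive (*-identityʳ a))
      core≥ : Q * (ℓ * ℓ) ≤ Q * edgesIn (E P) core + 68 * (ℓ * ℓ)
      core≥ = linear 0 (+-mono-≤ (+-mono-≤ κcore≥ (*-monoʳ-≤ Q κcore≤)) QX≤) (eq Q (ℓ * ℓ) κcore (edgesIn (E P) core) (∑∑ excess))
        where
        κcore≤ : κcore ≤ edgesIn (E P) core + ∑∑ excess
        κcore≤ = begin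
          κcore ≤⟨ ∑∑-mono (λ x y → ≤-trans (*-monoˡ-≤ (w x y) (κ≤ x y)) (≤-trans (≤-reflexive (*-distribʳ-+ (w x y) ⟦ adj (E P) x y ⟧ (excess x y)))
                     (+-monoʳ-≤ (⟦ adj (E P) x y ⟧ * w x y) (drop (excess x y) x y)))) ⟩
          ∑∑ (λ x y → ⟦ adj (E P) x y ⟧ * w x y + excess x y) ≡⟨ ∑∑-+ (λ x y → ⟦ adj (E P) x y ⟧ * w x y) excess ⟩
          edgesIn (E P) core + ∑∑ excess ∎
        eq : ∀ Q l k i x → Q * l + (Q * k + 67 * l + Q * (i + x) + l) + 0 ≡ Q * i + 68 * l + (Q * l + Q * k + Q * x)
        eq = solve-∀
      core≤ : Q * (∣ core ∣ᵛ * ∣ core ∣ᵛ) ≤ (Q + 2) * (ℓ * ℓ)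
      core≤ = begin
        Q * (∣ core ∣ᵛ * ∣ core ∣ᵛ) ≡⟨ cong (Q *_) (∑-product (λ x → ⟦ core x ⟧) (λ y → ⟦ core y ⟧)) ⟩
        Q * ∑∑ w ≤⟨ *-monoʳ-≤ Q (∑∑-mono λ x y → split x y) ⟩
        Q * ∑∑ (λ x y → ν x y * w x y + κ x y) ≡⟨ cong (Q *_) (∑∑-+ (λ x y → ν x y * w x y) κ) ⟩
        Q * (νcore + K) ≡⟨ *-distribˡ-+ Q νcore K ⟩
        Q * νcore + Q * K ≤⟨ +-mono-≤ νcore≤ QK≤ ⟩
        ℓ * ℓ + (Q + 1) * (ℓ * ℓ) ≡⟨ eq Q (ℓ * ℓ) ⟩
        (Q + 2) * (ℓ * ℓ) ∎
        where
        eq : ∀ Q l → l + (Q + 1) * l ≡ (Q + 2) * l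
        eq = solve-∀
        split : ∀ x y → w x y ≤ ν x y * w x y + κ x y
        split x y = ≤-trans (≤-reflexive (trans (sym (*-identityˡ (w x y))) (trans (cong (_* w x y) (sym (⟦⟧-not (bad x y)))) (*-distribʳ-+ (w x y) (ν x y) (κ x y)))))
          (+-monoʳ-≤ (ν x y * w x y) (drop (κ x y) x y))
    G> : 1296 * eH H < G
    G> = ≰⇒> absurd

-- From rational to natural inequalities.

-- The unnormalised fraction `p / (d + 1)` avoids reasoning about gcds; `d` is the denominator minus
-- one, as in `mkℚᵘ`.
Represents : ℕ → ℕ → Q.ℚ → Set
Represents p d u = Q.toℚᵘ u ℚᵘ.≃ mkℚᵘ (ℤ.+ p) d

represents-ℕ : ∀ k → Represents k 0 ℚ[ k ]
represents-ℕ k = Q.toℚᵘ-fromℚᵘ (mkℚᵘ (ℤ.+ k) 0)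

represents-*ℕ : ∀ {p d u} k → Represents p d u → Represents (k ℕ.* p) d (ℚ[ k ] Q.* u)
represents-*ℕ {p} {d} {u} k h = ℚᵘ.≃-trans (Q.toℚᵘ-homo-* ℚ[ k ] u) (ℚᵘ.≃-trans (ℚᵘ.*-cong (represents-ℕ k) h)
  (*≡* (cong₂ (λ a b → a ℤ.* (ℤ.+ suc b)) (sym (ℤ.pos-* k p)) (sym (ℕ.+-identityʳ d)))))

module _ {p d : ℕ} {u : Q.ℚ} (rep : Represents p d u) where

  private
    product≃ : ∀ a → Q.toℚᵘ (u Q.* ℚ[ a ]) ℚᵘ.≃ mkℚᵘ (ℤ.+ (p ℕ.* a)) d
    product≃ a = ℚᵘ.≃-trans (Q.toℚᵘ-homo-* u ℚ[ a ]) (ℚᵘ.≃-trans (ℚᵘ.*-cong rep (represents-ℕ a))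
      (*≡* (cong₂ (λ x y → x ℤ.* (ℤ.+ suc y)) (sym (ℤ.pos-* p a)) (sym (ℕ.*-identityʳ d)))))

  *-≤⇒ : ∀ a b → u Q.* ℚ[ a ] Q.≤ ℚ[ b ] → p ℕ.* a ℕ.≤ suc d ℕ.* b
  *-≤⇒ a b h = subst₂ ℕ._≤_ (ℕ.*-identityʳ (p ℕ.* a)) (ℕ.*-comm b (suc d))
    (ℤ.drop‿+≤+ (subst₂ ℤ._≤_ (sym (ℤ.pos-* (p ℕ.* a) 1)) (sym (ℤ.pos-* b (suc d)))
      (ℚᵘ.drop-*≤* (ℚᵘ.≤-respˡ-≃ (product≃ a) (ℚᵘ.≤-respʳ-≃ (represents-ℕ b) (Q.toℚᵘ-mono-≤ h))))))

  ⇒*-≤ : ∀ a b → p ℕ.* a ℕ.≤ suc d ℕ.* b → u Q.* ℚ[ a ] Q.≤ ℚ[ b ]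
  ⇒*-≤ a b h = Q.toℚᵘ-cancel-≤ (ℚᵘ.≤-respˡ-≃ (ℚᵘ.≃-sym (product≃ a)) (ℚᵘ.≤-respʳ-≃ (ℚᵘ.≃-sym (represents-ℕ b))
    (*≤* (subst₂ ℤ._≤_ (ℤ.pos-* (p ℕ.* a) 1) (ℤ.pos-* b (suc d))
      (ℤ.+≤+ (subst₂ ℕ._≤_ (sym (ℕ.*-identityʳ (p ℕ.* a))) (ℕ.*-comm (suc d) b) h))))))

  ≤-*⇒ : ∀ a b → ℚ[ b ] Q.≤ u Q.* ℚ[ a ] → suc d ℕ.* b ℕ.≤ p ℕ.* a
  ≤-*⇒ a b h = subst₂ ℕ._≤_ (ℕ.*-comm b (suc d)) (ℕ.*-identityʳ (p ℕ.* a))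
    (ℤ.drop‿+≤+ (subst₂ ℤ._≤_ (sym (ℤ.pos-* b (suc d))) (sym (ℤ.pos-* (p ℕ.* a) 1))
      (ℚᵘ.drop-*≤* (ℚᵘ.≤-respʳ-≃ (product≃ a) (ℚᵘ.≤-respˡ-≃ (represents-ℕ b) (Q.toℚᵘ-mono-≤ h))))))

  ⇒≤-* : ∀ a b → suc d ℕ.* b ℕ.≤ p ℕ.* a → ℚ[ b ] Q.≤ u Q.* ℚ[ a ]
  ⇒≤-* a b h = Q.toℚᵘ-cancel-≤ (ℚᵘ.≤-respʳ-≃ (ℚᵘ.≃-sym (product≃ a)) (ℚᵘ.≤-respˡ-≃ (ℚᵘ.≃-sym (represents-ℕ b))
    (*≤* (subst₂ ℤ._≤_ (ℤ.pos-* b (suc d)) (ℤ.pos-* (p ℕ.* a) 1)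
      (ℤ.+≤+ (subst₂ ℕ._≤_ (ℕ.*-comm (suc d) b) (sym (ℕ.*-identityʳ (p ℕ.* a))) h))))))

  represents-pos : 1 ℕ.≤ p → Q.0ℚ Q.< u
  represents-pos 1≤p = Q.toℚᵘ-cancel-< (ℚᵘ.<-respʳ-≃ (ℚᵘ.≃-sym rep) (*<* (subst (ℤ._<_ (ℤ.+ 0)) (sym (ℤ.*-identityʳ (ℤ.+ p))) (ℤ.+<+ 1≤p))))

  -- The subtracted term changes sides before denominators are cleared, so all numerators stay
  -- natural even if `u > 1`.
  1-*-≤⇒ : ∀ a b → (Q.1ℚ Q.- u) Q.* ℚ[ a ] Q.≤ ℚ[ b ] → suc d ℕ.* a ℕ.≤ suc d ℕ.* b ℕ.+ p ℕ.* a
  1-*-≤⇒ a b h = subst₂ ℕ._≤_ (ℕ.*-comm a (suc d)) (ℕ.*-identityʳ _)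
    (ℤ.drop‿+≤+ (subst₂ ℤ._≤_ (sym (ℤ.pos-* a (suc d))) (sym (ℤ.pos-* (suc d ℕ.* b ℕ.+ p ℕ.* a) 1))
      (ℚᵘ.drop-*≤* (ℚᵘ.≤-respʳ-≃ sum≃ (ℚᵘ.≤-respˡ-≃ (represents-ℕ a) (Q.toℚᵘ-mono-≤ moved))))))
    where
    moved : ℚ[ a ] Q.≤ ℚ[ b ] Q.+ u Q.* ℚ[ a ]
    moved = subst (Q._≤ ℚ[ b ] Q.+ u Q.* ℚ[ a ]) (eq u ℚ[ a ]) (Q.+-monoˡ-≤ (u Q.* ℚ[ a ]) h)
      where
      eq : ∀ u x → (Q.1ℚ Q.- u) Q.* x Q.+ u Q.* x ≡ x
      eq u x = trans (sym (Q.*-distribʳ-+ x (Q.1ℚ Q.- u) u))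
        (trans (cong (Q._* x) (trans (Q.+-assoc Q.1ℚ (Q.- u) u) (trans (cong (Q.1ℚ Q.+_) (Q.+-inverseˡ u)) (Q.+-identityʳ Q.1ℚ))))
          (Q.*-identityˡ x))
    sum≃ : Q.toℚᵘ (ℚ[ b ] Q.+ u Q.* ℚ[ a ]) ℚᵘ.≃ mkℚᵘ (ℤ.+ (suc d ℕ.* b ℕ.+ p ℕ.* a)) d
    sum≃ = ℚᵘ.≃-trans (Q.toℚᵘ-homo-+ ℚ[ b ] (u Q.* ℚ[ a ])) (ℚᵘ.≃-trans (ℚᵘ.+-cong (represents-ℕ b) (product≃ a))
      (*≡* (cong₂ (λ x y → x ℤ.* (ℤ.+ suc y)) numerator (sym (ℕ.+-identityʳ d)))))
      where
      numerator : (ℤ.+ b) ℤ.* (ℤ.+ suc d) ℤ.+ (ℤ.+ (p ℕ.* a)) ℤ.* (ℤ.+ 1) ≡ ℤ.+ (suc d ℕ.* b ℕ.+ p ℕ.* a)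
      numerator = trans (cong₂ ℤ._+_ (sym (ℤ.pos-* b (suc d))) (ℤ.*-identityʳ (ℤ.+ (p ℕ.* a))))
        (trans (sym (ℤ.pos-+ (b ℕ.* suc d) (p ℕ.* a))) (cong (λ v → ℤ.+ (v ℕ.+ p ℕ.* a)) (ℕ.*-comm b (suc d))))

1/_ : ℕ → Q.ℚ
1/ s = Q.fromℚᵘ (mkℚᵘ (ℤ.+ 1) (ℕ.pred s))

represents-1/ : ∀ s → Represents 1 (ℕ.pred s) (1/ s)
represents-1/ s = Q.toℚᵘ-fromℚᵘ (mkℚᵘ (ℤ.+ 1) (ℕ.pred s))

1≤⇒suc-pred : ∀ {s} → 1 ℕ.≤ s → suc (ℕ.pred s) ≡ s
1≤⇒suc-pred (s≤s _) = refl

-- The three cases with explicit constants.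

-- Here ε = `p / q`, and `Q₂`, `z₂` are the reciprocals of δ and λ.
Cases : ∀ {n} → ℕ → ℕ → ℕ → ℕ → ℕ → Pregraph n → Set
Cases {n} p q Q₂ z₂ ℓ P =
  (4 * ℓ * n ≤ e (M P)) ⊎
  ((Q₂ * (ℓ * n) ≤ Q₂ * e (M P) + ℓ * n) ×
   ¬ (Σ (VSet n) λ W → (∣ W ∣ᵛ ≡ ℓ) × (q * symDiffK (E P) W ≤ p * (ℓ C 2))) ×
   (z₂ * ℓ ≤ n)) ⊎
  (Σ (VSet n) λ U → (q * (ℓ C 2) ≤ q * eIn (E P) U + p * (ℓ C 2)) ×
   (49 * p * (ℓ * n * (ℓ * n)) ≤ q * (eIn (M P) (U ᶜ) * eIn (M P) (U ᶜ))))

-- The constants depend only on the denominator of ε, since ε ≥ 1 / q. The factor 288 is the 72 of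
-- `near-clique` times 4, as `ℓ² ≤ 4 * (ℓ C 2)` for `ℓ ≥ 2`. The two summands of `b` serve
-- `dense-extendable` and `sparse-extendable`, and `g` is the constant C.
module Constants (q : ℕ) where

  x Qₒ g f z b : ℕ
  x = 3 * q
  Qₒ = 288 * q
  g = 4 * Qₒ
  f = 2 * g * Qₒ
  z = 64 * (f * f) * Qₒ
  b = 5184 * (x * x * (x * x)) + 1296 * (g * g * Qₒ)

module NaturalNumbers (p q : ℕ) (1≤p : 1 ≤ p) (1≤q : 1 ≤ q) where

  open Constants q

  1≤x : 1 ≤ x
  1≤x = *-mono-≤ {1} {3} (s≤s z≤n) 1≤q
  1≤Q : 1 ≤ Qₒ
  1≤Q = *-mono-≤ {1} {288} (s≤s z≤n) 1≤q
  1≤g : 1 ≤ g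
  1≤g = *-mono-≤ {1} {4} (s≤s z≤n) 1≤Q
  5184≤b : 5184 ≤ b
  5184≤b = ≤-trans (*-monoʳ-≤ 5184 {1} {x * x * (x * x)} (*-mono-≤ (*-mono-≤ 1≤x 1≤x) (*-mono-≤ 1≤x 1≤x))) (m≤m+n (5184 * (x * x * (x * x))) (1296 * (g * g * Qₒ)))
  1≤b : 1 ≤ b
  1≤b = ≤-trans (s≤s z≤n) 5184≤b
  1≤f : 1 ≤ f
  1≤f = *-mono-≤ (*-mono-≤ {1} {2} (s≤s z≤n) 1≤g) 1≤Q
  1≤3b : 1 ≤ 3 * b
  1≤3b = *-mono-≤ {1} {3} (s≤s z≤n) 1≤b
  1≤2Q : 1 ≤ 2 * Qₒ
  1≤2Q = *-mono-≤ {1} {2} (s≤s z≤n) 1≤Q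
  1≤2z : 1 ≤ 2 * z
  1≤2z = *-mono-≤ {1} {2} (s≤s z≤n) (*-mono-≤ (*-mono-≤ {1} {64} (s≤s z≤n) (*-mono-≤ 1≤f 1≤f)) 1≤Q)

  module _ {n : ℕ} (ℓ : ℕ) (1≤n : 1 ≤ n) (g²n≤ℓ² : g * g * n ≤ ℓ * ℓ) (P : Pregraph n) (eE : e (E P) ≤ ℓ C 2) where

    2eE≤ℓ² : 2 * e (E P) ≤ ℓ * ℓ
    2eE≤ℓ² = ≤-trans (*-monoʳ-≤ 2 eE) (≤-trans (m≤m+n (2 * (ℓ C 2)) ℓ) (≤-reflexive (2*nC2+n ℓ)))

    case-M1 : 4 * ℓ * n ≤ e (M P) → Supersaturated P ℓ (3 * b)
    case-M1 h = supersaturated P ℓ b 1≤b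
      (dense-extendable P ℓ b (M P) (E P) (λ _ _ p → p) (λ _ _ _ _ _ _ p → p) 1≤n 1 1 ≤-refl ≤-refl
        2n≤ 5184≤b 2eE≤ℓ² (≤-trans (≤-reflexive (*-identityˡ _)) (≤-trans 2eE≤ℓ² (≤-reflexive (sym (*-identityˡ _)))))
        (≤-trans (≤-reflexive (eq ℓ n)) (≤-trans h (≤-reflexive (sym (*-identityˡ _))))))
      where
      eq : ∀ ℓ n → 4 * (1 * ℓ * n) ≡ 4 * ℓ * n
      eq = solve-∀
      2n≤ : 2 * n ≤ ℓ * ℓ
      2n≤ = ≤-trans (*-monoˡ-≤ n (*-mono-≤ {1} {g} {2} {g} 1≤g (≤-trans (s≤s (s≤s z≤n)) (*-monoʳ-≤ 4 1≤Q)))) g²n≤ℓ²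

    case-M2 : 2 * Qₒ * (ℓ * n) ≤ 2 * Qₒ * e (M P) + ℓ * n → 2 * z * ℓ ≤ n →
      ¬ (Σ (VSet n) λ W → (∣ W ∣ᵛ ≡ ℓ) × (q * symDiffK (E P) W ≤ p * (ℓ C 2))) → Supersaturated P ℓ (3 * b)
    -- With `4ℓn` mixed edges (M1) applies; otherwise this upper bound limits the number of vertices
    -- of linear degree to O(ℓ).
    case-M2 eM 2zℓ≤n far = [ case-M1 , few-edges ]′ (≤-total (4 * ℓ * n) (e (M P)))
      where
      2≤ℓ : 2 ≤ ℓ
      2≤ℓ = *-self-cancel-≤ (≤-trans (*-mono-≤ 2≤g (≤-trans 2≤g (≤-trans (scale-≤ g 1≤n) (≤-reflexive (*-comm n g))))) (≤-trans (≤-reflexive (sym (*-assoc g g n))) g²n≤ℓ²))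
        where 2≤g : 2 ≤ g
              2≤g = ≤-trans (s≤s (s≤s z≤n)) (*-monoʳ-≤ 4 1≤Q)
      close : ∀ W → Qₒ * symDiffK (E P) W ≤ 72 * (ℓ * ℓ) → q * symDiffK (E P) W ≤ p * (ℓ C 2)
      close W h = ≤-trans (*-cancelˡ-≤ 288 (linear 0 (+-mono-≤ h (*-monoʳ-≤ 72 (+-mono-≤ (≤-reflexive (cong (2 *_) (sym (2*nC2+n ℓ)))) (*-monoˡ-≤ ℓ 2≤ℓ))))
          (eq q (symDiffK (E P) W) (ℓ C 2) ℓ)))
        (scale-≤ (ℓ C 2) 1≤p)
        where eq : ∀ q s c ℓ → 288 * (q * s) + (72 * (ℓ * ℓ) + 72 * (2 * (2 * c + ℓ) + ℓ * ℓ)) + 0 ≡ 288 * c + (288 * q * s + 72 * (2 * (ℓ * ℓ) + 2 * ℓ))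
              eq = solve-∀
      few-edges : e (M P) ≤ 4 * ℓ * n → Supersaturated P ℓ (3 * b)
      few-edges h = supersaturated P ℓ b 1≤b
        (sparse-extendable P ℓ b 1≤n Qₒ 1≤Q g²n≤ℓ² 2zℓ≤n (m≤n+m (1296 * (g * g * Qₒ)) (5184 * (x * x * (x * x)))) 2eE≤ℓ² eM
          (≤-trans h (≤-reflexive (*-assoc 4 ℓ n))) λ (W , w , r) → far (W , w , close W r))

    case-M3 : (U : VSet n) → q * (ℓ C 2) ≤ q * eIn (E P) U + p * (ℓ C 2) →
      49 * p * (ℓ * n * (ℓ * n)) ≤ q * (eIn (M P) (U ᶜ) * eIn (M P) (U ᶜ)) → Supersaturated P ℓ (3 * b)
    case-M3 U hE hM = supersaturated P ℓ b 1≤b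
      (dense-extendable P ℓ b M₀ E₀ M₀⊆M E₀-enough 1≤n x y 1≤x (s≤s z≤n) 2x²n≤ℓ² (m≤m+n (5184 * (x * x * (x * x))) (1296 * (g * g * Qₒ)))
        (≤-trans (*-monoʳ-≤ 2 e₀≤) 2eE≤ℓ²) x²e₀≤ 4yℓn≤)
      where
      W = U ᶜ
      M₀ = restrict (M P) W
      E₀ = restrict (E P) W
      -- With ε = p / q, the quotient y / x lies between √ε and (7 / 4) √ε.
      root = ceil-sqrt (9 * (p * q))
      y₀ = proj₁ root
      y = suc y₀
      split : ∀ X x′ y′ → adj (restrict X W) x′ y′ ≡ true → (adj X x′ y′ ≡ true) × (W x′ ≡ true) × (W y′ ≡ true)
      split X x′ y′ h with ∧-true {adj X x′ y′} (trans (sym (adj-restrict X W x′ y′)) h)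
      ... | r , s = r , ∧-true {W x′} s
      M₀⊆M : ∀ x′ y′ → adj M₀ x′ y′ ≡ true → adj (M P) x′ y′ ≡ true
      M₀⊆M x′ y′ h = proj₁ (split (M P) x′ y′ h)
      E₀-enough : ∀ x′ y′ u v → adj M₀ x′ u ≡ true → adj M₀ y′ v ≡ true → adj E₀ x′ y′ ≡ false → adj (E P) x′ y′ ≡ false
      E₀-enough x′ y′ u v h k r = inside (adj (E P) x′ y′) (proj₁ (proj₂ (split (M P) x′ u h))) (proj₁ (proj₂ (split (M P) y′ v k)))
        (trans (sym (adj-restrict (E P) W x′ y′)) r)
        where
        inside : ∀ a {s t} → s ≡ true → t ≡ true → a ∧ s ∧ t ≡ false → a ≡ false
        inside false _ _ _ = refl
        inside true refl refl ()
      e₀+ : eIn (E P) U + e E₀ ≤ e (E P)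
      e₀+ = ≤-trans (≤-reflexive (sym (S-+ (pairs n) _ _))) (S-mono (pairs n)
        λ { (x′ , y′) → bits (x′ <ᶠ y′) (E P x′ y′) (U x′) (U y′) })
        where
        bits : ∀ o a s t → ⟦ o ∧ a ∧ s ∧ t ⟧ + ⟦ o ∧ a ∧ not s ∧ not t ⟧ ≤ ⟦ o ∧ a ⟧
        bits false a s t = z≤n
        bits true false s t = z≤n
        bits true true true true = ≤-refl
        bits true true true false = z≤n
        bits true true false t = ⟦⟧≤1 (not t)
      e₀≤ : e E₀ ≤ e (E P)
      e₀≤ = ≤-trans (m≤n+m (e E₀) (eIn (E P) U)) e₀+
      -- `U` already contains all but an ε-fraction of the `ℓ C 2` edges that E may have, so at most
      -- an ε-fraction is left for `Uᶜ`. This is why a bound of order √ε on `e(M) / (ℓn)` suffices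
      -- there.
      qe₀≤ : 2 * (q * e E₀) ≤ p * (ℓ * ℓ)
      qe₀≤ = linear (p * ℓ) (+-mono-≤ (*-monoʳ-≤ 2 (+-mono-≤ hE (*-monoʳ-≤ q (≤-trans e₀+ eE)))) (*-monoʳ-≤ p (≤-reflexive (2*nC2+n ℓ))))
        (eq p q (e E₀) (ℓ C 2) (eIn (E P) U) ℓ)
        where eq : ∀ p q e c u ℓ → 2 * (q * e) + (2 * (q * u + p * c + q * c) + p * (ℓ * ℓ)) + p * ℓ
                ≡ p * (ℓ * ℓ) + (2 * (q * c + q * (u + e)) + p * (2 * c + ℓ))
              eq = solve-∀
      x²e₀≤ : x * x * (2 * e E₀) ≤ y * y * (ℓ * ℓ)
      x²e₀≤ = linear 0 (+-mono-≤ (*-monoʳ-≤ (9 * q) qe₀≤) (*-monoˡ-≤ (ℓ * ℓ) (proj₂ (proj₂ root)))) (eq p q (e E₀) (ℓ * ℓ) (y * y))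
        where eq : ∀ p q e l y → 3 * q * (3 * q) * (2 * e) + (9 * q * (p * l) + y * l) + 0 ≡ y * l + (9 * q * (2 * (q * e)) + 9 * (p * q) * l)
              eq = solve-∀
      -- The factor 9 under the root forces `y₀ ≥ 2`, where the step from `y₀` to `y` costs less
      -- than a factor 7 / 4; this turns the 7 of (M3) into the 4 of `dense-extendable`.
      4y≤7y₀ : 4 * y ≤ 7 * y₀
      4y≤7y₀ = linear 2 (*-monoʳ-≤ 3 (≤-pred 3≤y)) (eq y₀)
        where
        3≤y : 3 ≤ y
        3≤y = *-self-cancel-≤ (≤-trans (*-monoʳ-≤ 9 (*-mono-≤ 1≤p 1≤q)) (proj₂ (proj₂ root)))
        eq : ∀ y → 4 * (1 + y) + 3 * y + 2 ≡ 7 * y + 3 * 2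
        eq = solve-∀
      4yℓn≤ : 4 * (y * ℓ * n) ≤ x * e M₀
      4yℓn≤ = *-self-cancel-≤ (linear 0
        (+-mono-≤ (*-monoʳ-≤ (ℓ * n * (ℓ * n)) (+-mono-≤ (*-mono-≤ 4y≤7y₀ 4y≤7y₀) (*-monoʳ-≤ 49 (proj₁ (proj₂ root))))) (*-monoʳ-≤ (9 * q) hM))
        (eq p q ℓ n y y₀ (e M₀)))
        where eq : ∀ p q ℓ n y y₀ m → 4 * (y * ℓ * n) * (4 * (y * ℓ * n)) +
                     (ℓ * n * (ℓ * n) * (7 * y₀ * (7 * y₀) + 49 * (9 * (p * q))) + 9 * q * (q * (m * m))) + 0
                   ≡ 3 * q * m * (3 * q * m) + (ℓ * n * (ℓ * n) * (4 * y * (4 * y) + 49 * (y₀ * y₀)) + 9 * q * (49 * p * (ℓ * n * (ℓ * n))))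
              eq = solve-∀
      2x²n≤ℓ² : 2 * (x * x) * n ≤ ℓ * ℓ
      2x²n≤ℓ² = ≤-trans (*-monoˡ-≤ n (≤-trans (≤-reflexive (sym (*-assoc 2 x x)))
        (*-mono-≤ (*-mono-≤ {2} {4} (s≤s (s≤s z≤n)) x≤Q) (≤-trans x≤Q (scale-≤ {4} Qₒ (s≤s z≤n)))))) g²n≤ℓ²
        where x≤Q : x ≤ Qₒ
              x≤Q = *-monoˡ-≤ q (m≤m+n 3 285)

  main : ∀ {n} ℓ → 1 ≤ n → g * g * n ≤ ℓ * ℓ → (P : Pregraph n) → e (E P) ≤ ℓ C 2 →
    Cases p q (2 * Qₒ) (2 * z) ℓ P → Supersaturated P ℓ (3 * b)
  main ℓ 1≤n g²n≤ P eE (inj₁ h) = case-M1 ℓ 1≤n g²n≤ P eE h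
  main ℓ 1≤n g²n≤ P eE (inj₂ (inj₁ (eM , far , 2zℓ≤n))) = case-M2 ℓ 1≤n g²n≤ P eE eM 2zℓ≤n far
  main ℓ 1≤n g²n≤ P eE (inj₂ (inj₂ (U , hE , hM))) = case-M3 ℓ 1≤n g²n≤ P eE U hE hM

-- The numerical constants are variables here, so that type checking never unfolds them.
rational-form : ∀ {p d} (ε : Q.ℚ) → Represents p d ε → ∀ b₃ Q₂ z₂ g → 1 ≤ b₃ → 1 ≤ Q₂ → 1 ≤ z₂ → 1 ≤ g →
    (∀ {n} ℓ → 1 ≤ n → g * g * n ≤ ℓ * ℓ → (P : Pregraph n) → e (E P) ≤ ℓ C 2 →
      Cases p (suc d) Q₂ z₂ ℓ P → Supersaturated P ℓ b₃) →
    Σ Q.ℚ λ β → Σ Q.ℚ λ δ → Σ Q.ℚ λ λ′ → Σ Q.ℚ λ Cₒ →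
    (Q.0ℚ Q.< β) × (Q.0ℚ Q.< δ) × (Q.0ℚ Q.< λ′) × (Q.0ℚ Q.< Cₒ) ×
    ((ℓ n : ℕ) → 1 ≤ n →
    (Cₒ Q.* Cₒ) Q.* ℚ[ n ] Q.≤ ℚ[ ℓ * ℓ ] →
    (P : Pregraph n) →
    e (E P) ≤ ℓ C 2 →
    ((4 * ℓ * n ≤ e (M P)) ⊎
    (((Q.1ℚ Q.- δ) Q.* ℚ[ ℓ * n ] Q.≤ ℚ[ e (M P) ]) ×
    ¬ CloseToK ε ℓ (E P) ×
    (ℚ[ ℓ ] Q.≤ λ′ Q.* ℚ[ n ])) ⊎
    (Σ (VSet n) λ U → (∣ U ∣ᵛ ≡ ℓ) ×
    ((Q.1ℚ Q.- ε) Q.* ℚ[ ℓ C 2 ] Q.≤ ℚ[ eIn (E P) U ]) ×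
    (ℚ[ 49 ] Q.* ε Q.* ℚ[ (ℓ * n) * (ℓ * n) ]
    Q.≤ ℚ[ eIn (M P) (U ᶜ) * eIn (M P) (U ᶜ) ]))) →
    Σ (Fin 3) λ i → Σ (Hyp n) λ H →
    SubHyp P i H ×
    (β Q.* ℚ[ ℓ ^ 4 ] Q.≤ ℚ[ eH H ]) ×
    ((x y : Fin n) → IsMEdge P x y → n * deg01 H x y ≤ ℓ ^ 3) ×
    ((x y u v : Fin n) → IsMEdge P x y → IsMEdge P u v →
    ¬ ((x ≡ u) × (y ≡ v)) → deg02 H x y u v ≤ ℓ) ×
    (0 < toℕ i → (x y : Fin n) → IsMEdge P x y → deg10 P H x y ≤ ℓ ^ 2))
rational-form {p} {d} ε rep b₃ Q₂ z₂ g 1≤b₃ 1≤Q₂ 1≤z₂ 1≤g main = 1/ b₃ , 1/ Q₂ , 1/ z₂ , ℚ[ g ] ,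
  represents-pos (represents-1/ b₃) ≤-refl ,
  represents-pos (represents-1/ Q₂) ≤-refl ,
  represents-pos (represents-1/ z₂) ≤-refl ,
  represents-pos (represents-ℕ g) 1≤g ,
  λ ℓ n 1≤n C²n≤ℓ² P eE cases →
    let i , H , sub , size , rest = main ℓ 1≤n
          (subst (g * g * n ≤_) (*-identityˡ (ℓ * ℓ)) (*-≤⇒ (represents-*ℕ g (represents-ℕ g)) n (ℓ * ℓ) C²n≤ℓ²)) P eE
          (natural-cases ℓ P cases)
    in i , H , sub ,
       ⇒*-≤ (represents-1/ b₃) (ℓ ^ 4) (eH H) (≤-trans (≤-reflexive (*-identityˡ (ℓ ^ 4)))
         (subst (λ s → ℓ ^ 4 ≤ s * eH H) (sym (1≤⇒suc-pred 1≤b₃)) size)) ,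
       rest
  where
  natural-cases : ∀ {n} ℓ (P : Pregraph n) →
    ((4 * ℓ * n ≤ e (M P)) ⊎
    (((Q.1ℚ Q.- (1/ Q₂)) Q.* ℚ[ ℓ * n ] Q.≤ ℚ[ e (M P) ]) ×
    ¬ CloseToK ε ℓ (E P) ×
    (ℚ[ ℓ ] Q.≤ (1/ z₂) Q.* ℚ[ n ])) ⊎
    (Σ (VSet n) λ U → (∣ U ∣ᵛ ≡ ℓ) ×
    ((Q.1ℚ Q.- ε) Q.* ℚ[ ℓ C 2 ] Q.≤ ℚ[ eIn (E P) U ]) ×
    (ℚ[ 49 ] Q.* ε Q.* ℚ[ (ℓ * n) * (ℓ * n) ]
    Q.≤ ℚ[ eIn (M P) (U ᶜ) * eIn (M P) (U ᶜ) ]))) → Cases p (suc d) Q₂ z₂ ℓ P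
  natural-cases ℓ P (inj₁ h) = inj₁ h
  natural-cases {n} ℓ P (inj₂ (inj₁ (eM , far , ℓ≤λn))) = inj₂ (inj₁ (
    subst (λ s → s * (ℓ * n) ≤ s * e (M P) + ℓ * n) (1≤⇒suc-pred 1≤Q₂)
      (≤-trans (1-*-≤⇒ (represents-1/ Q₂) (ℓ * n) (e (M P)) eM) (+-monoʳ-≤ (suc (pred Q₂) * e (M P)) (≤-reflexive (*-identityˡ (ℓ * n))))) ,
    (λ (W , w , h) → far (W , w , ⇒≤-* rep (ℓ C 2) (symDiffK (E P) W) h)) ,
    subst (λ s → s * ℓ ≤ n) (1≤⇒suc-pred 1≤z₂) (≤-trans (≤-*⇒ (represents-1/ z₂) n ℓ ℓ≤λn) (≤-reflexive (*-identityˡ n)))))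
  natural-cases {n} ℓ P (inj₂ (inj₂ (U , _ , hE , hM))) = inj₂ (inj₂ (U ,
    1-*-≤⇒ rep (ℓ C 2) (eIn (E P) U) hE ,
    *-≤⇒ (represents-*ℕ 49 rep) (ℓ * n * (ℓ * n)) (eIn (M P) (U ᶜ) * eIn (M P) (U ᶜ)) hM))

theorem3p1 : (ε : Q.ℚ) → Q.0ℚ Q.< ε →
    Σ Q.ℚ λ β → Σ Q.ℚ λ δ → Σ Q.ℚ λ λ′ → Σ Q.ℚ λ Cₒ →
    (Q.0ℚ Q.< β) × (Q.0ℚ Q.< δ) × (Q.0ℚ Q.< λ′) × (Q.0ℚ Q.< Cₒ) ×
    ((ℓ n : ℕ) → 1 ≤ n →
    -- ℓ ≥ C √n
    (Cₒ Q.* Cₒ) Q.* ℚ[ n ] Q.≤ ℚ[ ℓ * ℓ ] →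
    (P : Pregraph n) →
    e (E P) ≤ ℓ C 2 →
    -- (M1)
    ((4 * ℓ * n ≤ e (M P)) ⊎
    -- (M2)
    (((Q.1ℚ Q.- δ) Q.* ℚ[ ℓ * n ] Q.≤ ℚ[ e (M P) ]) ×
    ¬ CloseToK ε ℓ (E P) ×
    (ℚ[ ℓ ] Q.≤ λ′ Q.* ℚ[ n ])) ⊎
    -- (M3)  (e_M(Uᶜ) ≥ 7 √ε ℓ n, squared)
    (Σ (VSet n) λ U → (∣ U ∣ᵛ ≡ ℓ) ×
    ((Q.1ℚ Q.- ε) Q.* ℚ[ ℓ C 2 ] Q.≤ ℚ[ eIn (E P) U ]) ×
    (ℚ[ 49 ] Q.* ε Q.* ℚ[ (ℓ * n) * (ℓ * n) ]
    Q.≤ ℚ[ eIn (M P) (U ᶜ) * eIn (M P) (U ᶜ) ]))) →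
    Σ (Fin 3) λ i → Σ (Hyp n) λ H →
    SubHyp P i H ×
    (β Q.* ℚ[ ℓ ^ 4 ] Q.≤ ℚ[ eH H ]) ×
    -- Δ_(0,1)(H) ≤ ℓ³ / n
    ((x y : Fin n) → IsMEdge P x y → n * deg01 H x y ≤ ℓ ^ 3) ×
    -- Δ_(0,2)(H) ≤ ℓ
    ((x y u v : Fin n) → IsMEdge P x y → IsMEdge P u v →
    ¬ ((x ≡ u) × (y ≡ v)) → deg02 H x y u v ≤ ℓ) ×
    -- if i > 0 then Δ_(1,0)(H) ≤ ℓ²
    (0 < toℕ i → (x y : Fin n) → IsMEdge P x y → deg10 P H x y ≤ ℓ ^ 2))
theorem3p1 ε@(Q.mkℚ (ℤ.+ p) d _) 0<ε = rational-form {p} {d} ε ℚᵘ.≃-refl (3 * b) (2 * Qₒ) (2 * z) g 1≤3b 1≤2Q 1≤2z 1≤g main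
  where
  open Constants (suc d)
  1≤p : 1 ≤ p
  1≤p = ℤ.drop‿+<+ (subst (ℤ._<_ (ℤ.+ 0)) (ℤ.*-identityʳ (ℤ.+ p)) (ℚᵘ.drop-*<* (Q.toℚᵘ-mono-< 0<ε)))
  open NaturalNumbers p (suc d) 1≤p (s≤s z≤n)
theorem3p1 (Q.mkℚ ℤ.-[1+ p ] d _) (Q.*<* ())
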